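{- For every real $\epsilon>0$ there exists a number $n_\epsilon$ such that the following holds: if $G$ is a graph of order at least $n_\epsilon$ and average degree at least $14+\epsilon$, then $G$ contains two vertex-disjoint cycles whose lengths are $2r$ and $2r+2$ for some integer $r\geq 2$.
   Context: All graphs are finite and simple. -}

module Defs where

open import Data.Nat using (ℕ; zero; suc; _+_; _*_; _≤_; _<_)
open import Data.Fin using (Fin; toℕ)
open import Data.Bool using (Bool; true; false)
open import Data.List using (List; map)
open import Data.Nat.ListAction using (sum)
open import Data.List using (allFin)
open import Data.Product using (Σ; _×_; ∃; ∃-syntax; _,_)
open import Data.Sum using (_⊎_)
open import Relation.Binary.PropositionalEquality using (_≡_; _≢_)
open import Relation.Nullary using (¬_)
open import Function.Definitions using (Injective)

record Graph (n : ℕ) : Set where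
  field
    adj   : Fin n → Fin n → Bool
    sym   : ∀ i j → adj i j ≡ adj j i
    irref : ∀ i → adj i i ≡ false
open Graph public

b2n : Bool → ℕ
b2n true  = 1
b2n false = 0

degree : ∀ {n} → Graph n → Fin n → ℕ
degree {n} G i = sum (map (λ j → b2n (adj G i j)) (allFin n))

degreeSum : ∀ {n} → Graph n → ℕ
degreeSum {n} G = sum (map (degree G) (allFin n))

-- "average degree of G is at least 14 + p/q" (q > 0), i.e.
-- degreeSum G / n ≥ 14 + p/q, cleared of denominators:
-- q * degreeSum G ≥ (14 * q + p) * n.
AvgDegreeAtLeast14Plus : ∀ {n} → Graph n → (p q : ℕ) → Set
AvgDegreeAtLeast14Plus {n} G p q = (14 * q + p) * n ≤ q * degreeSum G

IsCycle : ∀ {n} → Graph n → (k : ℕ) → (Fin k → Fin n) → Set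
IsCycle G k c =
  3 ≤ k × Injective _≡_ _≡_ c ×
  (∀ (i j : Fin k) →
     (suc (toℕ i) ≡ toℕ j ⊎ (suc (toℕ i) ≡ k × toℕ j ≡ 0)) →
     adj G (c i) (c j) ≡ true)

Disjoint : ∀ {n k l} → (Fin k → Fin n) → (Fin l → Fin n) → Set
Disjoint c d = ∀ i j → c i ≢ d j

HasConsecutiveEvenCycles : ∀ {n} → Graph n → Set
HasConsecutiveEvenCycles G =
  ∃[ r ] (2 ≤ r × ∃[ c ] ∃[ d ]
    (IsCycle G (2 * r) c × IsCycle G (2 * r + 2) d × Disjoint c d))

module Submission where

-- Call a vertex set an even pair if it contains cycles of lengths 2r and 2r+2 with r at most a polylogarithm L of n.
-- Disjoint even pairs are collected greedily; two of them with the same r prove the theorem, so otherwise a set S of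
-- polylogarithmic size meets every even pair.  A bipartite graph with more than (2+δ)h edges on h vertices contains an
-- even pair; hence, off S, every bipartite graph has density at most 2+δ and every graph density at most 4+2δ.
-- Now count edges.  Almost no vertex has 5 neighbours in S, since K(5,5) contains disjoint cycles of lengths 4 and 6.
-- If almost no vertex has 4, there are at most (3+4+o(1))n edges.  Otherwise K(4,9) is available, and two further
-- edges inside the set W of vertices with at least 2 neighbours in S create a hexagon disjoint from some square; so W
-- spans almost no edges, and with w = |W| and r the number of remaining vertices off S there are at most
-- (4w + r) + 2(w + r) + 4r + o(n) ≤ (7+o(1))n edges.
--
-- For the bipartite statement take a minimal H whose density exceeds 2 by a term growing slowly with |H|.  Then H
-- expands, every nonempty X ⊆ H touches more than 2|X| edges, and H stays of small diameter when a small set is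
-- deleted and its giant component is kept.  Let D be maximal among the connected subsets whose complement M in H
-- contains a cycle, and let C, of length 2m, be a shortest cycle in M.  Every vertex of M attached to D lies on all
-- cycles of M.  If two attached vertices are m - 1 apart on C, a path through D closes both arcs between them to cycles
-- whose lengths differ by 2.  Otherwise at most m vertices are attached, and counting the edges that touch the
-- remaining vertices of M contradicts that M minus an attached vertex is a forest.
--
-- Existence statements are obtained only up to double negation; this suffices as the conclusion is decidable.

open import Defs renaming (sym to adj-sym; irref to adj-irrefl)
open import Data.Bool using (Bool; true; false; if_then_else_)
import Data.Bool.Properties as Bool
open import Data.Empty using (⊥; ⊥-elim)
open import Data.Fin using (Fin; zero; suc; toℕ; fromℕ<)
import Data.Fin.Properties as Fin
open import Data.List
  using (List; []; _∷_; [_]; _++_; length; reverse; lookup; map; tabulate; allFin; take; drop; filter)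
open import Data.List.Membership.DecPropositional using () renaming (_∈?_ to mem-dec)
open import Data.List.Membership.Propositional using () renaming (_∈_ to _∈ˡ_)
open import Data.List.Membership.Propositional.Properties
  using (∈-++⁺ˡ; ∈-++⁺ʳ; ∈-++⁻; ∈-lookup; ∈-filter⁺; ∈-tabulate⁺)
open import Data.List.Properties
  using (unfold-reverse; ++-assoc; length-++; length-reverse; length-take; length-drop; length-tabulate;
         take++drop≡id; filter-++; map-tabulate)
open import Data.List.Relation.Unary.All as All using (All; []; _∷_)
import Data.List.Relation.Unary.All.Properties as All
open import Data.List.Relation.Unary.AllPairs using ([]; _∷_)
open import Data.List.Relation.Unary.Any using (here; there)
open import Data.List.Relation.Unary.Any.Properties using (reverse⁻)
open import Data.List.Relation.Unary.Unique.Propositional using (Unique)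
import Data.List.Relation.Unary.Unique.Propositional.Properties as Unique
open import Data.Nat
import Data.Nat.ListAction as ListAction
open import Data.Nat.Logarithm using (⌊log₂_⌋; ⌊log₂⌋-mono-≤; ⌊log₂[2*b]⌋≡1+⌊log₂b⌋; ⌊log₂[2^n]⌋≡n)
open import Data.Nat.Properties
open import Data.Nat.Tactic.RingSolver using (solve-∀)
open import Data.Product hiding (map)
open import Data.Sum as Sum using (_⊎_; inj₁; inj₂; [_,_]′)
open import Data.Unit using (tt)
open import Function using (_∘_; id; flip)
open import Relation.Binary.PropositionalEquality hiding ([_])
open import Relation.Nullary
open import Relation.Nullary.Decidable using (_×-dec_; _⊎-dec_; _→-dec_; ¬?; does; map′; decidable-stable)
open import Algebra.Properties.Semiring.Sum +-*-semiring
  using (sum; sum-cong-≗; ∑-distrib-+; ∑-comm; *-distribˡ-sum)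

private variable
  n : ℕ
  Φ Ψ Ω : Set

-- Certificate checker for linear consequences: a ≤ b follows from p ≤ q once a + q + c and b + p agree.
≤-cert : ∀ {a b p q} c → p ≤ q → a + q + c ≡ b + p → a ≤ b
≤-cert {a} {b} {p} {q} c p≤q eq = +-cancelʳ-≤ q a b (begin
  a + q      ≤⟨ m≤m+n (a + q) c ⟩
  a + q + c  ≡⟨ eq ⟩
  b + p      ≤⟨ +-monoʳ-≤ b p≤q ⟩
  b + q      ∎)
  where open ≤-Reasoning

⊥-cert : ∀ {p q} c → p ≤ q → 1 + q + c ≡ p → ⊥
⊥-cert c p≤q eq with ≤-cert {1} {0} c p≤q eq
... | ()

-- Indicators, sums and finite sets

⟦_⟧ : Dec Φ → ℕ
⟦ d ⟧ = b2n (does d)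

⟦⟧-yes : (d : Dec Φ) → Φ → ⟦ d ⟧ ≡ 1
⟦⟧-yes (yes _) _ = refl
⟦⟧-yes (no ¬p) p = ⊥-elim (¬p p)

⟦⟧-no : (d : Dec Φ) → ¬ Φ → ⟦ d ⟧ ≡ 0
⟦⟧-no (yes p) ¬p = ⊥-elim (¬p p)
⟦⟧-no (no _) _ = refl

⟦⟧-mono : (d : Dec Φ) (e : Dec Ψ) → (Φ → Ψ) → ⟦ d ⟧ ≤ ⟦ e ⟧
⟦⟧-mono (no _)  e f = z≤n
⟦⟧-mono (yes p) e f = ≤-reflexive (sym (⟦⟧-yes e (f p)))

⟦⟧-cover : (d : Dec Φ) (e : Dec Ψ) (f : Dec Ω) → (Φ → Ψ ⊎ Ω) → ⟦ d ⟧ ≤ ⟦ e ⟧ + ⟦ f ⟧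
⟦⟧-cover (no _)  e f h = z≤n
⟦⟧-cover (yes p) e f h with h p
... | inj₁ q = ≤-trans (≤-reflexive (sym (⟦⟧-yes e q))) (m≤m+n _ _)
... | inj₂ r = ≤-trans (≤-reflexive (sym (⟦⟧-yes f r))) (m≤n+m _ _)

⟦⟧-pack : (d : Dec Φ) (e : Dec Ψ) (f : Dec Ω) →
  (Ψ → Φ) → (Ω → Φ) → (Ψ → Ω → ⊥) → ⟦ e ⟧ + ⟦ f ⟧ ≤ ⟦ d ⟧
⟦⟧-pack d (no _)  f q→p r→p excl = ⟦⟧-mono f d r→p
⟦⟧-pack d (yes q) f q→p r→p excl =
  subst (λ z → 1 + z ≤ ⟦ d ⟧) (sym (⟦⟧-no f (excl q))) (≤-reflexive (sym (⟦⟧-yes d (q→p q))))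

⟦⟧-split : (d : Dec Φ) (e : Dec Ψ) (f : Dec Ω) →
  (Φ → Ψ ⊎ Ω) → (Ψ → Φ) → (Ω → Φ) → (Ψ → Ω → ⊥) → ⟦ d ⟧ ≡ ⟦ e ⟧ + ⟦ f ⟧
⟦⟧-split d e f h q→p r→p excl = ≤-antisym (⟦⟧-cover d e f h) (⟦⟧-pack d e f q→p r→p excl)

sum-mono : {f g : Fin n → ℕ} → (∀ x → f x ≤ g x) → sum f ≤ sum g
sum-mono {zero}  h = z≤n
sum-mono {suc n} h = +-mono-≤ (h zero) (sum-mono (h ∘ suc))

sum-0 : {f : Fin n → ℕ} → (∀ x → f x ≡ 0) → sum f ≡ 0
sum-0 {zero}  h = refl
sum-0 {suc n} h = cong₂ _+_ (h zero) (sum-0 (h ∘ suc))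

sum-δ : (f : Fin n → ℕ) (v : Fin n) → (∀ x → x ≢ v → f x ≡ 0) → sum f ≡ f v
sum-δ {suc n} f zero h =
  trans (cong (f zero +_) (sum-0 (λ x → h (suc x) λ ()))) (+-identityʳ _)
sum-δ {suc n} f (suc v) h =
  trans (cong (_+ sum (f ∘ suc)) (h zero λ ()))
        (sum-δ (f ∘ suc) v (λ x x≢v → h (suc x) (x≢v ∘ Fin.suc-injective)))

sum-≤* : (f g : Fin n → ℕ) (k : ℕ) → (∀ x → f x ≤ k * g x) → sum f ≤ k * sum g
sum-≤* f g k h = ≤-trans (sum-mono h) (≤-reflexive (sym (*-distribˡ-sum k g)))

-- A subset is a decidable predicate, so that membership in a compound set computes to a proposition.
record Sub (n : ℕ) : Set₁ where
  constructor ⟪_⟫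
  field
    {mem} : Fin n → Set
    mem?  : ∀ x → Dec (mem x)
open Sub

infix 4 _∈_ _∉_ _⊆_
_∈_ _∉_ : Fin n → Sub n → Set
x ∈ X = mem X x
x ∉ X = ¬ (x ∈ X)

_⊆_ : Sub n → Sub n → Set
X ⊆ Y = ∀ {x} → x ∈ X → x ∈ Y

∣_∣ : Sub n → ℕ
∣ X ∣ = sum (λ x → ⟦ mem? X x ⟧)

infixl 6 _∖_ _∪_ _∩_ _-ˢ_
_∖_ _∪_ _∩_ : Sub n → Sub n → Sub n
X ∖ Y = ⟪ (λ x → mem? X x ×-dec ¬? (mem? Y x)) ⟫
X ∪ Y = ⟪ (λ x → mem? X x ⊎-dec mem? Y x) ⟫
X ∩ Y = ⟪ (λ x → mem? X x ×-dec mem? Y x) ⟫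

⁅_⁆ : Fin n → Sub n
⁅ v ⁆ = ⟪ (λ x → x Fin.≟ v) ⟫

_-ˢ_ : Sub n → Fin n → Sub n
X -ˢ v = X ∖ ⁅ v ⁆

full : Sub n
full = ⟪ (λ _ → yes tt) ⟫

⟨_⟩ : List (Fin n) → Sub n
⟨ l ⟩ = ⟪ (λ x → mem-dec Fin._≟_ x l) ⟫

∣∣-mono : (X Y : Sub n) → X ⊆ Y → ∣ X ∣ ≤ ∣ Y ∣
∣∣-mono X Y h = sum-mono λ x → ⟦⟧-mono (mem? X x) (mem? Y x) h

∣∣-split : (X Y Z : Sub n) → (∀ {x} → x ∈ X → x ∈ Y ⊎ x ∈ Z) → Y ⊆ X → Z ⊆ X →
  (∀ {x} → x ∈ Y → x ∈ Z → ⊥) → ∣ X ∣ ≡ ∣ Y ∣ + ∣ Z ∣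
∣∣-split X Y Z h k l m = trans
  (sum-cong-≗ λ x → ⟦⟧-split (mem? X x) (mem? Y x) (mem? Z x) h k l m)
  (∑-distrib-+ (λ x → ⟦ mem? Y x ⟧) (λ x → ⟦ mem? Z x ⟧))

∣∣-cover : (X Y Z : Sub n) → (∀ {x} → x ∈ X → x ∈ Y ⊎ x ∈ Z) → ∣ X ∣ ≤ ∣ Y ∣ + ∣ Z ∣
∣∣-cover X Y Z h = ≤-trans
  (sum-mono λ x → ⟦⟧-cover (mem? X x) (mem? Y x) (mem? Z x) h)
  (≤-reflexive (∑-distrib-+ (λ x → ⟦ mem? Y x ⟧) (λ x → ⟦ mem? Z x ⟧)))

∣∣-pack : (X Y Z : Sub n) → Y ⊆ X → Z ⊆ X → (∀ {x} → x ∈ Y → x ∈ Z → ⊥) → ∣ Y ∣ + ∣ Z ∣ ≤ ∣ X ∣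
∣∣-pack X Y Z k l m = ≤-trans
  (≤-reflexive (sym (∑-distrib-+ (λ x → ⟦ mem? Y x ⟧) (λ x → ⟦ mem? Z x ⟧))))
  (sum-mono λ x → ⟦⟧-pack (mem? X x) (mem? Y x) (mem? Z x) k l m)

∣∖∣ : (X Y : Sub n) → Y ⊆ X → ∣ X ∣ ≡ ∣ Y ∣ + ∣ X ∖ Y ∣
∣∖∣ X Y h = ∣∣-split X Y (X ∖ Y)
  (λ {x} x∈X → case (mem? Y x) x∈X) h proj₁ (λ y → λ (_ , ¬y) → ¬y y)
  where
  case : ∀ {x} → Dec (x ∈ Y) → x ∈ X → x ∈ Y ⊎ x ∈ (X ∖ Y)
  case (yes y) _ = inj₁ y
  case (no ¬y) x = inj₂ (x , ¬y)

∣⁅⁆∣ : (v : Fin n) → ∣ ⁅ v ⁆ ∣ ≡ 1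
∣⁅⁆∣ v = trans (sum-δ _ v (λ x x≢v → ⟦⟧-no (x Fin.≟ v) x≢v)) (⟦⟧-yes (v Fin.≟ v) refl)

∣-∣ : (X : Sub n) {v : Fin n} → v ∈ X → ∣ X ∣ ≡ suc ∣ X -ˢ v ∣
∣-∣ X {v} v∈X = trans (∣∖∣ X ⁅ v ⁆ λ { refl → v∈X }) (cong (_+ ∣ X -ˢ v ∣) (∣⁅⁆∣ v))

∈⇒1≤∣∣ : (X : Sub n) {v : Fin n} → v ∈ X → 1 ≤ ∣ X ∣
∈⇒1≤∣∣ X v∈X = ≤-trans (s≤s z≤n) (≤-reflexive (sym (∣-∣ X v∈X)))

∣full∣ : ∀ n → ∣ full {n} ∣ ≡ n
∣full∣ zero = refl
∣full∣ (suc n) = cong suc (∣full∣ n)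

∣∣≤n : (X : Sub n) → ∣ X ∣ ≤ n
∣∣≤n {n} X = subst (∣ X ∣ ≤_) (∣full∣ n) (∣∣-mono X full _)

∣∣≡0 : (X : Sub n) → (∀ {x} → x ∉ X) → ∣ X ∣ ≡ 0
∣∣≡0 X h = sum-0 λ x → ⟦⟧-no (mem? X x) h

inhabited : (X : Sub n) → 1 ≤ ∣ X ∣ → ∃[ x ] x ∈ X
inhabited X h with Fin.any? (mem? X)
... | yes p = p
... | no ¬p with subst (1 ≤_) (∣∣≡0 X (λ {x} x∈ → ¬p (x , x∈))) h
... | ()

∣⟨⟩∣ : (l : List (Fin n)) → ∣ ⟨ l ⟩ ∣ ≤ length l
∣⟨⟩∣ {n} [] = ≤-reflexive (∣∣≡0 {n} ⟨ [] ⟩ λ ())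
∣⟨⟩∣ (x ∷ l) = ≤-trans
  (∣∣-cover ⟨ x ∷ l ⟩ ⁅ x ⁆ ⟨ l ⟩ λ { (here e) → inj₁ e ; (there p) → inj₂ p })
  (+-mono-≤ (≤-reflexive (∣⁅⁆∣ x)) (∣⟨⟩∣ l))

∣⟨⟩∣-Unique : (l : List (Fin n)) → Unique l → ∣ ⟨ l ⟩ ∣ ≡ length l
∣⟨⟩∣-Unique {n} [] _ = ∣∣≡0 {n} ⟨ [] ⟩ λ ()
∣⟨⟩∣-Unique (x ∷ l) u@(_ ∷ ul) = trans
  (∣∣-split ⟨ x ∷ l ⟩ ⁅ x ⁆ ⟨ l ⟩ (λ { (here e) → inj₁ e ; (there p) → inj₂ p })
    (λ { refl → here refl }) there (λ { refl p → Unique.Unique[x∷xs]⇒x∉xs u p }))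
  (cong₂ _+_ (∣⁅⁆∣ x) (∣⟨⟩∣-Unique l ul))

Unique⇒length≤ : (X : Sub n) {l : List (Fin n)} → Unique l → All (_∈ X) l → length l ≤ ∣ X ∣
Unique⇒length≤ X {l} u a =
  subst (_≤ ∣ X ∣) (∣⟨⟩∣-Unique l u) (∣∣-mono ⟨ l ⟩ X (All.lookup a))

pick : (X : Sub n) (l : List (Fin n)) → length l < ∣ X ∣ → ∃[ x ] x ∈ X × ¬ (x ∈ˡ l)
pick X l h with Fin.any? (mem? (X ∖ ⟨ l ⟩))
... | yes p = p
... | no ¬p = ⊥-elim (<-irrefl refl (<-≤-trans h (≤-trans (∣∣-mono X ⟨ l ⟩ sub) (∣⟨⟩∣ l))))
  where
  sub : X ⊆ ⟨ l ⟩
  sub {x} x∈X with mem-dec Fin._≟_ x l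
  ... | yes q = q
  ... | no ¬q = ⊥-elim (¬p (x , x∈X , ¬q))

-- Since `Φ` need not be decidable, a least witness is available only to a proof of `⊥`; the
-- recursion is on a bound for the size.
minimal : ∀ {a ℓ} {A : Set a} (size : A → ℕ) (Φ : A → Set ℓ) (x : A) → Φ x →
  ((y : A) → Φ y → (∀ z → size z < size y → ¬ Φ z) → ⊥) → ⊥
minimal size Φ x Φx k = go (suc (size x)) x ≤-refl Φx
  where
  go : ∀ m y → size y < m → ¬ Φ y
  go zero    y ()
  go (suc m) y (s≤s h) Φy = k y Φy λ z z<y → go m z (<-≤-trans z<y h)

⊆-∣∣⇒⊇ : (X Y : Sub n) → X ⊆ Y → ∣ Y ∣ ≤ ∣ X ∣ → Y ⊆ X
⊆-∣∣⇒⊇ X Y X⊆Y h {y} y∈Y with mem? X y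
... | yes y∈X = y∈X
... | no y∉X = ⊥-elim (<-irrefl refl (begin-strict
  ∣ X ∣         ≤⟨ ∣∣-mono X (Y -ˢ y) (λ x∈X → X⊆Y x∈X , λ { refl → y∉X x∈X }) ⟩
  ∣ Y -ˢ y ∣    <⟨ ≤-refl ⟩
  suc ∣ Y -ˢ y ∣ ≡⟨ sym (∣-∣ Y y∈Y) ⟩
  ∣ Y ∣         ≤⟨ h ⟩
  ∣ X ∣         ∎))
  where open ≤-Reasoning

infixl 6 _⊕_
_⊕_ : ∀ {a b c d} → a ≤ b → c ≤ d → a + c ≤ b + d
_⊕_ = +-mono-≤

infixr 7 _⊛_
_⊛_ : ∀ k {a b} → a ≤ b → k * a ≤ k * b
k ⊛ h = *-monoʳ-≤ k h

pairs : {R : Fin n → Fin n → Set} → (∀ x y → Dec (R x y)) → ℕ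
pairs R? = sum λ x → sum λ y → ⟦ R? x y ⟧

module _ {R S : Fin n → Fin n → Set}
  (R? : ∀ x y → Dec (R x y)) (S? : ∀ x y → Dec (S x y)) where

  pairs-mono : (∀ {x y} → R x y → S x y) → pairs R? ≤ pairs S?
  pairs-mono h = sum-mono λ x → sum-mono λ y → ⟦⟧-mono (R? x y) (S? x y) h

  module _ {T : Fin n → Fin n → Set} (T? : ∀ x y → Dec (T x y)) where

    pairs-+ : sum (λ x → sum λ y → ⟦ S? x y ⟧ + ⟦ T? x y ⟧) ≡ pairs S? + pairs T?
    pairs-+ = trans
      (sum-cong-≗ λ x → ∑-distrib-+ (λ y → ⟦ S? x y ⟧) (λ y → ⟦ T? x y ⟧))
      (∑-distrib-+ (λ x → sum λ y → ⟦ S? x y ⟧) (λ x → sum λ y → ⟦ T? x y ⟧))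

    pairs-cover : (∀ {x y} → R x y → S x y ⊎ T x y) → pairs R? ≤ pairs S? + pairs T?
    pairs-cover h = ≤-trans
      (sum-mono λ x → sum-mono λ y → ⟦⟧-cover (R? x y) (S? x y) (T? x y) h)
      (≤-reflexive pairs-+)

    pairs-split : (∀ {x y} → R x y → S x y ⊎ T x y) → (∀ {x y} → S x y → R x y) →
      (∀ {x y} → T x y → R x y) → (∀ {x y} → S x y → T x y → ⊥) → pairs R? ≡ pairs S? + pairs T?
    pairs-split h k l m = trans
      (sum-cong-≗ λ x → sum-cong-≗ λ y → ⟦⟧-split (R? x y) (S? x y) (T? x y) h k l m)
      pairs-+

pairs-swap : {R : Fin n → Fin n → Set} (R? : ∀ x y → Dec (R x y)) → pairs R? ≡ pairs (flip R?)
pairs-swap R? = ∑-comm λ x y → ⟦ R? x y ⟧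

pairs-row : (v : Fin n) (X : Sub n) → pairs (λ x y → x Fin.≟ v ×-dec mem? X y) ≡ ∣ X ∣
pairs-row v X = trans
  (sum-δ _ v λ x x≢v → sum-0 λ y → ⟦⟧-no (x Fin.≟ v ×-dec mem? X y) (x≢v ∘ proj₁))
  (sum-cong-≗ λ y → ≤-antisym
    (⟦⟧-mono (v Fin.≟ v ×-dec mem? X y) (mem? X y) proj₂)
    (⟦⟧-mono (mem? X y) (v Fin.≟ v ×-dec mem? X y) (refl ,_)))

-- Inequalities used in the edge counts

2+a+sb≡3+[a+b] : ∀ a b → 2 + a + suc b ≡ 3 + (a + b)
2+a+sb≡3+[a+b] = solve-∀

2+a+b+sk≡3+[a+b+k] : ∀ a b k → 2 + a + b + suc k ≡ 3 + (a + b + k)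
2+a+b+sk≡3+[a+b+k] = solve-∀

-- Two vertices cut a cycle of length 2m into arcs with `d` and `a + b` inner vertices. For m =
-- `2 + d` the second arc, ends included, has m + 2 vertices and the first has m; `shortArc-length`
-- treats m = `d`, where the roles are exchanged.
longArc-length : ∀ a b d → a + (2 + d + b) ≡ 2 * (2 + d) → 2 + b + a ≡ 4 + d
longArc-length a b d h = +-cancelʳ-≡ d _ _ (trans (r₁ a b d) (trans h (r₂ d)))
  where
  r₁ : ∀ a b d → 2 + b + a + d ≡ a + (2 + d + b)
  r₁ = solve-∀
  r₂ : ∀ d → 2 * (2 + d) ≡ 4 + d + d
  r₂ = solve-∀

4+d+k≡2+d+k+2 : ∀ d k → 4 + d + k ≡ 2 + d + k + 2
4+d+k≡2+d+k+2 = solve-∀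

shortArc-length : ∀ a b d → a + (2 + d + b) ≡ 2 * d → 2 + b + a ≡ d
shortArc-length a b d h = +-cancelʳ-≡ d _ _ (trans (r₁ a b d) (trans h (r₂ d)))
  where
  r₁ : ∀ a b d → 2 + b + a + d ≡ a + (2 + d + b)
  r₁ = solve-∀
  r₂ : ∀ d → 2 * d ≡ d + d
  r₂ = solve-∀

2+d+k≡d+k+2 : ∀ d k → 2 + d + k ≡ d + k + 2
2+d+k≡d+k+2 = solve-∀

degree-excess : ∀ k f b′ b eB d → f < b′ → suc b′ ≤ b → b + k ≤ eB → eB ≤ f + d → 2 + k ≤ d
degree-excess k f b′ b eB d h₁ h₂ h₃ h₄ = ≤-cert 0 (h₁ ⊕ h₂ ⊕ h₃ ⊕ h₄) (eq f b′ b eB d k)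
  where
  eq : ∀ f b′ b eB d k → 2 + k + (b′ + b + eB + (f + d)) + 0 ≡ d + (suc f + suc b′ + (b + k) + eB)
  eq = solve-∀

1+2b≤2f⇒2[b+1]≤2f : ∀ b f → suc (2 * b) ≤ f + f → 2 * (b + 1) ≤ 2 * f
1+2b≤2f⇒2[b+1]≤2f b f h with f ≤? b
... | yes f≤b = ⊥-elim (⊥-cert 0 (h ⊕ 2 ⊛ f≤b) (eq b f))
  where
  eq : ∀ b f → 1 + (f + f + 2 * b) + 0 ≡ suc (2 * b) + 2 * f
  eq = solve-∀
... | no f≰b = *-monoʳ-≤ 2 (≤-trans (≤-reflexive (+-comm b 1)) (≰⇒> f≰b))

-- With `suc k` more edges than vertices and all degrees at least `2 + suc k`, the degree sum is too
-- large once there are three vertices.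
excess-absurd : ∀ k b → 3 ≤ b → (2 + suc k) * b ≤ b + suc k + (b + suc k) → ⊥
excess-absurd k b h₁ h = ⊥-cert k (suc k ⊛ h₁ ⊕ h) (eq k b)
  where
  eq : ∀ k b → 1 + (suc k * b + (b + suc k + (b + suc k))) + k ≡ suc k * 3 + (2 + suc k) * b
  eq = solve-∀

half-complement : ∀ ν β r x → 2 * ν ≤ β → 1 ≤ β → β + r ≤ ν + x → 1 ≤ x
half-complement _ _ _ (suc x) _ _ _ = s≤s z≤n
half-complement ν β r zero h₁ h₂ h₃ = ⊥-elim (⊥-cert (2 * r) (h₁ ⊕ h₂ ⊕ 2 ⊛ h₃) (eq ν β r))
  where
  eq : ∀ ν β r → 1 + (β + β + 2 * (ν + 0)) + 2 * r ≡ 2 * ν + 1 + 2 * (β + r)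
  eq = solve-∀

-- The hypotheses bound `f + d`, the number of edges outside `D`, by `β + 2 * r`, while `2 * ν ≤ β`
-- makes `2 * x` at least `β + 2 * r`.
forest-count : ∀ x f d μ′ db r ν β → 2 * x < f + d → f < μ′ → d ≤ db + r → db ≤ 2 → 2 * ν ≤ β →
  suc μ′ ≡ β + r → β + r ≡ ν + x → ⊥
forest-count x f d μ′ db r ν β h₁ h₂ h₃ h₄ h₅ h₆ h₇ =
  ⊥-cert 0 (h₁ ⊕ h₂ ⊕ h₃ ⊕ h₄ ⊕ h₅ ⊕ ≤-reflexive h₆ ⊕ 2 ⊛ ≤-reflexive h₇) (eq x f d μ′ db r ν β)
  where
  eq : ∀ x f d μ′ db r ν β →
    1 + (f + d + μ′ + (db + r) + 2 + β + (β + r) + 2 * (ν + x)) + 0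
    ≡ suc (2 * x) + suc f + d + db + 2 * ν + suc μ′ + 2 * (β + r)
  eq = solve-∀

dense-count : ∀ E l x z f → E * f ≤ (2 * E + l) * z → E * (2 * x + f) ≤ (2 * E + l) * (x + z)
dense-count E l x z f p = ≤-cert (l * x) p (eq E l x z f)
  where
  eq : ∀ E l x z f → E * (2 * x + f) + (2 * E + l) * z + l * x ≡ (2 * E + l) * (x + z) + E * f
  eq = solve-∀

connected-count : ∀ E l a z h f g → h ≡ a + z → E * f ≤ (2 * E + l) * a → E * g ≤ (2 * E + l) * z →
  E * (f + g) ≤ (2 * E + l) * h
connected-count E l a z h f g refl p q = ≤-cert 0 (p ⊕ q) (eq E l a z f g)
  where
  eq : ∀ E l a z f g → E * (f + g) + ((2 * E + l) * a + (2 * E + l) * z) + 0 ≡ (2 * E + l) * (a + z) + (E * f + E * g)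
  eq = solve-∀

-- The terms in `z` cancel. The level of the set with its boundary is lower by one, which gains `x`
-- at a cost of `(2 * E + l) * ν`.
expansion-count : ∀ E l x z ν f g k → (2 * E + suc l) * (x + z) < E * k → E * k ≤ E * (f + g) →
  E * f ≤ (2 * E + suc l) * z → E * g ≤ (2 * E + l) * (x + ν) → ν * l ≤ ν * E → x < 3 * E * ν
expansion-count E l x z ν f g k h₁ h₂ h₃ h₄ h₅ = ≤-cert 0 (h₁ ⊕ h₂ ⊕ h₃ ⊕ h₄ ⊕ h₅) (eq E l x z ν f g k)
  where
  eq : ∀ E l x z ν f g k →
    suc x + (E * k + E * (f + g) + (2 * E + suc l) * z + (2 * E + l) * (x + ν) + ν * E) + 0
    ≡ 3 * E * ν + (suc ((2 * E + suc l) * (x + z)) + E * k + E * f + E * g + ν * l)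
  eq = solve-∀

giant-room : ∀ E b h a → 4 * ((6 * E + 1) * b) ≤ 3 * h → ∀ {b′} → h ≤ b′ + a → b′ ≤ b → 3 * (3 * E * b) ≤ 3 * a
giant-room E b h a h₁ {b′} h₂ h₃ = ≤-cert (15 * E * b + b) (h₁ ⊕ 3 ⊛ h₂ ⊕ 3 ⊛ h₃) (eq E b h a b′)
  where
  eq : ∀ E b h a b′ → 3 * (3 * E * b) + (3 * h + 3 * (b′ + a) + 3 * b) + (15 * E * b + b)
    ≡ 3 * a + (4 * ((6 * E + 1) * b) + 3 * h + 3 * b′)
  eq = solve-∀

small-parts-absurd : ∀ E b h a z d → 4 * ((6 * E + 1) * b) ≤ 3 * h → 3 * h < 4 * (d + b) → d ≤ a + z →
  a < 3 * E * b → z < 3 * E * b → ⊥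
small-parts-absurd E b h a z d h₁ h₂ h₃ h₄ h₅ = ⊥-cert 8 (h₁ ⊕ h₂ ⊕ 4 ⊛ h₃ ⊕ 4 ⊛ h₄ ⊕ 4 ⊛ h₅) (eq E b h a z d)
  where
  eq : ∀ E b h a z d → 1 + (3 * h + 4 * (d + b) + 4 * (a + z) + 4 * (3 * E * b) + 4 * (3 * E * b)) + 8
    ≡ 4 * ((6 * E + 1) * b) + suc (3 * h) + 4 * d + 4 * suc a + 4 * suc z
  eq = solve-∀

two-giants-absurd : ∀ E b h r d → 4 * ((6 * E + 1) * b) ≤ 3 * h → 3 * h < 4 * (d + b) → 3 * h < 4 * (r + b) → r + d ≤ h →
  b ≤ E * b → ⊥
two-giants-absurd E b h r d h₁ h₂ h₃ h₄ h₅ = ⊥-cert (32 * b + 5) (2 ⊛ h₁ ⊕ 3 ⊛ h₂ ⊕ 3 ⊛ h₃ ⊕ 12 ⊛ h₄ ⊕ 48 ⊛ h₅)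
    (eq E b h r d)
  where
  eq : ∀ E b h r d →
    1 + (2 * (3 * h) + 3 * (4 * (d + b)) + 3 * (4 * (r + b)) + 12 * h + 48 * (E * b)) + (32 * b + 5)
    ≡ 2 * (4 * ((6 * E + 1) * b)) + 3 * suc (3 * h) + 3 * suc (3 * h) + 12 * (r + d) + 48 * b
  eq = solve-∀

3Eb+b≤4Eb : ∀ E b → 1 ≤ E → 3 * E * b + b ≤ 4 * E * b
3Eb+b≤4Eb E b 1≤E = ≤-cert 0 (*-monoˡ-≤ b 1≤E) (eq E b)
  where
  eq : ∀ E b → 3 * E * b + b + E * b + 0 ≡ 4 * E * b + 1 * b
  eq = solve-∀

cofinite-majority : ∀ h s d r b → 1 ≤ h → 4 * s ≤ h → h ≤ d + r → r ≤ s → d ≤ b → h < 2 * b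
cofinite-majority h s d r b h₁ h₂ h₃ h₄ h₅ with 2 * b ≤? h
... | no p = ≰⇒> p
... | yes p = ⊥-elim (⊥-cert 0 (h₁ ⊕ h₂ ⊕ 4 ⊛ h₃ ⊕ 4 ⊛ h₄ ⊕ 4 ⊛ h₅ ⊕ 2 ⊛ p) (eq h s d r b))
  where
  eq : ∀ h s d r b → 1 + (h + h + 4 * (d + r) + 4 * s + 4 * b + 2 * h) + 0 ≡ 1 + 4 * s + 4 * h + 4 * r + 4 * d + 2 * (2 * b)
  eq = solve-∀

growth-count : ∀ E b ν b′ s → b < 3 * E * ν → b + ν ≤ b′ + s → 3 * E * b + b < 3 * E * b′ + 3 * E * s
growth-count E b ν b′ s p q = ≤-cert 0 (p ⊕ (3 * E) ⊛ q) (eq E b ν b′ s)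
  where
  eq : ∀ E b ν b′ s → suc (3 * E * b + b) + (3 * E * ν + 3 * E * (b′ + s)) + 0
    ≡ 3 * E * b′ + 3 * E * s + (suc b + 3 * E * (b + ν))
  eq = solve-∀

saturated-majority : ∀ h y b′ s → 3 * h < 4 * y → y ≤ b′ + s → 4 * s ≤ h → h < 2 * b′
saturated-majority h y b′ s h₁ h₂ h₃ with 2 * b′ ≤? h
... | no p = ≰⇒> p
... | yes p = ⊥-elim (⊥-cert 0 (h₁ ⊕ 4 ⊛ h₂ ⊕ h₃ ⊕ 2 ⊛ p) (eq h y b′ s))
  where
  eq : ∀ h y b′ s → 1 + (4 * y + 4 * (b′ + s) + h + 2 * h) + 0 ≡ suc (3 * h) + 4 * y + 4 * s + 2 * (2 * b′)
  eq = solve-∀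

-- A ball of size `a ≥ 6 * E * s` can afford the loss of `s` vertices in a step and still gains at
-- least `a / (6 * E)`, so that `6 * E` steps double it.
growth-iterate : ∀ E s k a b b′ → 6 * E * s ≤ a → (6 * E + k) * a ≤ 6 * E * b → 3 * E * b + b < 3 * E * b′ + 3 * E * s →
  a ≤ b → (6 * E + suc k) * a ≤ 6 * E * b′
growth-iterate E s k a b b′ h₁ h₂ h₃ h₄ = ≤-cert 2 (h₁ ⊕ h₂ ⊕ 2 ⊛ h₃ ⊕ 2 ⊛ h₄) (eq E s k a b b′)
  where
  eq : ∀ E s k a b b′ → (6 * E + suc k) * a + (a + 6 * E * b + 2 * (3 * E * b′ + 3 * E * s) + 2 * b) + 2
    ≡ 6 * E * b′ + (6 * E * s + (6 * E + k) * a + 2 * suc (3 * E * b + b) + 2 * a)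
  eq = solve-∀

6E*2b≡[6E+6E]*b : ∀ E b → 6 * E * (2 * b) ≡ (6 * E + 6 * E) * b
6E*2b≡[6E+6E]*b = solve-∀

majorities-meet : ∀ h a b → h < 2 * a → h < 2 * b → a + b ≤ h → ⊥
majorities-meet h a b h₁ h₂ h₃ = ⊥-cert 1 (h₁ ⊕ h₂ ⊕ 2 ⊛ h₃) (eq h a b)
  where
  eq : ∀ h a b → 1 + (2 * a + 2 * b + 2 * h) + 1 ≡ suc h + suc h + 2 * (a + b)
  eq = solve-∀

closed-count : ∀ m r f k g → m ≤ r + 1 → 2 * r + f < k → k ≤ f + g → 1 ≤ r → m ≤ g
closed-count m r f k g h₁ h₂ h₃ h₄ = ≤-cert 1 (h₁ ⊕ h₂ ⊕ h₃ ⊕ h₄) (eq m r f k g)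
  where
  eq : ∀ m r f k g → m + (r + 1 + k + (f + g) + r) + 1 ≡ g + (m + suc (2 * r + f) + k + 1)
  eq = solve-∀

delete-count : ∀ m h f d g → suc m ≤ h → d < h → g ≤ f + d → 2 * h < g → m ≤ f
delete-count m h f d g h₁ h₂ h₃ h₄ = ≤-cert 3 (h₁ ⊕ h₂ ⊕ h₃ ⊕ h₄) (eq m h f d g)
  where
  eq : ∀ m h f d g → m + (h + h + (f + d) + g) + 3 ≡ f + (suc m + suc d + g + suc (2 * h))
  eq = solve-∀

c*[s*p]≡c*p*s : ∀ c s p → c * (s * p) ≡ c * p * s
c*[s*p]≡c*p*s = solve-∀

a+b+[b+c]≡a+[b+b]+c : ∀ a b c → a + b + (b + c) ≡ a + (b + b) + c
a+b+[b+c]≡a+[b+b]+c = solve-∀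

cut-count : ∀ a b f g g′ → a ≤ 2 * b → f ≤ 4 * g → g ≤ g′ → a + a + f ≤ 4 * (g′ + b)
cut-count a b f g g′ h₁ h₂ h₃ = ≤-cert 0 (2 ⊛ h₁ ⊕ h₂ ⊕ 4 ⊛ h₃) (eq a b f g g′)
  where
  eq : ∀ a b f g g′ → a + a + f + (2 * (2 * b) + 4 * g + 4 * g′) + 0 ≡ 4 * (g′ + b) + (2 * a + f + 4 * g)
  eq = solve-∀

-- The leading terms of the degree sum are `6 * h` from edges to the exceptional set and `8 * h`
-- from edges off it. The density error contributes `h / (4 * q)` and the lower-order terms less
-- than `n / (8 * q)`, together less than the excess `n / q`.
few-rich-count : ∀ n q h dS X₁ X₂ X₃ X₄ T D e → (14 * q + 1) * n ≤ q * dS → dS ≤ X₁ + (T + T) + D → T ≤ 3 * h + X₂ →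
  D ≤ 4 * e → 16 * q * e ≤ (32 * q + 1) * h → h ≤ n → 8 * q * (X₁ + 2 * X₂ + 2 * X₃ + X₄) < n → ⊥
few-rich-count n q h dS X₁ X₂ X₃ X₄ T D e h₁ h₂ h₃ h₄ h₅ h₆ h₇ = ⊥-cert (5 * n + 16 * q * X₃ + 8 * q * X₄)
  (8 ⊛ h₁ ⊕ (8 * q) ⊛ h₂ ⊕ (16 * q) ⊛ h₃ ⊕ (8 * q) ⊛ h₄ ⊕ 2 ⊛ h₅ ⊕ (112 * q + 2) ⊛ h₆ ⊕ h₇)
  (eq n q h dS X₁ X₂ X₃ X₄ T D e)
  where
  eq : ∀ n q h dS X₁ X₂ X₃ X₄ T D e →
    1 + (8 * (q * dS) + 8 * q * (X₁ + (T + T) + D) + 16 * q * (3 * h + X₂) + 8 * q * (4 * e) + 2 * ((32 * q + 1) * h)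
      + (112 * q + 2) * n + n) + (5 * n + 16 * q * X₃ + 8 * q * X₄)
    ≡ 8 * ((14 * q + 1) * n) + 8 * q * dS + 16 * q * T + 8 * q * D + 2 * (16 * q * e) + (112 * q + 2) * h
      + suc (8 * q * (X₁ + 2 * X₂ + 2 * X₃ + X₄))
  eq = solve-∀

-- The leading coefficient is 8 + 4 = 12 for `w` and 2 + 4 + 8 = 14 for `r`; the errors again add up
-- to less than `n / q`.
many-rich-count : ∀ n q w r dS X₁ X₂ X₃ X₄ T D Dw f Dr e₁ e₂ → (14 * q + 1) * n ≤ q * dS → dS ≤ X₁ + (T + T) + D →
  T ≤ 4 * w + r + X₃ → D ≤ Dw + (f + f) + Dr → Dw ≤ X₄ → f ≤ e₁ → 16 * q * e₁ ≤ (32 * q + 1) * (w + r) →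
  Dr ≤ 4 * e₂ → 16 * q * e₂ ≤ (32 * q + 1) * r → w + r ≤ n → 8 * q * (X₁ + 2 * X₂ + 2 * X₃ + X₄) < n → ⊥
many-rich-count n q w r dS X₁ X₂ X₃ X₄ T D Dw f Dr e₁ e₂ h₁ h₂ h₃ h₄ h₅ h₆ h₇ h₈ h₉ h₁₀ h₁₁ =
  ⊥-cert (4 * n + 16 * q * X₂ + (16 * q + 2) * w)
  (8 ⊛ h₁ ⊕ (8 * q) ⊛ h₂ ⊕ (16 * q) ⊛ h₃ ⊕ (8 * q) ⊛ h₄ ⊕ (8 * q) ⊛ h₅ ⊕ (16 * q) ⊛ h₆ ⊕ h₇
    ⊕ (8 * q) ⊛ h₈ ⊕ 2 ⊛ h₉ ⊕ (112 * q + 3) ⊛ h₁₀ ⊕ h₁₁)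
  (eq n q w r dS X₁ X₂ X₃ X₄ T D Dw f Dr e₁ e₂)
  where
  eq : ∀ n q w r dS X₁ X₂ X₃ X₄ T D Dw f Dr e₁ e₂ →
    1 + (8 * (q * dS) + 8 * q * (X₁ + (T + T) + D) + 16 * q * (4 * w + r + X₃) + 8 * q * (Dw + (f + f) + Dr)
      + 8 * q * X₄ + 16 * q * e₁ + (32 * q + 1) * (w + r) + 8 * q * (4 * e₂) + 2 * ((32 * q + 1) * r)
      + (112 * q + 3) * n + n) + (4 * n + 16 * q * X₂ + (16 * q + 2) * w)
    ≡ 8 * ((14 * q + 1) * n) + 8 * q * dS + 16 * q * T + 8 * q * D + 8 * q * Dw + 16 * q * f + 16 * q * e₁
      + 8 * q * Dr + 2 * (16 * q * e₂) + (112 * q + 3) * (w + r) + suc (8 * q * (X₁ + 2 * X₂ + 2 * X₃ + X₄))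
  eq = solve-∀

pair-size : ∀ r u → 2 * r + (2 * r + 2 + u) ≡ 4 * r + 2 + u
pair-size = solve-∀

-- Lists

lookup-injective : ∀ {A : Set} {l : List A} → Unique l → {i j : Fin (length l)} → lookup l i ≡ lookup l j → i ≡ j
lookup-injective (px ∷ u) {zero} {zero} h = refl
lookup-injective (px ∷ u) {zero} {suc j} h = ⊥-elim (All.lookup px (∈-lookup j) h)
lookup-injective (px ∷ u) {suc i} {zero} h = ⊥-elim (All.lookup px (∈-lookup i) (sym h))
lookup-injective (px ∷ u) {suc i} {suc j} h = cong suc (lookup-injective u h)

Unique-++⁻ : ∀ {A : Set} (l : List A) {k} → Unique (l ++ k) →
  Unique l × Unique k × (∀ {x} → x ∈ˡ l → x ∈ˡ k → ⊥)
Unique-++⁻ [] u = [] , u , λ ()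
Unique-++⁻ (x ∷ l) (px ∷ u) with Unique-++⁻ l u
... | ul , uk , disj = All.++⁻ˡ l px ∷ ul , uk ,
  λ { (here refl) x∈k → All.lookup (All.++⁻ʳ l px) x∈k refl ; (there x∈l) → disj x∈l }

drop-∷ : ∀ {A : Set} k (l : List A) {y l′} → drop k l ≡ y ∷ l′ → drop (suc k) l ≡ l′
drop-∷ zero    (x ∷ l) refl = refl
drop-∷ (suc k) (x ∷ l) h    = drop-∷ k l h
drop-∷ (suc k) []      ()
drop-∷ zero    []      ()

drop-split : ∀ {A : Set} k (l : List A) {y l′} → drop k l ≡ y ∷ l′ →
  ∃[ mid ] l ≡ mid ++ y ∷ l′ × length mid ≡ k
drop-split zero    l       h = [] , h , refl
drop-split (suc k) (x ∷ l) h with drop-split k l h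
... | mid , eq , len = x ∷ mid , cong (x ∷_) eq , cong suc len

gap-split : ∀ {A : Set} g as {u : A} {r} as′ {w bs} → drop (suc g) (as ++ u ∷ r) ≡ as′ ++ w ∷ bs →
  length as ≡ length as′ → ∃[ mid ] r ≡ mid ++ w ∷ bs × length mid ≡ g
gap-split g []       []         h _ = drop-split g _ h
gap-split g (a ∷ as) (a′ ∷ as′) h e = gap-split g as as′ (drop-∷ g (as ++ _) h) (suc-injective e)

module _ {A : Set} {P : A → Set} (P? : ∀ x → Dec (P x)) where

  count-zip : (l l′ : List A) → length l ≡ length l′ →
    (∀ as {u bs} as′ {w bs′} → l ≡ as ++ u ∷ bs → l′ ≡ as′ ++ w ∷ bs′ → length as ≡ length as′ → P u → P w → ⊥) →
    length (filter P? l) + length (filter P? l′) ≤ length l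
  count-zip [] [] _ h = z≤n
  count-zip (x ∷ l) (y ∷ l′) e h with count-zip l l′ (suc-injective e)
    (λ as as′ eq eq′ e′ → h (x ∷ as) (y ∷ as′) (cong (x ∷_) eq) (cong (y ∷_) eq′) (cong suc e′))
  ... | ih with P? x | P? y
  ...   | yes p | yes q = ⊥-elim (h [] [] refl refl refl p q)
  ...   | yes p | no _  = s≤s ih
  ...   | no _  | yes q = ≤-trans (≤-reflexive (+-suc _ _)) (s≤s ih)
  ...   | no _  | no _  = m≤n⇒m≤1+n ih

  count-take-drop : ∀ k (l : List A) →
    length (filter P? l) ≡ length (filter P? (take k l)) + length (filter P? (drop k l))
  count-take-drop k l = trans
    (cong (length ∘ filter P?) (sym (take++drop≡id k l)))
    (trans (cong length (filter-++ P? (take k l) (drop k l))) (length-++ (filter P? (take k l))))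

  -- The gaps m - 2 and m are the two ways of being m - 1 steps apart on a cycle of length 2m.
  count-cyclic : ∀ m (l : List A) → length l ≡ 2 * m → 2 ≤ m →
    (∀ as {u} mid {w bs} → l ≡ as ++ u ∷ mid ++ w ∷ bs → suc (suc (length mid)) ≡ m ⊎ length mid ≡ m →
      P u → P w → ⊥) →
    2 * length (filter P? l) ≤ length l
  count-cyclic (suc zero) l len (s≤s ()) h
  count-cyclic m@(suc (suc m″)) l len _ h = begin
    2 * ♯ l                                       ≡⟨ solve₁ (♯ l) ⟩
    ♯ l + ♯ l                                     ≡⟨ cong₂ _+_ (count-take-drop (suc m) l) (count-take-drop (suc m″) l) ⟩
    ♯ zs + ♯ ts + (♯ xs + ♯ ys)                   ≡⟨ solve₂ (♯ zs) (♯ ts) (♯ xs) (♯ ys) ⟩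
    -- Position i of `zs` is matched with that of `ys`, m - 1 places further on, and position i of
    -- `xs` with that of `ts`, m + 1 places further on. Each of the 2m matched pairs has at most one
    -- element in `P`, and each position of `l` is in two pairs.
    ♯ zs + ♯ ys + (♯ xs + ♯ ts)                   ≤⟨ +-mono-≤
      (count-zip zs ys (trans lzs (sym lys)) λ { as as′ {w} {bs′} eq eq′ e p q →
        glue (suc m) m″ as as′ eq eq′ e p q (inj₁ refl) })
      (count-zip xs ts (trans lxs (sym lts)) λ { as as′ eq eq′ e p q →
        glue (suc m″) m as as′ eq eq′ e p q (inj₂ refl) }) ⟩
    length zs + length xs                         ≡⟨ cong₂ _+_ lzs lxs ⟩
    suc m + suc m″                                ≡⟨ solve₃ m″ ⟩
    2 * m                                         ≡⟨ sym len ⟩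
    length l                                      ∎
    where
    open ≤-Reasoning
    ♯ : List A → ℕ
    ♯ k = length (filter P? k)
    zs = take (suc m) l
    ts = drop (suc m) l
    xs = take (suc m″) l
    ys = drop (suc m″) l
    solve₁ : ∀ a → 2 * a ≡ a + a
    solve₁ = solve-∀
    solve₂ : ∀ a b c d → a + b + (c + d) ≡ a + d + (c + b)
    solve₂ = solve-∀
    solve₃ : ∀ a → suc (suc (suc a)) + suc a ≡ 2 * (2 + a)
    solve₃ = solve-∀
    len′ : length l ≡ suc m + suc m″
    len′ = trans len (sym (solve₃ m″))
    lzs : length zs ≡ suc m
    lzs = trans (length-take (suc m) l) (m≤n⇒m⊓n≡m (≤-trans (m≤m+n _ (suc m″)) (≤-reflexive (sym len′))))
    lxs : length xs ≡ suc m″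
    lxs = trans (length-take (suc m″) l) (m≤n⇒m⊓n≡m (≤-trans (m≤n+m _ (suc m)) (≤-reflexive (sym len′))))
    lys : length ys ≡ suc m
    lys = trans (length-drop (suc m″) l) (trans (cong (_∸ suc m″) len′) (m+n∸n≡m (suc m) (suc m″)))
    lts : length ts ≡ suc m″
    lts = trans (length-drop (suc m) l) (trans (cong (_∸ suc m) len′) (m+n∸m≡n (suc m) (suc m″)))
    glue : ∀ k g as {u bs} as′ {w bs′} → take k l ≡ as ++ u ∷ bs → drop (suc g) l ≡ as′ ++ w ∷ bs′ →
      length as ≡ length as′ → P u → P w → suc (suc g) ≡ m ⊎ g ≡ m → ⊥
    glue k g as {u} {bs} as′ eq eq′ e p q d =
      let mid , eq″ , lmid = gap-split g as as′ (trans (cong (drop (suc g)) (sym l≡)) eq′) e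
      in h as mid (trans l≡ (cong (λ z → as ++ u ∷ z) eq″))
           (Sum.map (trans (cong (2 +_) lmid)) (trans lmid) d) p q
      where
      l≡ : l ≡ as ++ u ∷ (bs ++ drop k l)
      l≡ = trans (sym (take++drop≡id k l)) (trans (cong (_++ drop k l) eq) (++-assoc as (u ∷ bs) (drop k l)))

Unique-reverse : ∀ {A : Set} (l : List A) → Unique l → Unique (reverse l)
Unique-reverse [] u = []
Unique-reverse (x ∷ l) (px ∷ u) = subst Unique (sym (unfold-reverse x l))
  (Unique.++⁺ (Unique-reverse l u) ([] ∷ []) λ { (p , here refl) → All.lookup px (reverse⁻ p) refl })

-- Even pairs in dense bipartite graphs

record CycleOn {n : ℕ} (G : Graph n) (k : ℕ) (X : Sub n) : Set where
  field
    vertices : Fin k → Fin n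
    isCycle  : IsCycle G k vertices
    inside   : ∀ i → vertices i ∈ X

CycleOn-⊆ : ∀ {n} {G : Graph n} {k} {X Y : Sub n} → X ⊆ Y → CycleOn G k X → CycleOn G k Y
CycleOn-⊆ h C = record { vertices = vertices ; isCycle = isCycle ; inside = λ i → h (inside i) }
  where open CycleOn C

record EvenPair {n : ℕ} (G : Graph n) (X : Sub n) (L : ℕ) : Set where
  field
    r     : ℕ
    2≤r   : 2 ≤ r
    r≤L   : r ≤ L
    short : CycleOn G (2 * r) X
    long  : CycleOn G (2 * r + 2) X

EvenPair-weaken : ∀ {n} {G : Graph n} {X Y : Sub n} {L L′} → X ⊆ Y → L ≤ L′ → EvenPair G X L → EvenPair G Y L′
EvenPair-weaken {G = G} {X} {Y} X⊆Y L≤L′ p = record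
  { r = r ; 2≤r = 2≤r ; r≤L = ≤-trans r≤L L≤L′
  ; short = CycleOn-⊆ {G = G} {X = X} {Y} X⊆Y short ; long = CycleOn-⊆ {G = G} {X = X} {Y} X⊆Y long }
  where open EvenPair p

-- The cube makes the level drop as soon as the size shrinks by a factor 3/4.
level : ℕ → ℕ
level h = ⌊log₂ (h * h * h) ⌋

level-mono : ∀ {x h} → x ≤ h → level x ≤ level h
level-mono p = ⌊log₂⌋-mono-≤ (*-mono-≤ (*-mono-≤ p p) p)

-- The cube of 3/4 is 27/64, which is below 1/2.
cube-drop : ∀ x h → 4 * x ≤ 3 * h → 2 * (x * x * x) ≤ h * h * h
cube-drop x h p = *-cancelˡ-≤ 27 (begin
  27 * (2 * (x * x * x))                       ≤⟨ m≤m+n _ (10 * (x * x * x)) ⟩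
  27 * (2 * (x * x * x)) + 10 * (x * x * x)    ≡⟨ eq₁ x ⟩
  4 * x * (4 * x) * (4 * x)                    ≤⟨ *-mono-≤ (*-mono-≤ p p) p ⟩
  3 * h * (3 * h) * (3 * h)                    ≡⟨ eq₂ h ⟩
  27 * (h * h * h)                             ∎)
  where
  open ≤-Reasoning
  eq₁ : ∀ x → 27 * (2 * (x * x * x)) + 10 * (x * x * x) ≡ 4 * x * (4 * x) * (4 * x)
  eq₁ = solve-∀
  eq₂ : ∀ h → 3 * h * (3 * h) * (3 * h) ≡ 27 * (h * h * h)
  eq₂ = solve-∀

level-drop : ∀ x h → 1 ≤ x → 4 * x ≤ 3 * h → level x < level h
level-drop x@(suc _) h _ p = subst (_≤ level h) (⌊log₂[2*b]⌋≡1+⌊log₂b⌋ (x * x * x)) (⌊log₂⌋-mono-≤ (cube-drop x h p))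

-- A ball first takes `6 * E * s` steps to outgrow the missing vertices, then `t` doublings of
-- `6 * E` steps each. Two paths of that radius are joined, and lengths count vertices.
diameter : (E t s : ℕ) → ℕ
diameter E t s = 2 * suc (t * (6 * E) + 6 * E * s)

-- s₁ and s₂ bound the complements of the two giant components, b₂ the cycle used to define the second one;
-- below the threshold the whole expander is already small.
module Bounds (E t : ℕ) where
  s₁ b₂ s₂ threshold bound : ℕ
  s₁ = 4 * E * 1
  b₂ = s₁ + suc (diameter E t s₁)
  s₂ = 4 * E * b₂
  threshold = 4 * ((6 * E + 1) * b₂)
  bound = (s₂ + diameter E t s₂) + (threshold + threshold)

module Bipartite {n : ℕ} (G : Graph n) (χ : Fin n → Bool) where

  private variable
    u v w x y z : Fin n
    l l′ : List (Fin n)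

  -- Orienting every bichromatic edge from true to false makes each of them count once.
  Arc Edge : Fin n → Fin n → Set
  Arc u v = χ u ≡ true × χ v ≡ false × adj G u v ≡ true
  Edge u v = Arc u v ⊎ Arc v u

  Arc? : ∀ u v → Dec (Arc u v)
  Arc? u v = χ u Bool.≟ true ×-dec χ v Bool.≟ false ×-dec adj G u v Bool.≟ true

  Edge? : ∀ u v → Dec (Edge u v)
  Edge? u v = Arc? u v ⊎-dec Arc? v u

  Edge-sym : Edge u v → Edge v u
  Edge-sym = Sum.swap

  Arc-asym : Arc u v → ¬ Arc v u
  Arc-asym (p , _) (_ , q , _) with () ← trans (sym p) q

  Edge-χ : Edge u v → χ u ≢ χ v
  Edge-χ (inj₁ (p , q , _)) e with () ← trans (sym p) (trans e q)
  Edge-χ (inj₂ (p , q , _)) e with () ← trans (sym p) (trans (sym e) q)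

  Edge-irrefl : ¬ Edge u u
  Edge-irrefl e = Edge-χ e refl

  Edge⇒adj : Edge u v → adj G u v ≡ true
  Edge⇒adj (inj₁ (_ , _ , p)) = p
  Edge⇒adj {u} {v} (inj₂ (_ , _ , p)) = trans (adj-sym G u v) p

  arcs-in? : (X : Sub n) → ∀ u v → Dec (u ∈ X × v ∈ X × Arc u v)
  arcs-in? X u v = mem? X u ×-dec mem? X v ×-dec Arc? u v

  e : Sub n → ℕ
  e X = pairs (arcs-in? X)

  nbrs : Fin n → Sub n
  nbrs v = ⟪ Edge? v ⟫

  deg : Sub n → Fin n → ℕ
  deg X v = ∣ X ∩ nbrs v ∣

  e-cover : (X Y Z : Sub n) →
    (∀ {u v} → u ∈ X → v ∈ X → Edge u v → (u ∈ Y × v ∈ Y) ⊎ (u ∈ Z × v ∈ Z)) → e X ≤ e Y + e Z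
  e-cover X Y Z h = pairs-cover (arcs-in? X) (arcs-in? Y) (arcs-in? Z)
    λ {x} {y} (p , q , r) → Sum.map (λ (s , t) → s , t , r) (λ (s , t) → s , t , r) (h {x} {y} p q (inj₁ r))

  e-mono : (X Y : Sub n) → X ⊆ Y → e X ≤ e Y
  e-mono X Y h = pairs-mono (arcs-in? X) (arcs-in? Y) λ (p , q , r) → h p , h q , r

  e-cong : (X Y : Sub n) → X ⊆ Y → Y ⊆ X → e X ≡ e Y
  e-cong X Y h k = ≤-antisym (e-mono X Y h) (e-mono Y X k)

  e-remove : (X : Sub n) → v ∈ X → e X ≡ e (X -ˢ v) + deg X v
  e-remove {v} X v∈X = begin
    e X                        ≡⟨ pairs-split (arcs-in? X) (arcs-in? (X -ˢ v)) at? split₁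
                                    (λ (p , q , r) → proj₁ p , proj₁ q , r) at⇒
                                    (λ (p , q , r) → [ (λ s → proj₂ p (proj₁ s)) , (λ s → proj₂ q (proj₁ s)) ]′) ⟩
    e (X -ˢ v) + pairs at?     ≡⟨ cong (e (X -ˢ v) +_) step ⟩
    e (X -ˢ v) + deg X v       ∎
    where
    open ≡-Reasoning
    out in′ : Sub n
    out = ⟪ (λ y → mem? X y ×-dec Arc? v y) ⟫
    in′ = ⟪ (λ y → mem? X y ×-dec Arc? y v) ⟫
    row? : (Y : Sub n) → ∀ x y → Dec (x ≡ v × y ∈ Y)
    row? Y x y = x Fin.≟ v ×-dec mem? Y y
    At : Fin n → Fin n → Set
    At x y = (x ≡ v × y ∈ out) ⊎ (y ≡ v × x ∈ in′)
    at? : ∀ x y → Dec (At x y)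
    at? x y = row? out x y ⊎-dec row? in′ y x
    split₁ : x ∈ X × y ∈ X × Arc x y → (x ∈ (X -ˢ v) × y ∈ (X -ˢ v) × Arc x y) ⊎ At x y
    split₁ {x} {y} (p , q , r) with x Fin.≟ v | y Fin.≟ v
    ... | yes refl | _        = inj₂ (inj₁ (refl , q , r))
    ... | no _     | yes refl = inj₂ (inj₂ (refl , p , r))
    ... | no x≢v   | no y≢v   = inj₁ ((p , x≢v) , (q , y≢v) , r)
    at⇒ : At x y → x ∈ X × y ∈ X × Arc x y
    at⇒ (inj₁ (refl , q , r)) = v∈X , q , r
    at⇒ (inj₂ (refl , p , r)) = p , v∈X , r
    step : pairs at? ≡ deg X v
    step = begin
      pairs at?                              ≡⟨ pairs-split at? (row? out) (flip (row? in′)) id inj₁ inj₂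
                                                  (λ { (refl , _ , r) (refl , _ , s) → Arc-asym r s }) ⟩
      pairs (row? out) + pairs (flip (row? in′))
                                             ≡⟨ cong (pairs (row? out) +_) (sym (pairs-swap (row? in′))) ⟩
      pairs (row? out) + pairs (row? in′)    ≡⟨ cong₂ _+_ (pairs-row v out) (pairs-row v in′) ⟩
      ∣ out ∣ + ∣ in′ ∣                      ≡⟨ sym (∣∣-split (X ∩ nbrs v) out in′
                                                  (λ { (p , inj₁ r) → inj₁ (p , r) ; (p , inj₂ r) → inj₂ (p , r) })
                                                  (λ (p , r) → p , inj₁ r) (λ (p , r) → p , inj₂ r)
                                                  (λ { (_ , r) (_ , s) → Arc-asym r s })) ⟩
      deg X v                                ∎

  ends? : (X : Sub n) → ∀ v u → Dec (v ∈ X × u ∈ X × Edge v u)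
  ends? X v u = mem? X v ×-dec mem? X u ×-dec Edge? v u

  handshake : (X : Sub n) → pairs (ends? X) ≡ e X + e X
  handshake X = trans
    (pairs-split (ends? X) (arcs-in? X) (flip (arcs-in? X))
      (λ { (p , q , inj₁ r) → inj₁ (p , q , r) ; (p , q , inj₂ r) → inj₂ (q , p , r) })
      (λ (p , q , r) → p , q , inj₁ r) (λ (q , p , r) → p , q , inj₂ r)
      (λ { (_ , _ , r) (_ , _ , s) → Arc-asym r s }))
    (cong (e X +_) (sym (pairs-swap (arcs-in? X))))

  degrees-≥ : (X : Sub n) (f : Fin n → ℕ) → (∀ v → v ∈ X → f v ≤ deg X v) → (∀ v → v ∉ X → f v ≡ 0) →
    sum f ≤ e X + e X
  degrees-≥ X f h h₀ = ≤-trans (sum-mono pointwise) (≤-reflexive (handshake X))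
    where
    pointwise : ∀ v → f v ≤ sum (λ u → ⟦ ends? X v u ⟧)
    pointwise v with mem? X v
    ... | no v∉X = ≤-trans (≤-reflexive (h₀ v v∉X)) z≤n
    ... | yes v∈X = ≤-trans (h v v∈X)
      (sum-mono λ u → ⟦⟧-mono (mem? X u ×-dec Edge? v u) (yes v∈X ×-dec mem? X u ×-dec Edge? v u) (v∈X ,_))

  min-degree⇒e≥ : (X : Sub n) (k : ℕ) → (∀ {v} → v ∈ X → k ≤ deg X v) → k * ∣ X ∣ ≤ e X + e X
  min-degree⇒e≥ X k h = ≤-trans
    (≤-reflexive (*-distribˡ-sum k λ v → ⟦ mem? X v ⟧))
    (degrees-≥ X (λ v → k * ⟦ mem? X v ⟧)
      (λ v v∈X → ≤-trans (≤-reflexive (trans (cong (k *_) (⟦⟧-yes (mem? X v) v∈X)) (*-identityʳ k))) (h v∈X))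
      (λ v v∉X → trans (cong (k *_) (⟦⟧-no (mem? X v) v∉X)) (*-zeroʳ k)))

  min-degree⇒e> : (X : Sub n) (k : ℕ) → (∀ {v} → v ∈ X → k ≤ deg X v) → w ∈ X → suc k ≤ deg X w →
    suc (k * ∣ X ∣) ≤ e X + e X
  min-degree⇒e> {w} X k h w∈X hw = ≤-trans
    (≤-reflexive (sym (begin
      sum f                                                       ≡⟨ ∑-distrib-+ (λ v → ⟦ v Fin.≟ w ⟧) (λ v → k * ⟦ mem? X v ⟧) ⟩
      ∣ ⁅ w ⁆ ∣ + sum (λ v → k * ⟦ mem? X v ⟧)                    ≡⟨ cong₂ _+_ (∣⁅⁆∣ w) (sym (*-distribˡ-sum k λ v → ⟦ mem? X v ⟧)) ⟩
      1 + k * ∣ X ∣                                               ∎)))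
    (degrees-≥ X f at-X off-X)
    where
    open ≡-Reasoning
    f : Fin n → ℕ
    f v = ⟦ v Fin.≟ w ⟧ + k * ⟦ mem? X v ⟧
    at-X : ∀ v → v ∈ X → f v ≤ deg X v
    at-X v v∈X rewrite ⟦⟧-yes (mem? X v) v∈X | *-identityʳ k with v Fin.≟ w
    ... | yes refl = hw
    ... | no _ = h v∈X
    off-X : ∀ v → v ∉ X → f v ≡ 0
    off-X v v∉X rewrite ⟦⟧-no (mem? X v) v∉X | *-zeroʳ k with v Fin.≟ w
    ... | yes refl = ⊥-elim (v∉X w∈X)
    ... | no _ = refl

  two-nbrs : (X : Sub n) → x ∈ X → y ∈ X → x ≢ y → Edge v x → Edge v y → 2 ≤ deg X v
  two-nbrs {x} {y} {v} X x∈X y∈X x≢y vx vy = ≤-trans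
    (≤-reflexive (sym (cong₂ _+_ (∣⁅⁆∣ x) (∣⁅⁆∣ y))))
    (∣∣-pack (X ∩ nbrs v) ⁅ x ⁆ ⁅ y ⁆ (λ { refl → x∈X , vx }) (λ { refl → y∈X , vy }) λ { refl refl → x≢y refl })

  -- Paths, cycles and connected sets

  data Path : Fin n → Fin n → List (Fin n) → Set where
    nil  : Path x x [ x ]
    cons : Edge x y → Path y z l → Path x z (x ∷ l)

  Path-append : ∀ {a b c d} → Path a b l → Edge b c → Path c d l′ → Path a d (l ++ l′)
  Path-append nil bc q = cons bc q
  Path-append (cons ab p) bc q = cons ab (Path-append p bc q)

  Path-reverse : Path x y l → Path y x (reverse l)
  Path-reverse nil = nil
  Path-reverse {x} (cons {l = l} ab p) =
    subst (Path _ _) (sym (unfold-reverse x l)) (Path-append (Path-reverse p) (Edge-sym ab) nil)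

  Path-split : ∀ as {bs} → Path x z (as ++ u ∷ bs) → Path x u (as ++ [ u ]) × Path u z (u ∷ bs)
  Path-split [] nil = nil , nil
  Path-split [] (cons e p) = nil , cons e p
  Path-split (a ∷ []) (cons e p) = let q , r = Path-split [] p in cons e q , r
  Path-split (a ∷ as@(_ ∷ _)) (cons e p) = let q , r = Path-split as p in cons e q , r

  Path-prefix : Path x z l → w ∈ˡ l → Unique l →
    ∃[ l′ ] Path x w l′ × Unique l′ × (∀ {y} → y ∈ˡ l′ → y ∈ˡ l)
  Path-prefix nil (here refl) u = _ , nil , u , id
  Path-prefix (cons e p) (here refl) u = [ _ ] , nil , [] ∷ [] , λ { (here e) → here e }
  Path-prefix {x} (cons e p) (there w∈) u@(px ∷ ul) with Path-prefix p w∈ ul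
  ... | l′ , q , u′ , sub = x ∷ l′ , cons e q , All.tabulate (λ y∈ → All.lookup px (sub y∈)) ∷ u′ ,
    λ { (here e) → here e ; (there y∈) → there (sub y∈) }

  Path-suffix : Path y z l → x ∈ˡ l → Unique l →
    ∃[ l′ ] Path x z l′ × Unique l′ × (∀ {y} → y ∈ˡ l′ → y ∈ˡ l) × length l′ ≤ length l
  Path-suffix nil (here refl) u = _ , nil , u , id , ≤-refl
  Path-suffix (cons e p) (here refl) u = _ , cons e p , u , id , ≤-refl
  Path-suffix (cons e p) (there x∈) (_ ∷ u) =
    let l′ , q , u′ , sub , h = Path-suffix p x∈ u in l′ , q , u′ , there ∘ sub , m≤n⇒m≤1+n h

  -- If the first vertex recurs on the loop-free remainder, the path is restarted from that
  -- occurrence.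
  Path-loop-erase : ∀ {m} → Path x z l → length l ≤ m →
    ∃[ l′ ] Path x z l′ × Unique l′ × (∀ {y} → y ∈ˡ l′ → y ∈ˡ l) × length l′ ≤ m
  Path-loop-erase nil h = _ , nil , [] ∷ [] , id , h
  Path-loop-erase {x} (cons {l = l} e p) (s≤s h) with Path-loop-erase p h
  ... | l′ , q , u , sub , h′ with mem-dec Fin._≟_ x l′
  ...   | no x∉ = x ∷ l′ , cons e q , All.tabulate (λ y∈ → λ { refl → x∉ y∈ }) ∷ u ,
                  (λ { (here e) → here e ; (there y∈) → there (sub y∈) }) , s≤s h′
  ...   | yes x∈ with Path-suffix q x∈ u
  ...     | k , r , v , s , h″ = k , r , v , there ∘ sub ∘ s , m≤n⇒m≤1+n (≤-trans h″ h′)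

  Path-first : Path x z l → x ∈ˡ l
  Path-first nil = here refl
  Path-first (cons _ _) = here refl

  Path-last : Path x z l → z ∈ˡ l
  Path-last nil = here refl
  Path-last (cons _ p) = there (Path-last p)

  private
    ≢-≢⇒≡ : {p q r : Bool} → p ≢ q → q ≢ r → p ≡ r
    ≢-≢⇒≡ {true}  {true}  h k = ⊥-elim (h refl)
    ≢-≢⇒≡ {true}  {false} {true} h k = refl
    ≢-≢⇒≡ {true}  {false} {false} h k = ⊥-elim (k refl)
    ≢-≢⇒≡ {false} {false} h k = ⊥-elim (h refl)
    ≢-≢⇒≡ {false} {true} {true} h k = ⊥-elim (k refl)
    ≢-≢⇒≡ {false} {true} {false} h k = refl

  Path-parity : Path x z l → ∃[ k ] ((length l ≡ suc (2 * k) × χ x ≡ χ z) ⊎ (length l ≡ 2 * suc k × χ x ≢ χ z))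
  Path-parity nil = 0 , inj₁ (refl , refl)
  Path-parity {x} {z} (cons {y = y} xy p) with Path-parity p
  ... | k , inj₁ (h , eq) = k , inj₂ (trans (cong suc h) (sym (*-suc 2 k)) , λ eq′ → Edge-χ xy (trans eq′ (sym eq)))
  ... | k , inj₂ (h , ne) = suc k , inj₁ (cong suc h , ≢-≢⇒≡ (Edge-χ xy) ne)

  -- The list gives the vertices in cyclic order; `long` excludes a single edge traversed back and
  -- forth.
  record Cycle (l : List (Fin n)) : Set where
    field
      {start end} : Fin n
      path   : Path start end l
      close  : Edge end start
      unique : Unique l
      long   : 3 ≤ length l

  Cycle-even : Cycle l → ∃[ m ] length l ≡ 2 * m × 2 ≤ m
  Cycle-even C with Path-parity (Cycle.path C)
  ... | k , inj₁ (_ , eq) = ⊥-elim (Edge-χ (Cycle.close C) (sym eq))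
  ... | zero , inj₂ (h , _) = ⊥-elim (<-irrefl refl (≤-trans (Cycle.long C) (≤-reflexive h)))
  ... | suc k , inj₂ (h , _) = suc (suc k) , h , s≤s (s≤s z≤n)

  Path-lookup : Path x z l → (i j : Fin (length l)) → suc (toℕ i) ≡ toℕ j → Edge (lookup l i) (lookup l j)
  Path-lookup nil zero zero ()
  Path-lookup (cons e nil) zero (suc zero) h = e
  Path-lookup (cons e (cons _ _)) zero (suc zero) h = e
  Path-lookup (cons e p) (suc i) (suc j) h = Path-lookup p i j (suc-injective h)

  Path-lookup-first : Path x z l → (j : Fin (length l)) → toℕ j ≡ 0 → lookup l j ≡ x
  Path-lookup-first nil zero h = refl
  Path-lookup-first (cons _ _) zero h = refl

  Path-lookup-last : Path x z l → (i : Fin (length l)) → suc (toℕ i) ≡ length l → lookup l i ≡ z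
  Path-lookup-last nil zero h = refl
  Path-lookup-last (cons _ nil) zero ()
  Path-lookup-last (cons _ (cons _ _)) zero ()
  Path-lookup-last (cons _ p) (suc i) h = Path-lookup-last p i (suc-injective h)

  Cycle⇒CycleOn : ∀ {l} → Cycle l → CycleOn G (length l) ⟨ l ⟩
  Cycle⇒CycleOn {l} C = record
    { vertices = lookup l
    ; isCycle = long , lookup-injective unique , λ
      { i j (inj₁ h) → Edge⇒adj (Path-lookup path i j h)
      ; i j (inj₂ (h , h₀)) → Edge⇒adj (subst₂ Edge
          (sym (Path-lookup-last path i h)) (sym (Path-lookup-first path j h₀)) close) }
    ; inside = ∈-lookup
    }
    where open Cycle C

  -- Connectedness is stated through cuts, the form in which minimality arguments supply it; paths
  -- are recovered later by growing balls.
  Connected : Sub n → Set₁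
  Connected D = (A : Sub n) → A ⊆ D → ∀ {a b} → a ∈ A → b ∈ D → b ∉ A →
    (∀ {x y} → x ∈ A → y ∈ D → y ∉ A → ¬ Edge x y) → ⊥

  -- If the cut separates `u` from `w`, the edge between them crosses it; otherwise it restricts to
  -- a cut of `D`.
  Connected-extend : ∀ {D u w} → Connected D → u ∈ D → Edge u w → Connected (D ∪ ⁅ w ⁆)
  Connected-extend {D} {u} {w} conn u∈D uw A A⊆ {a} {b} a∈A b∈ b∉A none with mem? A w | mem? A u
  ... | yes w∈A | no u∉A  = none w∈A (inj₁ u∈D) u∉A (Edge-sym uw)
  ... | no w∉A  | yes u∈A = none u∈A (inj₂ refl) w∉A uw
  ... | yes w∈A | yes u∈A = conn (A ∩ D) proj₂ (u∈A , u∈D) (b∈D b∈) (b∉A ∘ proj₁)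
        λ (x∈A , _) y∈D y∉ → none x∈A (inj₁ y∈D) λ y∈A → y∉ (y∈A , y∈D)
    where
    b∈D : b ∈ (D ∪ ⁅ w ⁆) → b ∈ D
    b∈D (inj₁ p) = p
    b∈D (inj₂ refl) = ⊥-elim (b∉A w∈A)
  ... | no w∉A  | no u∉A = conn A A⊆D a∈A u∈D u∉A λ x∈A y∈D → none x∈A (inj₁ y∈D)
    where
    A⊆D : A ⊆ D
    A⊆D x∈A with A⊆ x∈A
    ... | inj₁ p = p
    ... | inj₂ refl = ⊥-elim (w∉A x∈A)

  deg<∣∣ : (B : Sub n) {v : Fin n} → v ∈ B → deg B v < ∣ B ∣
  deg<∣∣ B {v} v∈B = ≤-trans
    (s≤s (∣∣-mono (B ∩ nbrs v) (B -ˢ v) λ { (x∈B , vx) → x∈B , λ { refl → Edge-irrefl vx } }))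
    (≤-reflexive (sym (∣-∣ B v∈B)))

  e-cons : (l : List (Fin n)) {x : Fin n} → ¬ (x ∈ˡ l) →
    e ⟨ x ∷ l ⟩ ≡ e ⟨ l ⟩ + deg ⟨ x ∷ l ⟩ x
  e-cons l {x} x∉ = trans (e-remove ⟨ x ∷ l ⟩ (here refl)) (cong (_+ deg ⟨ x ∷ l ⟩ x)
    (e-cong (⟨ x ∷ l ⟩ -ˢ x) ⟨ l ⟩
      (λ { (here eq , ne) → ⊥-elim (ne eq) ; (there p , _) → p })
      (λ p → there p , λ { refl → x∉ p })))

  Path-edges : ∀ {x z l} → Path x z l → Unique l → length l ≤ suc (e ⟨ l ⟩)
  Path-edges nil _ = s≤s z≤n
  Path-edges (cons {x} {y} {l = l} xy p) u@(_ ∷ ul) = s≤s (begin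
    length l                   ≤⟨ Path-edges p ul ⟩
    suc (e ⟨ l ⟩)              ≡⟨ +-comm 1 _ ⟩
    e ⟨ l ⟩ + 1                ≤⟨ +-monoʳ-≤ (e ⟨ l ⟩) (∈⇒1≤∣∣ (⟨ x ∷ l ⟩ ∩ nbrs x) (there (Path-first p) , xy)) ⟩
    e ⟨ l ⟩ + deg ⟨ x ∷ l ⟩ x  ≡⟨ sym (e-cons l (Unique.Unique[x∷xs]⇒x∉xs u)) ⟩
    e ⟨ x ∷ l ⟩                ∎)
    where open ≤-Reasoning

  -- The first vertex contributes two edges, to its successor and to the last vertex, and the
  -- remaining vertices form a path.
  Cycle-edges : ∀ {l} → Cycle l → length l ≤ e ⟨ l ⟩
  Cycle-edges record { path = nil ; long = s≤s () }
  Cycle-edges record { path = cons _ nil ; long = s≤s (s≤s ()) }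
  Cycle-edges record { path = cons {x} {y} {z} {l} xy p@(cons _ p′) ; close = zx ; unique = u@(_ ∷ ul@(_ ∷ _)) } = begin
    suc (length l)             ≤⟨ s≤s (Path-edges p ul) ⟩
    2 + e ⟨ l ⟩                ≡⟨ +-comm 2 _ ⟩
    e ⟨ l ⟩ + 2                ≤⟨ +-monoʳ-≤ (e ⟨ l ⟩) (two-nbrs ⟨ x ∷ l ⟩ (there (here refl)) (there (Path-last p))
                                    (λ { refl → Unique.Unique[x∷xs]⇒x∉xs ul (Path-last p′) }) xy (Edge-sym zx)) ⟩
    e ⟨ l ⟩ + deg ⟨ x ∷ l ⟩ x  ≡⟨ sym (e-cons l (Unique.Unique[x∷xs]⇒x∉xs u)) ⟩
    e ⟨ x ∷ l ⟩                ∎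
    where open ≤-Reasoning

  -- A path in `B` is extended at its front until all neighbours of the front vertex in `B` lie on
  -- it. A neighbour other than the second vertex then closes a cycle.
  min-degree⇒Cycle : (B : Sub n) {b : Fin n} → b ∈ B → (∀ {v} → v ∈ B → 2 ≤ deg B v) →
    ∃[ c ] Cycle c × (∀ {y} → y ∈ˡ c → y ∈ B)
  min-degree⇒Cycle B {b} b∈B 2≤deg =
    extend ∣ B ∣ nil ([] ∷ []) (b∈B ∷ []) (≤-reflexive refl)
    where
    extend : ∀ m {x z l} → Path x z l → Unique l → All (_∈ B) l → ∣ B ∣ < length l + m →
      ∃[ c ] Cycle c × (∀ {y} → y ∈ˡ c → y ∈ B)
    extend m {x} {l = l} p u a h with Fin.any? (mem? (B ∩ nbrs x ∖ ⟨ l ⟩))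
    extend zero p u a h | _ =
      ⊥-elim (<-irrefl refl (<-≤-trans h (≤-trans (≤-reflexive (+-identityʳ _)) (Unique⇒length≤ B u a))))
    extend (suc m) {l = l} p u a h | yes (y , (y∈B , xy) , y∉l) =
      extend m (cons (Edge-sym xy) p) (All.tabulate (λ z∈ → λ { refl → y∉l z∈ }) ∷ u) (y∈B ∷ a)
        (≤-trans h (≤-reflexive (+-suc (length l) m)))
    extend (suc m) {x} nil u (x∈B ∷ _) h | no none with pick (B ∩ nbrs x) [] (≤-trans (s≤s z≤n) (2≤deg x∈B))
    ... | y , (y∈B , xy) , _ = ⊥-elim (none (y , (y∈B , xy) , λ { (here refl) → Edge-irrefl xy }))
    extend (suc m) (cons {x} {x₁} {l = l} e p) u@(px ∷ ul) a@(x∈B ∷ a′) h | no none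
      with pick (B ∩ nbrs x) [ x₁ ] (2≤deg x∈B)
    ... | w , (w∈B , xw) , w≢ with mem-dec Fin._≟_ w l
    ...   | no w∉l = ⊥-elim (none (w , (w∈B , xw) , λ { (here refl) → Edge-irrefl xw ; (there p) → w∉l p }))
    ...   | yes w∈l with Path-prefix p w∈l ul
    ...     | l′ , q , u′ , sub = x ∷ l′ ,
      record { path = cons e q ; close = Edge-sym xw ; unique = All.tabulate (λ y∈ → All.lookup px (sub y∈)) ∷ u′
             ; long = s≤s (long q) } ,
      λ { (here refl) → x∈B ; (there y∈) → All.lookup a′ (sub y∈) }
      where
      long : ∀ {l′} → Path x₁ w l′ → 2 ≤ length l′
      long nil = ⊥-elim (w≢ (here refl))
      long (cons _ nil) = s≤s (s≤s z≤n)
      long (cons _ (cons _ _)) = s≤s (s≤s z≤n)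

  -- A maximal connected set whose complement contains a cycle

  module Endgame
    (H : Sub n) (s ℓ : ℕ)
    (dense : ∀ X → X ⊆ H → ∀ {x} → x ∈ X → 2 * ∣ X ∣ + e (H ∖ X) < e H)
    (H-connected : Connected H)
    (short-paths : ∀ D → D ⊆ H → Connected D → ∣ H ∖ D ∣ ≤ s → ∀ {x y} → x ∈ D → y ∈ D →
      (∀ {l} → Path x y l → Unique l → All (_∈ D) l → length l ≤ ℓ → ⊥) → ⊥)
    where

    -- Edge counting replaces containment of a cycle: a set spanning at least as many edges as it
    -- has vertices contains a cycle, and the vertex set of a cycle spans that many.
    Cyclic : Sub n → Set₁
    Cyclic M = Σ[ B ∈ Sub n ] B ⊆ M × (∃[ b ] b ∈ B) × ∣ B ∣ ≤ e B

    record Remainder (D : Sub n) : Set₁ where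
      field
        D⊆H       : D ⊆ H
        connected : Connected D
        inhabit   : ∃[ d ] d ∈ D
        small     : ∣ H ∖ D ∣ ≤ s
        cyclic    : Cyclic (H ∖ D)

    makePair : ∀ {c d L} → Cycle c → Cycle d → length d ≡ length c + 2 → length c ≤ L →
      ⟨ c ⟩ ⊆ H → ⟨ d ⟩ ⊆ H → EvenPair G H L
    makePair {c} {d} C D eq h c⊆ d⊆ with Cycle-even C
    ... | m , lc , 2≤m = record
      { r = m ; 2≤r = 2≤m ; r≤L = ≤-trans (m≤n*m m 2) (≤-trans (≤-reflexive (sym lc)) h)
      ; short = subst (λ k → CycleOn G k H) lc (CycleOn-⊆ {G = G} {X = ⟨ c ⟩} c⊆ (Cycle⇒CycleOn C))
      ; long = subst (λ k → CycleOn G k H) (trans eq (cong (_+ 2) lc)) (CycleOn-⊆ {G = G} {X = ⟨ d ⟩} d⊆ (Cycle⇒CycleOn D))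
      }

    module Maximal (D : Sub n) (ok : Remainder D) (best : ∀ D′ → ∣ H ∖ D′ ∣ < ∣ H ∖ D ∣ → ¬ Remainder D′)
      (noPair : ¬ EvenPair G H (s + ℓ)) where
      open Remainder ok

      M : Sub n
      M = H ∖ D

      Attached : Fin n → Set
      Attached v = ∃[ u ] u ∈ D × Edge u v

      Attached? : ∀ v → Dec (Attached v)
      Attached? v = Fin.any? λ u → mem? D u ×-dec Edge? u v

      N : Sub n
      N = ⟪ (λ v → mem? M v ×-dec Attached? v) ⟫

      -- Otherwise `w` could be moved into `D`, which stays connected and still leaves the cyclic
      -- set `B` outside, contrary to the maximality of `D`.
      N-hits : ∀ {w} → w ∈ N → ∀ B → B ⊆ M → w ∉ B → ∀ {b} → b ∈ B → ¬ ∣ B ∣ ≤ e B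
      N-hits {w} (w∈M , u , u∈D , uw) B B⊆M w∉B {b} b∈B h = best D′
        (≤-trans (s≤s (∣∣-mono (H ∖ D′) (M -ˢ w) λ (x∈H , x∉) → (x∈H , x∉ ∘ inj₁) , x∉ ∘ inj₂))
                 (≤-reflexive (sym (∣-∣ M w∈M))))
        record
          { D⊆H = λ { (inj₁ p) → D⊆H p ; (inj₂ refl) → proj₁ w∈M }
          ; connected = Connected-extend {D} connected u∈D uw
          ; inhabit = u , inj₁ u∈D
          ; small = ≤-trans (∣∣-mono (H ∖ D′) M λ (x∈H , x∉) → x∈H , x∉ ∘ inj₁) small
          ; cyclic = B , (λ x∈B → proj₁ (B⊆M x∈B) , λ
              { (inj₁ p) → proj₂ (B⊆M x∈B) p ; (inj₂ refl) → w∉B x∈B }) , (b , b∈B) , h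
          }
        where D′ = D ∪ ⁅ w ⁆

      -- With their ends included, the arcs between `u` and `w` have m and m + 2 vertices. The same
      -- path `q` through `D` closes each of them to a cycle, and the two cycles form an even pair.
      theta : ∀ m as {u} mid {w bs} → Cycle (as ++ u ∷ mid ++ w ∷ bs) → (∀ {x} → x ∈ˡ as ++ u ∷ mid ++ w ∷ bs → x ∈ M) →
        length (as ++ u ∷ mid ++ w ∷ bs) ≡ 2 * m → suc (suc (length mid)) ≡ m ⊎ length mid ≡ m →
        Attached u → Attached w → ⊥
      theta m as {u} mid {w} {bs} C c⊆M len gap (u′ , u′∈D , uu′) (w′ , w′∈D , ww′) =
        short-paths D D⊆H connected small w′∈D u′∈D λ {q} qp qu qa ql →
          let q⊆D = All.lookup qa
              in-c₁ : ∀ {x} → x ∈ˡ u ∷ mid ++ [ w ] → x ∈ˡ c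
              in-c₁ p = subst (_ ∈ˡ_) (sym c≡₁) (∈-++⁺ʳ as (∈-++⁺ˡ p))
              in-c₂ : ∀ {x} → x ∈ˡ w ∷ bs ++ as ++ [ u ] → x ∈ˡ c
              in-c₂ {x} p = in₂ x (∈-++⁻ (w ∷ bs) p)
              C₁ : Cycle ((u ∷ mid ++ [ w ]) ++ q)
              C₁ = record
                { path = Path-append p₂ (Edge-sym ww′) qp ; close = uu′
                ; unique = Unique.++⁺ u₂ qu λ (x∈ , x∈q) → proj₂ (c⊆M (in-c₁ x∈)) (q⊆D x∈q)
                ; long = ≤-trans (s≤s (s≤s (s≤s z≤n))) (≤-reflexive (sym (trans (length-++ (u ∷ mid ++ [ w ]))
                    (trans (cong₂ _+_ l₁ (q-pos qp)) (2+a+sb≡3+[a+b] (length mid) _))))) }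
              C₂ : Cycle ((w ∷ bs ++ as ++ [ u ]) ++ reverse q)
              C₂ = record
                { path = Path-append (Path-append p₃ (Cycle.close C) p₁) (Edge-sym uu′) (Path-reverse qp) ; close = ww′
                ; unique = Unique.++⁺ u₃ (Unique-reverse q qu)
                    λ (x∈ , x∈q) → proj₂ (c⊆M (in-c₂ x∈)) (q⊆D (reverse⁻ x∈q))
                ; long = ≤-trans (s≤s (s≤s (s≤s z≤n))) (≤-reflexive (sym (trans (length-++ (w ∷ bs ++ as ++ [ u ]))
                    (trans (cong₂ _+_ l₂ (trans (length-reverse q) (q-pos qp))) (2+a+b+sk≡3+[a+b+k] (length bs) (length as) _))))) }
              len₁ : length ((u ∷ mid ++ [ w ]) ++ q) ≡ 2 + length mid + length q
              len₁ = trans (length-++ (u ∷ mid ++ [ w ])) (cong (_+ length q) l₁)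
              len₂ : length ((w ∷ bs ++ as ++ [ u ]) ++ reverse q) ≡ 2 + length bs + length as + length q
              len₂ = trans (length-++ (w ∷ bs ++ as ++ [ u ])) (cong₂ _+_ l₂ (length-reverse q))
              in₁ : ⟨ (u ∷ mid ++ [ w ]) ++ q ⟩ ⊆ H
              in₁ {x} p = [ proj₁ ∘ c⊆M ∘ in-c₁ , D⊆H ∘ q⊆D ]′ (∈-++⁻ (u ∷ mid ++ [ w ]) p)
              in₂ : ⟨ (w ∷ bs ++ as ++ [ u ]) ++ reverse q ⟩ ⊆ H
              in₂ {x} p = [ proj₁ ∘ c⊆M ∘ in-c₂ , D⊆H ∘ q⊆D ∘ reverse⁻ ]′ (∈-++⁻ (w ∷ bs ++ as ++ [ u ]) p)
          in finish C₁ C₂ in₁ in₂ len₁ len₂ ql gap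
        where
        c = as ++ u ∷ mid ++ w ∷ bs
        c≡₁ : c ≡ as ++ (u ∷ mid ++ [ w ]) ++ bs
        c≡₁ = cong (λ z → as ++ u ∷ z) (sym (++-assoc mid [ w ] bs))
        c≡₂ : c ≡ (as ++ [ u ]) ++ mid ++ w ∷ bs
        c≡₂ = sym (++-assoc as [ u ] (mid ++ w ∷ bs))
        open Cycle C using (path; unique)
        parts = Path-split as {bs = mid ++ w ∷ bs} path
        p₁ = proj₁ parts
        parts′ = Path-split (u ∷ mid) {bs = bs} (proj₂ parts)
        p₂ = proj₁ parts′
        p₃ = proj₂ parts′
        uniq₁ = Unique-++⁻ (u ∷ mid ++ [ w ]) (proj₁ (proj₂ (Unique-++⁻ as (subst Unique c≡₁ unique))))
        uniq₂ = Unique-++⁻ (as ++ [ u ]) (subst Unique c≡₂ unique)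
        uniq₃ = Unique-++⁻ mid (proj₁ (proj₂ uniq₂))
        u₂ : Unique (u ∷ mid ++ [ w ])
        u₂ = proj₁ uniq₁
        u₃ : Unique (w ∷ bs ++ as ++ [ u ])
        u₃ = Unique.++⁺ (proj₁ (proj₂ uniq₃)) (proj₁ uniq₂) λ (x∈ , y∈) → proj₂ (proj₂ uniq₂) y∈ (∈-++⁺ʳ mid x∈)
        in₂ : ∀ x → x ∈ˡ w ∷ bs ⊎ x ∈ˡ as ++ [ u ] → x ∈ˡ c
        in₂ x (inj₁ p) = ∈-++⁺ʳ as (there (∈-++⁺ʳ mid p))
        in₂ x (inj₂ p) = subst (x ∈ˡ_) (sym c≡₂) (∈-++⁺ˡ p)
        l₁ : length (u ∷ mid ++ [ w ]) ≡ 2 + length mid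
        l₁ = cong suc (trans (length-++ mid) (+-comm (length mid) 1))
        l₂ : length (w ∷ bs ++ as ++ [ u ]) ≡ 2 + length bs + length as
        l₂ = cong suc (trans (length-++ bs) (trans (cong (length bs +_) (trans (length-++ as) (+-comm (length as) 1)))
               (+-suc (length bs) (length as))))
        q-pos : ∀ {x y q} → Path x y q → length q ≡ suc (length q ∸ 1)
        q-pos nil = refl
        q-pos (cons _ _) = refl
        len-c : length as + (2 + length mid + length bs) ≡ 2 * m
        len-c = trans (sym (trans (length-++ as)
          (cong (λ z → length as + suc z) (trans (length-++ mid) (+-suc (length mid) (length bs)))))) len
        2m≤s : 2 * m ≤ s
        2m≤s = ≤-trans (≤-reflexive (sym len)) (≤-trans (Unique⇒length≤ M {c} unique (All.tabulate c⊆M)) small)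
        finish : ∀ {c₁ c₂ k} → Cycle c₁ → Cycle c₂ → ⟨ c₁ ⟩ ⊆ H → ⟨ c₂ ⟩ ⊆ H →
          length c₁ ≡ 2 + length mid + k → length c₂ ≡ 2 + length bs + length as + k → k ≤ ℓ →
          suc (suc (length mid)) ≡ m ⊎ length mid ≡ m → ⊥
        -- Here the arc through `mid` is the shorter one; in the other case it is the longer one and
        -- the two cycles change places.
        finish {k = k} C₁ C₂ i₁ i₂ e₁ e₂ k≤ℓ (inj₁ g) = noPair (makePair C₁ C₂
          (trans e₂ (trans (cong (_+ k) (longArc-length (length as) (length bs) (length mid)
            (trans len-c (cong (2 *_) (sym g))))) (trans (4+d+k≡2+d+k+2 (length mid) k) (cong (_+ 2) (sym e₁)))))
          (≤-trans (≤-reflexive (trans e₁ (cong (_+ k) g))) (+-mono-≤ (≤-trans (m≤n*m m 2) 2m≤s) k≤ℓ)) i₁ i₂)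
        finish {k = k} C₁ C₂ i₁ i₂ e₁ e₂ k≤ℓ (inj₂ refl) = noPair (makePair C₂ C₁
          (trans e₁ (trans (2+d+k≡d+k+2 (length mid) k) (cong (λ z → z + k + 2) (sym (shortArc-length (length as) (length bs) (length mid) len-c))))
            ■ cong (_+ 2) (sym e₂))
          (≤-trans (≤-reflexive (trans e₂ (cong (_+ k) (shortArc-length (length as) (length bs) (length mid) len-c))))
            (+-mono-≤ (≤-trans (m≤n*m m 2) 2m≤s) k≤ℓ)) i₂ i₁)
          where
          infixl 2 _■_
          _■_ = trans

      module Minimal (B : Sub n) (B⊆M : B ⊆ M) {b : Fin n} (b∈B : b ∈ B) (∣B∣≤e : ∣ B ∣ ≤ e B)
        (B-min : ∀ Z → ∣ Z ∣ < ∣ B ∣ → ¬ (Z ⊆ M × (∃[ z ] z ∈ Z) × ∣ Z ∣ ≤ e Z)) where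

        removal : ∀ {v} → v ∈ B → e (B -ˢ v) < ∣ B -ˢ v ∣
        removal {v} v∈B with ∣ B -ˢ v ∣ ≤? e (B -ˢ v)
        ... | no ≰ = ≰⇒> ≰
        ... | yes h with Fin.any? (mem? (B -ˢ v))
        ...   | yes p = ⊥-elim (B-min (B -ˢ v) (≤-reflexive (sym (∣-∣ B v∈B))) (B⊆M ∘ proj₁ , p , h))
        -- If `v` is the only vertex of `B`, then `B` spans no edge, against `∣ B ∣ ≤ e B`.
        ...   | no ¬p = ⊥-elim (<-irrefl refl (begin-strict
          0                            <⟨ s≤s z≤n ⟩
          suc ∣ B -ˢ v ∣               ≡⟨ sym (∣-∣ B v∈B) ⟩
          ∣ B ∣                        ≤⟨ ∣B∣≤e ⟩
          e B                          ≡⟨ e-remove B v∈B ⟩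
          e (B -ˢ v) + deg B v         ≤⟨ +-mono-≤ (≤-reflexive e≡0) (s≤s⁻¹ (≤-trans (deg<∣∣ B v∈B) (≤-reflexive (∣-∣ B v∈B)))) ⟩
          ∣ B -ˢ v ∣                   ≡⟨ ∣∣≡0 (B -ˢ v) (λ {x} p → ¬p (x , p)) ⟩
          0                            ∎))
          where
          open ≤-Reasoning
          e≡0 : e (B -ˢ v) ≡ 0
          e≡0 = sum-0 λ x → sum-0 λ y → ⟦⟧-no (arcs-in? (B -ˢ v) x y) λ (p , _) → ¬p (x , p)

        -- By minimality `B -ˢ v` spans at most `∣ B ∣ - 2` edges, so `v` carries all the others.
        deg≥ : ∀ k → ∣ B ∣ + k ≤ e B → ∀ {v} → v ∈ B → 2 + k ≤ deg B v
        deg≥ k h {v} v∈B = degree-excess k (e (B -ˢ v)) (∣ B -ˢ v ∣) (∣ B ∣) (e B) (deg B v) (removal v∈B) (≤-reflexive (sym (∣-∣ B v∈B))) h (≤-reflexive (e-remove B v∈B))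

        2≤deg : ∀ {v} → v ∈ B → 2 ≤ deg B v
        2≤deg = deg≥ 0 (≤-trans (≤-reflexive (+-identityʳ _)) ∣B∣≤e)

        -- All degrees in `B` are at least 2, so a vertex of degree 3 forces an excess of edges over
        -- vertices. Any excess raises every degree by as much, and the degree sum becomes
        -- contradictory.
        deg≤2 : ∀ {w} → w ∈ B → deg B w ≤ 2
        deg≤2 {w} w∈B with 3 ≤? deg B w
        ... | no ≱3 = s≤s⁻¹ (≰⇒> ≱3)
        ... | yes 3≤ = ⊥-elim (excess-absurd k₀ (∣ B ∣) (≤-trans 3≤ (<⇒≤ (deg<∣∣ B w∈B)))
                (≤-trans (min-degree⇒e≥ B (2 + suc k₀) (deg≥ (suc k₀) (≤-reflexive k≡))) (≤-reflexive (cong₂ _+_ (sym k≡) (sym k≡)))))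
          where
          e>∣B∣ : ∣ B ∣ + 1 ≤ e B
          e>∣B∣ = *-cancelˡ-≤ 2 (1+2b≤2f⇒2[b+1]≤2f (∣ B ∣) (e B) (min-degree⇒e> B 2 2≤deg w∈B 3≤))
          k₀ = e B ∸ (∣ B ∣ + 1)
          k≡ : ∣ B ∣ + suc k₀ ≡ e B
          k≡ = trans (sym (+-assoc ∣ B ∣ 1 k₀)) (m+[n∸m]≡n e>∣B∣)

        absurd : ⊥
        absurd with min-degree⇒Cycle B b∈B 2≤deg
        ... | c , C , c⊆B with Cycle-even C
        ...   | m , lc , 2≤m = main (Fin.any? (mem? N))
          where
          c-unique = Cycle.unique C
          ∣c∣ : ∣ ⟨ c ⟩ ∣ ≡ length c
          ∣c∣ = ∣⟨⟩∣-Unique c c-unique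
          c-start : ∃[ z ] z ∈ ⟨ c ⟩
          c-start = _ , Path-first (Cycle.path C)
          -- The vertex set of `c` is itself cyclic, so minimality makes it all of `B`: the set `B`
          -- is a shortest cycle outside `D`.
          ∣B∣≤∣c∣ : ∣ B ∣ ≤ ∣ ⟨ c ⟩ ∣
          ∣B∣≤∣c∣ with ∣ ⟨ c ⟩ ∣ <? ∣ B ∣
          ... | no ≮ = ≮⇒≥ ≮
          ... | yes h = ⊥-elim (B-min ⟨ c ⟩ h (B⊆M ∘ c⊆B , c-start , ≤-trans (≤-reflexive ∣c∣) (Cycle-edges C)))
          B⊆c : B ⊆ ⟨ c ⟩
          B⊆c = ⊆-∣∣⇒⊇ ⟨ c ⟩ B c⊆B ∣B∣≤∣c∣
          N⊆B : N ⊆ B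
          N⊆B {w} w∈N with mem? B w
          ... | yes p = p
          ... | no w∉B = ⊥-elim (N-hits w∈N B B⊆M w∉B b∈B ∣B∣≤e)
          no-gap : ∀ as {u} mid {w bs} → c ≡ as ++ u ∷ mid ++ w ∷ bs → suc (suc (length mid)) ≡ m ⊎ length mid ≡ m →
            Attached u → Attached w → ⊥
          no-gap as mid refl = theta m as mid C (B⊆M ∘ c⊆B) lc
          2∣N∣≤ : 2 * ∣ N ∣ ≤ ∣ B ∣
          2∣N∣≤ = begin
            2 * ∣ N ∣                            ≤⟨ *-monoʳ-≤ 2 (∣∣-mono N ⟨ filter Attached? c ⟩
                                                      λ w∈N → ∈-filter⁺ Attached? (B⊆c (N⊆B w∈N)) (proj₂ w∈N)) ⟩
            2 * ∣ ⟨ filter Attached? c ⟩ ∣       ≤⟨ *-monoʳ-≤ 2 (∣⟨⟩∣ (filter Attached? c)) ⟩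
            2 * length (filter Attached? c)      ≤⟨ count-cyclic Attached? m c lc 2≤m no-gap ⟩
            length c                             ≡⟨ sym ∣c∣ ⟩
            ∣ ⟨ c ⟩ ∣                            ≤⟨ ∣∣-mono ⟨ c ⟩ B c⊆B ⟩
            ∣ B ∣                                ∎
            where open ≤-Reasoning
          main : Dec (∃[ w ] w ∈ N) → ⊥
          -- If nothing outside `D` is attached to it, `D` is a side of a cut of `H` without
          -- crossing edges.
          main (no none) = H-connected D D⊆H (proj₂ inhabit) (proj₁ (B⊆M b∈B)) (proj₂ (B⊆M b∈B))
            λ {x} {y} x∈D y∈H y∉D xy → none (y , (y∈H , y∉D) , x , x∈D , xy)
          -- The vertices of `X` are not attached to `D`, so the more than `2 * ∣ X ∣` edges
          -- touching them all lie in `M`. Yet `M -ˢ w` has fewer edges than vertices because `w`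
          -- lies on every cycle, and `w` has at most two neighbours on `B`.
          main (yes (w , w∈N)) = forest-count (∣ X ∣) (e (M -ˢ w)) (deg M w) (∣ M -ˢ w ∣) (deg B w) (∣ M ∖ B ∣) (∣ N ∣) (∣ B ∣)
              (<-≤-trans (+-cancelʳ-< _ _ _ (<-≤-trans (dense X (proj₁ ∘ proj₁) (proj₂ X-inh)) e-H)) (≤-reflexive (e-remove M w∈M)))
              (≰⇒> (N-hits w∈N (M -ˢ w) proj₁ (λ (_ , ne) → ne refl) {proj₁ M-w-inh} (proj₂ M-w-inh)))
              deg-M (deg≤2 w∈B) 2∣N∣≤
              (trans (sym (∣-∣ M w∈M)) M≡B) (trans (sym M≡B) M≡N)
            where
            w∈M = proj₁ w∈N
            w∈B = N⊆B w∈N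
            X = M ∖ N
            M≡B : ∣ M ∣ ≡ ∣ B ∣ + ∣ M ∖ B ∣
            M≡B = ∣∖∣ M B B⊆M
            M≡N : ∣ M ∣ ≡ ∣ N ∣ + ∣ X ∣
            M≡N = ∣∖∣ M N proj₁
            1≤B : 1 ≤ ∣ B ∣
            1≤B = ∈⇒1≤∣∣ B b∈B
            X-inh : ∃[ x ] x ∈ X
            X-inh = inhabited X (half-complement (∣ N ∣) (∣ B ∣) (∣ M ∖ B ∣) (∣ X ∣) 2∣N∣≤ 1≤B (≤-reflexive (trans (sym M≡B) M≡N)))
            M-w-inh : ∃[ x ] x ∈ (M -ˢ w)
            M-w-inh with inhabited (B ∩ nbrs w) (≤-trans (s≤s z≤n) (2≤deg w∈B))
            ... | x , x∈B , wx = x , B⊆M x∈B , λ { refl → Edge-irrefl wx }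
            e-H : e H ≤ e M + e (H ∖ X)
            e-H = e-cover H M (H ∖ X) split
              where
              to-M : ∀ {u v} → u ∈ X → v ∈ H → Edge u v → v ∈ M
              to-M {u} {v} (u∈M , u∉N) v∈H uv with mem? D v
              ... | no v∉D = v∈H , v∉D
              ... | yes v∈D = ⊥-elim (u∉N (u∈M , v , v∈D , Edge-sym uv))
              split : ∀ {u v} → u ∈ H → v ∈ H → Edge u v → (u ∈ M × v ∈ M) ⊎ (u ∈ (H ∖ X) × v ∈ (H ∖ X))
              split {u} {v} u∈H v∈H uv with mem? X u | mem? X v
              ... | yes u∈X | _ = inj₁ (proj₁ u∈X , to-M u∈X v∈H uv)
              ... | no _ | yes v∈X = inj₁ (to-M v∈X u∈H (Edge-sym uv) , proj₁ v∈X)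
              ... | no u∉X | no v∉X = inj₂ ((u∈H , u∉X) , (v∈H , v∉X))
            deg-M : deg M w ≤ deg B w + ∣ M ∖ B ∣
            deg-M = ∣∣-cover (M ∩ nbrs w) (B ∩ nbrs w) (M ∖ B) split
              where
              split : ∀ {x} → x ∈ (M ∩ nbrs w) → x ∈ (B ∩ nbrs w) ⊎ x ∈ (M ∖ B)
              split {x} (x∈M , wx) with mem? B x
              ... | yes x∈B = inj₁ (x∈B , wx)
              ... | no x∉B = inj₂ (x∈M , x∉B)

    -- Take D maximal: then every vertex outside D attached to D lies on every cycle outside D.
    evenPair : (D₀ : Sub n) → Remainder D₀ → ¬ ¬ EvenPair G H (s + ℓ)
    evenPair D₀ ok₀ noPair = minimal (λ D → ∣ H ∖ D ∣) Remainder D₀ ok₀ λ D ok best →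
      let B , B⊆M , b , h = Remainder.cyclic ok
      in minimal ∣_∣ (λ B → B ⊆ (H ∖ D) × (∃[ b ] b ∈ B) × ∣ B ∣ ≤ e B) B (B⊆M , b , h)
        λ { B (B⊆M , (_ , b∈B) , h) B-min →
          Maximal.Minimal.absurd D ok best noPair B B⊆M b∈B h B-min }

  -- Balls and short paths in a connected set

  module Balls (D : Sub n) (connected : Connected D) where

    ball : Fin n → ℕ → Sub n
    ball x zero    = ⁅ x ⁆
    ball x (suc i) = ball x i ∪ ⟪ (λ v → mem? D v ×-dec Fin.any? λ u → mem? (ball x i) u ×-dec Edge? v u) ⟫

    ball-mono : ∀ {x} i k → ball x i ⊆ ball x (k + i)
    ball-mono i zero    p = p
    ball-mono i (suc k) p = inj₁ (ball-mono i k p)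

    ball-⊆ : ∀ {x} → x ∈ D → ∀ i → ball x i ⊆ D
    ball-⊆ x∈D zero    refl     = x∈D
    ball-⊆ x∈D (suc i) (inj₁ p) = ball-⊆ x∈D i p
    ball-⊆ x∈D (suc i) (inj₂ p) = proj₁ p

    ball-path : ∀ {x v} → x ∈ D → ∀ i → v ∈ ball x i → ∃[ l ] Path v x l × All (_∈ D) l × length l ≤ suc i
    ball-path x∈D zero refl = _ , nil , x∈D ∷ [] , ≤-refl
    ball-path x∈D (suc i) (inj₁ p) =
      let l , q , a , h = ball-path x∈D i p in l , q , a , m≤n⇒m≤1+n h
    ball-path x∈D (suc i) (inj₂ (v∈D , u , u∈ , vu)) =
      let l , q , a , h = ball-path x∈D i u∈ in _ , cons vu q , v∈D ∷ a , s≤s h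

    Path-meet : ∀ {x y z l l′} → Path z x l → All (_∈ D) l → Path z y l′ → All (_∈ D) l′ →
      ∃[ k ] Path x y k × All (_∈ D) k × length k ≤ length l + length l′
    Path-meet nil _ q b = _ , q , b , n≤1+n _
    Path-meet (cons {l = l} zz′ p) (z∈D ∷ a) q b =
      let k , r , c , h = Path-meet p a (cons (Edge-sym zz′) q) (All.lookup a (Path-first p) ∷ b)
      in k , r , c , ≤-trans h (≤-reflexive (+-suc (length l) _))

    ball-center : ∀ {x} i → x ∈ ball x i
    ball-center zero    = refl
    ball-center (suc i) = inj₁ (ball-center i)

    ball-grow : ∀ {x} → x ∈ D → ∀ i → D ⊆ ball x i ⊎ ∣ ball x i ∣ < ∣ ball x (suc i) ∣
    ball-grow {x} x∈D i with Fin.any? (mem? (ball x (suc i) ∖ ball x i))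
    ... | yes (v , v∈ , v∉) = inj₂ (≤-trans
            (s≤s (∣∣-mono (ball x i) (ball x (suc i) -ˢ v) λ p → inj₁ p , λ { refl → v∉ p }))
            (≤-reflexive (sym (∣-∣ (ball x (suc i)) v∈))))
    ... | no none = inj₁ λ {y} y∈D → case y y∈D (mem? (ball x i) y)
      where
      case : ∀ y → y ∈ D → Dec (y ∈ ball x i) → y ∈ ball x i
      case y y∈D (yes p) = p
      case y y∈D (no q) = ⊥-elim (connected (ball x i) (ball-⊆ x∈D i) (ball-center i) y∈D q
        λ {u} {v} u∈ v∈D v∉ uv → none (v , inj₂ (v∈D , u , u∈ , Edge-sym uv) , v∉))

    simplePath : ∀ {x y l m} → Path x y l → All (_∈ D) l → length l ≤ m →
      ∃[ k ] Path x y k × Unique k × All (_∈ D) k × length k ≤ m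
    simplePath p a h = let k , q , u , sub , h′ = Path-loop-erase p h in k , q , u , All.tabulate (All.lookup a ∘ sub) , h′

    -- By connectedness a ball that has not yet filled `D` gains a vertex in every step.
    ball-exhausts : ∀ {x} → x ∈ D → ∀ i → D ⊆ ball x i ⊎ i < ∣ ball x i ∣
    ball-exhausts {x} x∈D zero = inj₂ (≤-reflexive (sym (∣⁅⁆∣ x)))
    ball-exhausts {x} x∈D (suc i) with ball-exhausts x∈D i | ball-grow x∈D i
    ... | inj₁ p | _ = inj₁ (inj₁ ∘ p)
    ... | inj₂ _ | inj₁ p = inj₁ (inj₁ ∘ p)
    ... | inj₂ p | inj₂ q = inj₂ (<-≤-trans (s≤s p) q)

    joined : ∀ {x y} → x ∈ D → y ∈ D → ∃[ l ] Path x y l × Unique l × All (_∈ D) l × length l ≤ ∣ D ∣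
    joined {x} {y} x∈D y∈D =
      let l , p , a , _ = ball-path y∈D (∣ D ∣) (all x∈D)
          k , q , u , b , _ = simplePath p a ≤-refl
      in k , q , u , b , Unique⇒length≤ D u b
      where
      all : D ⊆ ball y ∣ D ∣
      all with ball-exhausts y∈D ∣ D ∣
      ... | inj₁ p = p
      ... | inj₂ p = ⊥-elim (<-irrefl refl (<-≤-trans p (∣∣-mono (ball y ∣ D ∣) D (ball-⊆ y∈D ∣ D ∣))))

  -- Expansion of a minimal subgraph of density above `2 + level ∣ H ∣ / E`

  module Expander (E t : ℕ) (1≤E : 1 ≤ E) (n<2^t : n < 2 ^ t) (H : Sub n)
    (level≤E : level ∣ H ∣ ≤ E)
    (rich : (2 * E + level ∣ H ∣) * ∣ H ∣ < E * e H)
    (sparse : ∀ Z → Z ⊆ H → ∣ Z ∣ < ∣ H ∣ → E * e Z ≤ (2 * E + level ∣ Z ∣) * ∣ Z ∣)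
    where

    open Bounds E t

    private instance
      E≢0 : NonZero E
      E≢0 = >-nonZero 1≤E

    h : ℕ
    h = ∣ H ∣

    some : ∃[ v ] v ∈ H
    some with Fin.any? (mem? H)
    ... | yes p = p
    ... | no none = ⊥-elim (<-irrefl refl (≤-<-trans z≤n (<-≤-trans rich (≤-reflexive
      (trans (cong (E *_) (sum-0 λ x → sum-0 λ y → ⟦⟧-no (arcs-in? H x y) λ (p , _) → none (x , p))) (*-zeroʳ E))))))

    1≤h : 1 ≤ h
    1≤h = ∈⇒1≤∣∣ H (proj₂ some)

    sparse′ : ∀ Z → Z ⊆ H → ∣ Z ∣ < h → E * e Z ≤ (2 * E + level h) * ∣ Z ∣
    sparse′ Z Z⊆H lt = ≤-trans (sparse Z Z⊆H lt) (*-monoˡ-≤ ∣ Z ∣ (+-monoʳ-≤ (2 * E) (level-mono (<⇒≤ lt))))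

    ∖-< : ∀ X → X ⊆ H → ∀ {x} → x ∈ X → ∣ H ∖ X ∣ < h
    ∖-< X X⊆H x∈X = ≤-trans (+-monoˡ-≤ ∣ H ∖ X ∣ (∈⇒1≤∣∣ X x∈X)) (≤-reflexive (sym (∣∖∣ H X X⊆H)))

    -- By minimality `H ∖ X` obeys the density bound that `H` violates, so the vertices of `X`
    -- account for more than two edges each.
    dense : ∀ X → X ⊆ H → ∀ {x} → x ∈ X → 2 * ∣ X ∣ + e (H ∖ X) < e H
    dense X X⊆H x∈X = *-cancelˡ-< E _ _ (≤-<-trans
      (dense-count E (level h) (∣ X ∣) (∣ H ∖ X ∣) (e (H ∖ X)) (sparse′ (H ∖ X) proj₁ (∖-< X X⊆H x∈X)))
      (subst (λ z → (2 * E + level h) * z < E * e H) (∣∖∣ H X X⊆H) rich))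

    -- Both sides of a cut without crossing edges would obey the density bound, and then so would
    -- `H`.
    H-connected : Connected H
    H-connected A A⊆H {a} {b} a∈A b∈H b∉A none = <-irrefl refl (<-≤-trans rich (≤-trans
      (*-monoʳ-≤ E (e-cover H A (H ∖ A) split))
      (connected-count E (level h) (∣ A ∣) (∣ H ∖ A ∣) h (e A) (e (H ∖ A)) (∣∖∣ H A A⊆H)
        (sparse′ A A⊆H (≤-trans (≤-reflexive (+-comm 1 _)) (≤-trans (+-monoʳ-≤ ∣ A ∣ (∈⇒1≤∣∣ (H ∖ A) (b∈H , b∉A)))
          (≤-reflexive (sym (∣∖∣ H A A⊆H))))))
        (sparse′ (H ∖ A) proj₁ (∖-< A A⊆H a∈A)))))
      where
      split : ∀ {u v} → u ∈ H → v ∈ H → Edge u v → (u ∈ A × v ∈ A) ⊎ (u ∈ (H ∖ A) × v ∈ (H ∖ A))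
      split {u} {v} u∈H v∈H uv with mem? A u | mem? A v
      ... | yes p | yes q = inj₁ (p , q)
      ... | no p | no q = inj₂ ((u∈H , p) , (v∈H , q))
      ... | yes p | no q = ⊥-elim (none p v∈H q uv)
      ... | no p | yes q = ⊥-elim (none q u∈H p (Edge-sym uv))

    boundary : Sub n → Sub n
    boundary X = ⟪ (λ v → mem? H v ×-dec ¬? (mem? X v) ×-dec Fin.any? λ u → mem? X u ×-dec Edge? u v) ⟫

    -- Every edge of `H` lies in `H ∖ X` or in `Y`, which is `X` with its boundary. As `Y` has at
    -- most three quarters of the vertices, its level is smaller than that of `H`; so `Y` can make
    -- up for the edges touching `X` only if the boundary is large.
    expansion : ∀ X → X ⊆ H → ∀ {x} → x ∈ X → 4 * (∣ X ∣ + ∣ boundary X ∣) ≤ 3 * h → ∣ X ∣ < 3 * E * ∣ boundary X ∣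
    expansion X X⊆H {x} x∈X small = finish (level h) refl (level-drop (∣ Y ∣) h 1≤Y 4Y≤3h)
      where
      Y = X ∪ boundary X
      ∣Y∣≤ : ∣ Y ∣ ≤ ∣ X ∣ + ∣ boundary X ∣
      ∣Y∣≤ = ∣∣-cover Y X (boundary X) id
      4Y≤3h : 4 * ∣ Y ∣ ≤ 3 * h
      4Y≤3h = ≤-trans (*-monoʳ-≤ 4 ∣Y∣≤) small
      1≤Y : 1 ≤ ∣ Y ∣
      1≤Y = ∈⇒1≤∣∣ Y (inj₁ x∈X)
      Y<h : ∣ Y ∣ < h
      Y<h = *-cancelˡ-< 3 _ _ (<-≤-trans (*-monoˡ-< ∣ Y ∣ {{>-nonZero 1≤Y}} {3} {4} ≤-refl) 4Y≤3h)
      Y⊆H : Y ⊆ H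
      Y⊆H (inj₁ p) = X⊆H p
      Y⊆H (inj₂ p) = proj₁ p
      e-H : e H ≤ e (H ∖ X) + e Y
      e-H = e-cover H (H ∖ X) Y split
        where
        to-Y : ∀ {u v} → u ∈ X → v ∈ H → Edge u v → v ∈ Y
        to-Y {u} {v} u∈X v∈H uv with mem? X v
        ... | yes p = inj₁ p
        ... | no q = inj₂ (v∈H , q , u , u∈X , uv)
        split : ∀ {u v} → u ∈ H → v ∈ H → Edge u v → (u ∈ (H ∖ X) × v ∈ (H ∖ X)) ⊎ (u ∈ Y × v ∈ Y)
        split {u} {v} u∈H v∈H uv with mem? X u | mem? X v
        ... | yes p | _ = inj₂ (inj₁ p , to-Y p v∈H uv)
        ... | no _ | yes q = inj₂ (to-Y q u∈H (Edge-sym uv) , inj₁ q)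
        ... | no p | no q = inj₁ ((u∈H , p) , (v∈H , q))
      finish : ∀ l → level h ≡ l → level ∣ Y ∣ < l → ∣ X ∣ < 3 * E * ∣ boundary X ∣
      finish (suc l) eq (s≤s lt) = expansion-count E l (∣ X ∣) (∣ H ∖ X ∣) (∣ boundary X ∣) (e (H ∖ X)) (e Y) (e H)
        (subst₂ (λ z w → (2 * E + z) * w < E * e H) eq (∣∖∣ H X X⊆H) rich)
        (*-monoʳ-≤ E e-H)
        (subst (λ z → E * e (H ∖ X) ≤ (2 * E + z) * ∣ H ∖ X ∣) eq (sparse′ (H ∖ X) proj₁ (∖-< X X⊆H x∈X)))
        (≤-trans (sparse Y Y⊆H Y<h) (*-mono-≤ (+-monoʳ-≤ (2 * E) lt) ∣Y∣≤))
        (*-monoʳ-≤ ∣ boundary X ∣ (≤-trans (n≤1+n l) (≤-trans (≤-reflexive (sym eq)) level≤E)))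

    -- `D` is a component of `H ∖ B` that misses at most `s` vertices of `H`.
    record Giant (B : Sub n) (s : ℕ) : Set₁ where
      field
        {D}       : Sub n
        avoids    : ∀ {x} → x ∈ D → x ∈ H × x ∉ B
        connected : Connected D
        inhabit   : ∃[ d ] d ∈ D
        small     : ∣ H ∖ D ∣ ≤ s
        closed    : ∀ {x y} → x ∈ D → y ∈ H → y ∉ B → Edge x y → y ∈ D

    -- Take a least union of components of `H ∖ B` with at least `3 * E * b` vertices. By expansion
    -- it has about three quarters of `H` or more. A cut without crossing edges would split it into
    -- two unions below `3 * E * b`, too few in total; and the rest `R` is below that bound, since
    -- two sets of about `3 * h / 4` vertices do not fit into `H`.
    giant : ∀ B b → B ⊆ H → ∣ B ∣ ≤ b → 1 ≤ b → 4 * ((6 * E + 1) * b) ≤ 3 * h → (Giant B (4 * E * b) → ⊥) → ⊥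
    giant B b B⊆H ∣B∣≤b 1≤b room k = minimal ∣_∣ (λ A → Closed A × 3 * E * b ≤ ∣ A ∣) (H ∖ B)
      (((λ p → p) , λ _ y∈H y∉B _ → y∈H , y∉B) , large₀) build
      where
      Closed : Sub n → Set
      Closed A = (∀ {x} → x ∈ A → x ∈ H × x ∉ B) × (∀ {x y} → x ∈ A → y ∈ H → y ∉ B → Edge x y → y ∈ A)
      large₀ : 3 * E * b ≤ ∣ H ∖ B ∣
      large₀ = *-cancelˡ-≤ 3 (giant-room E b h (∣ H ∖ B ∣) room (∣∣-cover H B (H ∖ B) split) ∣B∣≤b)
        where
        split : ∀ {x} → x ∈ H → x ∈ B ⊎ x ∈ (H ∖ B)
        split {x} x∈H with mem? B x
        ... | yes p = inj₁ p
        ... | no q = inj₂ (x∈H , q)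
      -- The boundary of a closed set lies in B, so by expansion the set is tiny or of size at least about 3h/4.
      dichotomy : ∀ A → Closed A → ∣ A ∣ < 3 * E * b ⊎ 3 * h < 4 * (∣ A ∣ + b)
      dichotomy A (A⊆ , cl) with 4 * (∣ A ∣ + b) ≤? 3 * h
      ... | no ≰ = inj₂ (≰⇒> ≰)
      ... | yes fits with Fin.any? (mem? A)
      ...   | no none = inj₁ (≤-trans (s≤s (≤-reflexive (∣∣≡0 A λ {x} p → none (x , p))))
                (*-mono-≤ (*-mono-≤ (s≤s {n = 2} z≤n) 1≤E) 1≤b))
      ...   | yes (a , a∈A) = inj₁ (<-≤-trans
                (expansion A (proj₁ ∘ A⊆) a∈A (≤-trans (*-monoʳ-≤ 4 (+-monoʳ-≤ ∣ A ∣ ∂≤b)) fits))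
                (*-monoʳ-≤ (3 * E) ∂≤b))
        where
        ∂⊆B : boundary A ⊆ B
        ∂⊆B {v} (v∈H , v∉A , u , u∈A , uv) with mem? B v
        ... | yes p = p
        ... | no q = ⊥-elim (v∉A (cl u∈A v∈H q uv))
        ∂≤b : ∣ boundary A ∣ ≤ b
        ∂≤b = ≤-trans (∣∣-mono (boundary A) B ∂⊆B) ∣B∣≤b
      build : ∀ D → Closed D × 3 * E * b ≤ ∣ D ∣ → (∀ Z → ∣ Z ∣ < ∣ D ∣ → ¬ (Closed Z × 3 * E * b ≤ ∣ Z ∣)) → ⊥
      build D ((D⊆ , cl) , large) least = k record
        { D = D ; avoids = D⊆ ; connected = connected ; closed = cl
        ; inhabit = inhabited D (≤-trans (*-mono-≤ (*-mono-≤ (s≤s {n = 2} z≤n) 1≤E) 1≤b) large)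
        ; small = ≤-trans (∣∣-cover (H ∖ D) R B split) (+-mono-≤ (<⇒≤ R-small) ∣B∣≤b ■ 3Eb+b≤4Eb E b 1≤E) }
        where
        infixl 2 _■_
        _■_ = ≤-trans
        D-big : 3 * h < 4 * (∣ D ∣ + b)
        D-big with dichotomy D (D⊆ , cl)
        ... | inj₁ lt = ⊥-elim (<-irrefl refl (<-≤-trans lt large))
        ... | inj₂ p = p
        connected : Connected D
        connected A A⊆D {a} {b′} a∈A b′∈D b′∉A none = small-parts-absurd E b h (∣ A ∣) (∣ D ∖ A ∣) (∣ D ∣) room D-big
          (≤-reflexive (∣∖∣ D A A⊆D)) A-small DA-small
          where
          A-small : ∣ A ∣ < 3 * E * b
          A-small with 3 * E * b ≤? ∣ A ∣
          ... | no ≰ = ≰⇒> ≰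
          ... | yes p = ⊥-elim (least A
                (≤-trans (≤-reflexive (+-comm 1 _)) (≤-trans (+-monoʳ-≤ ∣ A ∣ (∈⇒1≤∣∣ (D ∖ A) (b′∈D , b′∉A)))
                  (≤-reflexive (sym (∣∖∣ D A A⊆D)))))
                ((D⊆ ∘ A⊆D , clA) , p))
            where
            clA : ∀ {x y} → x ∈ A → y ∈ H → y ∉ B → Edge x y → y ∈ A
            clA {x} {y} x∈A y∈H y∉B xy with mem? A y
            ... | yes q = q
            ... | no q = ⊥-elim (none x∈A (cl (A⊆D x∈A) y∈H y∉B xy) q xy)
          DA-small : ∣ D ∖ A ∣ < 3 * E * b
          DA-small with 3 * E * b ≤? ∣ D ∖ A ∣
          ... | no ≰ = ≰⇒> ≰
          ... | yes p = ⊥-elim (least (D ∖ A)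
                (≤-trans (+-monoˡ-≤ ∣ D ∖ A ∣ (∈⇒1≤∣∣ A a∈A)) (≤-reflexive (sym (∣∖∣ D A A⊆D))))
                ((D⊆ ∘ proj₁ , λ (x∈D , x∉A) y∈H y∉B xy → cl x∈D y∈H y∉B xy ,
                  λ y∈A → none y∈A x∈D x∉A (Edge-sym xy)) , p))
        R = H ∖ B ∖ D
        split : ∀ {x} → x ∈ (H ∖ D) → x ∈ R ⊎ x ∈ B
        split {x} (x∈H , x∉D) with mem? B x
        ... | yes p = inj₂ p
        ... | no q = inj₁ ((x∈H , q) , x∉D)
        R-small : ∣ R ∣ < 3 * E * b
        R-small with dichotomy R (proj₁ , λ ((x∈H , x∉B) , x∉D) y∈H y∉B xy →
                      (y∈H , y∉B) , λ y∈D → x∉D (cl y∈D x∈H x∉B (Edge-sym xy)))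
        ... | inj₁ p = p
        ... | inj₂ q = ⊥-elim (two-giants-absurd E b h (∣ R ∣) (∣ D ∣) room D-big q
                        (∣∣-pack H R D (proj₁ ∘ proj₁) (proj₁ ∘ D⊆) proj₂) (m≤n*m b E))

    module Diameter (D : Sub n) (D⊆H : D ⊆ H) (connected : Connected D) (s : ℕ)
      (missing : ∣ H ∖ D ∣ ≤ s) (room : 4 * s ≤ h) where
      open Balls D connected

      module From {x : Fin n} (x∈D : x ∈ D) where

        β : ℕ → ℕ
        β i = ∣ ball x i ∣

        Big : ℕ → Set
        Big i = h < 2 * β i

        Big-mono : ∀ k {i} → Big i → Big (k + i)
        Big-mono k {i} p = <-≤-trans p (*-monoʳ-≤ 2 (∣∣-mono (ball x i) (ball x (k + i)) (ball-mono i k)))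

        full⇒Big : ∀ i → D ⊆ ball x i → Big i
        full⇒Big i p = cofinite-majority h s (∣ D ∣) (∣ H ∖ D ∣) (β i) 1≤h room (≤-reflexive (∣∖∣ H D D⊆H)) missing (∣∣-mono D (ball x i) p)

        ∂-step : ∀ i → β i + ∣ boundary (ball x i) ∣ ≤ β (suc i) + s
        ∂-step i = begin
          β i + ∣ boundary X ∣               ≤⟨ ∣∣-pack (X ∪ boundary X) X (boundary X) inj₁ inj₂ (λ p q → proj₁ (proj₂ q) p) ⟩
          ∣ X ∪ boundary X ∣                 ≤⟨ ∣∣-cover (X ∪ boundary X) (ball x (suc i)) (H ∖ D) split ⟩
          β (suc i) + ∣ H ∖ D ∣              ≤⟨ +-monoʳ-≤ (β (suc i)) missing ⟩
          β (suc i) + s                      ∎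
          where
          open ≤-Reasoning
          X = ball x i
          split : ∀ {v} → v ∈ (X ∪ boundary X) → v ∈ ball x (suc i) ⊎ v ∈ (H ∖ D)
          split (inj₁ p) = inj₁ (inj₁ p)
          split {v} (inj₂ (v∈H , _ , u , u∈X , uv)) with mem? D v
          ... | yes v∈D = inj₁ (inj₂ (v∈D , u , u∈X , Edge-sym uv))
          ... | no v∉D = inj₂ (v∈H , v∉D)

        -- Either the ball expands, or it fills three quarters of `H` together with its boundary. In
        -- the second case at most `s` of these vertices, hence at most a quarter of `H`, are
        -- missing from the next ball.
        step : ∀ i → Big (suc i) ⊎ 3 * E * β i + β i < 3 * E * β (suc i) + 3 * E * s
        step i with 4 * (β i + ∣ boundary (ball x i) ∣) ≤? 3 * h
        ... | yes fits = inj₂ (growth-count E (β i) (∣ boundary (ball x i) ∣) (β (suc i)) s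
                (expansion (ball x i) (D⊆H ∘ ball-⊆ x∈D i) (ball-center i) fits) (∂-step i))
        ... | no ¬fits = inj₁ (saturated-majority h (β i + ∣ boundary (ball x i) ∣) (β (suc i)) s (≰⇒> ¬fits) (∂-step i) room)

        linear : ∀ i → 6 * E * s ≤ β i → ∀ k → Big (k + i) ⊎ (6 * E + k) * β i ≤ 6 * E * β (k + i)
        linear i p zero = inj₂ (≤-reflexive (cong (_* β i) (+-identityʳ (6 * E))))
        linear i p (suc k) with linear i p k | step (k + i)
        ... | inj₁ big | _ = inj₁ (Big-mono 1 {k + i} big)
        ... | inj₂ _ | inj₁ big = inj₁ big
        ... | inj₂ q | inj₂ r = inj₂ (growth-iterate E s k (β i) (β (k + i)) (β (suc (k + i))) p q r
                (∣∣-mono (ball x i) (ball x (k + i)) (ball-mono i k)))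

        doubling : ∀ j → Big (j * (6 * E) + 6 * E * s) ⊎
          (6 * E * s ≤ β (j * (6 * E) + 6 * E * s) × 2 ^ j ≤ β (j * (6 * E) + 6 * E * s))
        doubling zero with ball-exhausts x∈D (6 * E * s)
        ... | inj₁ p = inj₁ (full⇒Big (6 * E * s) p)
        ... | inj₂ p = inj₂ (<⇒≤ p , ≤-trans (s≤s z≤n) p)
        doubling (suc j) rewrite +-assoc (6 * E) (j * (6 * E)) (6 * E * s) with doubling j
        ... | inj₁ big = inj₁ (Big-mono (6 * E) {j * (6 * E) + 6 * E * s} big)
        ... | inj₂ (p , q) with linear (j * (6 * E) + 6 * E * s) p (6 * E)
        ...   | inj₁ big = inj₁ big
        ...   | inj₂ r = inj₂ (≤-trans p (≤-trans (m≤n*m (β i) 2) twice) , ≤-trans (*-monoʳ-≤ 2 q) twice)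
          where
          i = j * (6 * E) + 6 * E * s
          twice : 2 * β i ≤ β (6 * E + i)
          twice = *-cancelˡ-≤ (6 * E) {{m*n≢0 6 E}} (≤-trans (≤-reflexive (6E*2b≡[6E+6E]*b E (β i))) r)

        big : Big (t * (6 * E) + 6 * E * s)
        big with doubling t
        ... | inj₁ p = p
        -- After `t` doublings the ball would have at least `2 ^ t` vertices, more than the whole
        -- graph.
        ... | inj₂ (_ , p) = ⊥-elim (<-irrefl refl (<-≤-trans n<2^t (≤-trans p (∣∣≤n (ball x (t * (6 * E) + 6 * E * s))))))

      short-path : ∀ {x y} → x ∈ D → y ∈ D →
        ∃[ l ] Path x y l × Unique l × All (_∈ D) l × length l ≤ diameter E t s
      short-path {x} {y} x∈D y∈D with Fin.any? (mem? (ball x (t * (6 * E) + 6 * E * s) ∩ ball y (t * (6 * E) + 6 * E * s)))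
      -- Each of the two balls contains more than half of `H`, so they share a vertex.
      ... | no none = ⊥-elim (majorities-meet h (∣ ball x i ∣) (∣ ball y i ∣) (From.big x∈D) (From.big y∈D)
              (∣∣-pack H (ball x i) (ball y i) (D⊆H ∘ ball-⊆ x∈D i) (D⊆H ∘ ball-⊆ y∈D i) λ {z} p q → none (z , p , q)))
        where
        i = t * (6 * E) + 6 * E * s
      ... | yes (z , z∈x , z∈y) =
        let i = t * (6 * E) + 6 * E * s
            l , p , a , hl = ball-path x∈D i z∈x
            l′ , p′ , a′ , hl′ = ball-path y∈D i z∈y
            k , q , b , hk = Path-meet p a p′ a′
        in simplePath q b (≤-trans hk (≤-trans (+-mono-≤ hl hl′) (≤-reflexive (cong (suc i +_) (sym (+-identityʳ (suc i)))))))

    -- If deleting `v` leaves further vertices besides `D`, the more than `2 * ∣ R ∣` edges touching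
    -- this rest `R` stay in `H ∖ D`, which has only `∣ R ∣ + 1` vertices.
    dense-cycle : ∀ D {x} → D ⊆ H → x ∈ H → x ∉ D → ∀ v → v ∉ D →
      (∀ {x y} → x ∈ D → y ∈ H → y ≢ v → Edge x y → y ∈ D) → x ≢ v → ∣ H ∖ D ∣ ≤ e (H ∖ D)
    dense-cycle D {x} D⊆H x∈H x∉D v v∉D closed x≢v = closed-count (∣ H ∖ D ∣) (∣ R ∣) (e (H ∖ R)) (e H) (e (H ∖ D))
        (∣∣-cover (H ∖ D) R ⁅ v ⁆ split₁ ■ ≤-reflexive (cong (∣ R ∣ +_) (∣⁅⁆∣ v)))
        (dense R (proj₁ ∘ proj₁) x∈R)
        (e-cover H (H ∖ R) (H ∖ D) split₂) (∈⇒1≤∣∣ R x∈R)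
      where
      infixl 2 _■_
      _■_ = ≤-trans
      R = H ∖ D -ˢ v
      x∈R : x ∈ R
      x∈R = (x∈H , x∉D) , x≢v
      split₁ : ∀ {y} → y ∈ (H ∖ D) → y ∈ R ⊎ y ∈ ⁅ v ⁆
      split₁ {y} p with y Fin.≟ v
      ... | yes q = inj₂ q
      ... | no q = inj₁ (p , q)
      to-M : ∀ {u w} → u ∈ R → w ∈ H → Edge u w → w ∉ D
      to-M ((u∈H , u∉D) , u≢v) w∈H uw w∈D = u∉D (closed w∈D u∈H u≢v (Edge-sym uw))
      split₂ : ∀ {u w} → u ∈ H → w ∈ H → Edge u w → (u ∈ (H ∖ R) × w ∈ (H ∖ R)) ⊎ (u ∈ (H ∖ D) × w ∈ (H ∖ D))
      split₂ {u} {w} u∈H w∈H uw with mem? R u | mem? R w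
      ... | yes p | _ = inj₂ (proj₁ p , w∈H , to-M p w∈H uw)
      ... | no _ | yes q = inj₂ ((u∈H , to-M q u∈H (Edge-sym uw)) , proj₁ q)
      ... | no p | no q = inj₁ ((u∈H , p) , (w∈H , q))

    3≤deg : ∀ {v} → v ∈ H → 3 ≤ deg H v
    3≤deg {v} v∈H = +-cancelˡ-≤ (e (H -ˢ v)) 3 (deg H v) (≤-trans
      (≤-reflexive (trans (+-comm (e (H -ˢ v)) 3) (cong (λ z → suc (2 * z + e (H -ˢ v))) (sym (∣⁅⁆∣ v)))))
      (≤-trans (dense ⁅ v ⁆ (λ { refl → v∈H }) refl) (≤-reflexive (e-remove H v∈H))))

    -- Deleting `v` leaves a giant component. A cyclic set of at most `b₂` vertices is either
    -- everything outside that component or, if only `v` is outside, a cycle formed by `v` and a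
    -- short path between two of its neighbours. The giant component left by deleting this set
    -- starts the maximality argument.
    large-case : threshold ≤ h → ¬ ¬ EvenPair G H bound
    large-case large noPair with some
    ... | v , v∈H = giant ⁅ v ⁆ 1 (λ { refl → v∈H }) (≤-reflexive (∣⁅⁆∣ v)) ≤-refl room₁ λ D₁ → find-cycle D₁ λ B b∈B B⊆H ∣B∣≤ ∣B∣≤e →
        giant B b₂ B⊆H ∣B∣≤ (s≤s z≤n ■ m≤n+m (suc _) s₁) (large ■ m≤n*m h 3) λ D₂ →
        Endgame.evenPair H s₂ (diameter E t s₂) dense H-connected
          (λ D D⊆H conn sm x∈D y∈D k → let l , p , u , a , len = Diameter.short-path D D⊆H conn s₂ sm room₂ x∈D y∈D in k p u a len)
          (Giant.D D₂)
          record { D⊆H = proj₁ ∘ Giant.avoids D₂ ; connected = Giant.connected D₂ ; inhabit = Giant.inhabit D₂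
                 ; small = Giant.small D₂
                 ; cyclic = B , (λ x∈B → B⊆H x∈B , λ x∈D → proj₂ (Giant.avoids D₂ x∈D) x∈B) , (_ , b∈B) , ∣B∣≤e }
          (noPair ∘ EvenPair-weaken {G = G} {X = H} {H} id (m≤m+n _ (threshold + threshold)))
      where
      infixl 2 _■_
      _■_ = ≤-trans
      1≤b₂ : 1 ≤ b₂
      1≤b₂ = s≤s z≤n ■ m≤n+m (suc _) s₁
      room₁ : 4 * ((6 * E + 1) * 1) ≤ 3 * h
      room₁ = *-monoʳ-≤ 4 (*-monoʳ-≤ (6 * E + 1) 1≤b₂) ■ large ■ m≤n*m h 3
      room-s : ∀ b → 4 * (4 * E * b) ≤ 4 * ((6 * E + 1) * b)
      room-s b = *-monoʳ-≤ 4 (*-monoˡ-≤ b (*-monoˡ-≤ E {4} {6} (m≤m+n 4 2) ■ m≤m+n (6 * E) 1))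
      room₂ : 4 * s₂ ≤ h
      room₂ = room-s b₂ ■ large
      room₁′ : 4 * s₁ ≤ h
      room₁′ = room-s 1 ■ *-monoʳ-≤ 4 (*-monoʳ-≤ (6 * E + 1) 1≤b₂) ■ large
      find-cycle : Giant ⁅ v ⁆ s₁ →
        (∀ B {b} → b ∈ B → B ⊆ H → ∣ B ∣ ≤ b₂ → ∣ B ∣ ≤ e B → ⊥) → ⊥
      find-cycle D₁ k with Fin.any? (mem? (H ∖ Giant.D D₁ -ˢ v))
      ... | yes (x , (x∈H , x∉D) , x≢v) = k (H ∖ D) {x} (x∈H , x∉D) proj₁ (small ■ m≤m+n s₁ _)
              (dense-cycle D (proj₁ ∘ avoids) x∈H x∉D v (λ v∈D → proj₂ (avoids v∈D) refl) closed x≢v)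
        where open Giant D₁
      ... | no none with pick (H ∩ nbrs v) [] (s≤s z≤n ■ 3≤deg v∈H)
      ...   | y₁ , (y₁∈H , vy₁) , _ with pick (H ∩ nbrs v) [ y₁ ] (s≤s (s≤s z≤n) ■ 3≤deg v∈H)
      ...     | y₂ , (y₂∈H , vy₂) , y₂≢ =
        let l , p , u , a , len = Diameter.short-path D (proj₁ ∘ avoids) connected s₁ small room₁′ (in-D y₁∈H vy₁) (in-D y₂∈H vy₂)
            C : Cycle (v ∷ l)
            C = record { path = cons vy₁ p ; close = Edge-sym vy₂
                       ; unique = All.tabulate (λ z∈ → λ { refl → proj₂ (avoids (All.lookup a z∈)) refl }) ∷ u
                       ; long = s≤s (2≤ p) }
        in k ⟨ v ∷ l ⟩ (here refl) (λ { (here refl) → v∈H ; (there z∈) → proj₁ (avoids (All.lookup a z∈)) })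
             (∣⟨⟩∣ (v ∷ l) ■ s≤s len ■ m≤n+m _ s₁) (∣⟨⟩∣ (v ∷ l) ■ Cycle-edges C)
        where
        open Giant D₁
        in-D : ∀ {y} → y ∈ H → Edge v y → y ∈ D
        in-D {y} y∈H vy with mem? D y
        ... | yes q = q
        ... | no q = ⊥-elim (none (y , (y∈H , q) , λ { refl → Edge-irrefl vy }))
        2≤ : ∀ {l} → Path y₁ y₂ l → 2 ≤ length l
        2≤ nil = ⊥-elim (y₂≢ (here refl))
        2≤ (cons _ nil) = s≤s (s≤s z≤n)
        2≤ (cons _ (cons _ _)) = s≤s (s≤s z≤n)

    -- A single vertex `v` serves as the starting connected set: `H -ˢ v` is cyclic, as fewer than
    -- `h` of the more than `2 * h` edges are lost. The size of `H` bounds all paths and cycles.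
    small-case : h ≤ threshold → ¬ ¬ EvenPair G H bound
    small-case h≤ noPair with some
    ... | v , v∈H = Endgame.evenPair H threshold threshold dense H-connected
          (λ D D⊆H conn _ x∈D y∈D k → let l , p , u , a , len = Balls.joined D conn x∈D y∈D
                                      in k p u a (≤-trans len (≤-trans (∣∣-mono D H D⊆H) h≤)))
          ⁅ v ⁆
          record { D⊆H = λ { refl → v∈H } ; connected = λ { A A⊆ a∈A refl v∉A _ → v∉A (subst (_∈ A) (A⊆ a∈A) a∈A) }
                 ; inhabit = v , refl ; small = ≤-trans (∣∣-mono (H -ˢ v) H proj₁) h≤
                 ; cyclic = H -ˢ v , id , other , cyc }
          (noPair ∘ EvenPair-weaken {G = G} {X = H} {H} id (m≤n+m _ (s₂ + diameter E t s₂)))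
      where
      other : ∃[ b ] b ∈ (H -ˢ v)
      other with inhabited (H ∩ nbrs v) (≤-trans (s≤s z≤n) (3≤deg v∈H))
      ... | y , y∈H , vy = y , y∈H , λ { refl → Edge-irrefl vy }
      cyc : ∣ H -ˢ v ∣ ≤ e (H -ˢ v)
      cyc = delete-count (∣ H -ˢ v ∣) h (e (H -ˢ v)) (deg H v) (e H) (≤-reflexive (sym (∣-∣ H v∈H))) (deg<∣∣ H v∈H) (≤-reflexive (e-remove H v∈H))
        (≤-trans (s≤s (m≤m+n _ _)) (dense H id v∈H))

  -- A least subset of `U` that still exceeds the density bound at its own level is an expander in
  -- the sense above.
  bipartite-evenPair : (E t : ℕ) → 1 ≤ E → n < 2 ^ t →
    ∀ U → level ∣ U ∣ ≤ E → (2 * E + level ∣ U ∣) * ∣ U ∣ < E * e U → ¬ ¬ EvenPair G U (Bounds.bound E t)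
  bipartite-evenPair E t 1≤E n<2^t U level≤E rich noPair = minimal ∣_∣
    (λ H → H ⊆ U × (2 * E + level ∣ H ∣) * ∣ H ∣ < E * e H) U (id , rich) λ H (H⊆U , rich-H) least →
    let level-H = ≤-trans (level-mono (∣∣-mono H U H⊆U)) level≤E
        sparse-H = λ Z (Z⊆H : Z ⊆ H) lt → ≮⇒≥ (λ r → least Z lt (H⊆U ∘ Z⊆H , r))
        noPair-H = noPair ∘ EvenPair-weaken {G = G} {X = H} {U} H⊆U ≤-refl
    in [ (λ p → Expander.large-case E t 1≤E n<2^t H level-H rich-H sparse-H p noPair-H)
       , (λ p → Expander.small-case E t 1≤E n<2^t H level-H rich-H sparse-H p noPair-H) ]′ (≤-total (Bounds.threshold E t) ∣ H ∣)

-- Squares, hexagons and large bicliques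

module _ {n : ℕ} (G : Graph n) where

  N : Fin n → Sub n
  N v = ⟪ (λ u → adj G v u Bool.≟ true) ⟫

  N-sym : ∀ {u v} → u ∈ N v → v ∈ N u
  N-sym {u} {v} p = trans (adj-sym G u v) p

  N-irrefl : ∀ {u} → u ∉ N u
  N-irrefl {u} p with () ← trans (sym p) (adj-irrefl G u)

  N-≢ : ∀ {u v} → u ∈ N v → u ≢ v
  N-≢ p refl = N-irrefl p

  -- Colouring by membership in `X` makes the bipartite notions of path and cycle available in any
  -- graph, for cycles alternating between `X` and its complement.
  module _ (X : Sub n) where
    private
      χ : Fin n → Bool
      χ v = does (mem? X v)
    open Bipartite G χ

    in⇒χ : ∀ {v} → v ∈ X → χ v ≡ true
    in⇒χ {v} p with mem? X v
    ... | yes _ = refl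
    ... | no q = ⊥-elim (q p)

    out⇒χ : ∀ {v} → v ∉ X → χ v ≡ false
    out⇒χ {v} p with mem? X v
    ... | yes q = ⊥-elim (p q)
    ... | no _ = refl

    edge : ∀ {a x} → a ∈ X → x ∉ X → x ∈ N a → Edge a x
    edge p q r = inj₁ (in⇒χ p , out⇒χ q , r)

    apart : ∀ {a x} → a ∈ X → x ∉ X → a ≢ x
    apart p q refl = q p

    hexagon : ∀ {a b c x y z} → a ∈ X → b ∈ X → c ∈ X → x ∉ X → y ∉ X → z ∉ X →
      a ≢ b → a ≢ c → b ≢ c → x ≢ y → x ≢ z → y ≢ z →
      x ∈ N a → x ∈ N b → y ∈ N b → y ∈ N c → z ∈ N c → z ∈ N a →
      CycleOn G 6 ⟨ a ∷ x ∷ b ∷ y ∷ c ∷ z ∷ [] ⟩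
    hexagon {a} {b} {c} {x} {y} {z} a∈ b∈ c∈ x∉ y∉ z∉ ab ac bc xy xz yz ax bx by cy cz az = Cycle⇒CycleOn record
      { path = cons (edge a∈ x∉ ax) (cons (Edge-sym (edge b∈ x∉ bx)) (cons (edge b∈ y∉ by)
          (cons (Edge-sym (edge c∈ y∉ cy)) (cons (edge c∈ z∉ cz) nil))))
      ; close = Edge-sym (edge a∈ z∉ az)
      ; unique = (apart a∈ x∉ ∷ ab ∷ apart a∈ y∉ ∷ ac ∷ apart a∈ z∉ ∷ [])
          ∷ (≢-sym (apart b∈ x∉) ∷ xy ∷ ≢-sym (apart c∈ x∉) ∷ xz ∷ [])
          ∷ (apart b∈ y∉ ∷ bc ∷ apart b∈ z∉ ∷ [])
          ∷ (≢-sym (apart c∈ y∉) ∷ yz ∷ []) ∷ (apart c∈ z∉ ∷ []) ∷ [] ∷ []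
      ; long = s≤s (s≤s (s≤s z≤n)) }

    square : ∀ {a b x y} → a ∈ X → b ∈ X → x ∉ X → y ∉ X → a ≢ b → x ≢ y →
      x ∈ N a → x ∈ N b → y ∈ N b → y ∈ N a → CycleOn G 4 ⟨ a ∷ x ∷ b ∷ y ∷ [] ⟩
    square {a} {b} {x} {y} a∈ b∈ x∉ y∉ ab xy ax bx by ay = Cycle⇒CycleOn record
      { path = cons (edge a∈ x∉ ax) (cons (Edge-sym (edge b∈ x∉ bx)) (cons (edge b∈ y∉ by) nil))
      ; close = Edge-sym (edge a∈ y∉ ay)
      ; unique = (apart a∈ x∉ ∷ ab ∷ apart a∈ y∉ ∷ [])
          ∷ (≢-sym (apart b∈ x∉) ∷ xy ∷ []) ∷ (apart b∈ y∉ ∷ []) ∷ [] ∷ []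
      ; long = s≤s (s≤s (s≤s z≤n)) }

  disjoint-cycles : ∀ {X Y : Sub n} r → 2 ≤ r → CycleOn G (2 * r) X → CycleOn G (2 * r + 2) Y →
    (∀ {v} → v ∈ X → v ∈ Y → ⊥) → HasConsecutiveEvenCycles G
  disjoint-cycles {X} {Y} r 2≤r C D disj = r , 2≤r , C.vertices , D.vertices , C.isCycle , D.isCycle ,
    λ i j eq → disj (C.inside i) (subst (_∈ Y) (sym eq) (D.inside j))
    where
    module C = CycleOn C
    module D = CycleOn D

  Complete : Sub n → Sub n → Set
  Complete A B = ∀ {a b} → a ∈ A → b ∈ B → b ∈ N a

  -- On the side of `S` the square has to avoid only the vertices in `used`, so two more vertices of
  -- `A` suffice; on the other side it may have to avoid all of the hexagon.
  hexagon-square : ∀ (S : Sub n) {hex} used → CycleOn G 6 ⟨ hex ⟩ → length hex ≤ 6 → (∀ {v} → v ∈ˡ hex → v ∈ S → v ∈ˡ used) →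
    (A B : Sub n) → A ⊆ S → (∀ {v} → v ∈ B → v ∉ S) → Complete A B → suc (length used) < ∣ A ∣ → 8 < ∣ B ∣ →
    HasConsecutiveEvenCycles G
  hexagon-square S {hex} used C ≤6 covered A B A⊆S B∩S complete room roomB
    with pick A used (<⇒≤ room)
  ... | a , a∈ , a∉ with pick A (a ∷ used) room
  ...   | b , b∈ , b∉ with pick B hex (≤-trans (s≤s ≤6) (≤-trans (m≤m+n 7 2) roomB))
  ...     | x , x∈ , x∉ with pick B (x ∷ hex) (≤-trans (s≤s (s≤s ≤6)) (≤-trans (m≤m+n 8 1) roomB))
  ...       | y , y∈ , y∉ = disjoint-cycles {⟨ a ∷ x ∷ b ∷ y ∷ [] ⟩} {⟨ hex ⟩} 2 ≤-refl
    (square S (A⊆S a∈) (A⊆S b∈) (B∩S x∈) (B∩S y∈) (λ { refl → b∉ (here refl) }) (λ { refl → y∉ (here refl) })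
      (complete a∈ x∈) (complete b∈ x∈) (complete b∈ y∈) (complete a∈ y∈)) C
    λ { (here refl) p → a∉ (covered p (A⊆S a∈))
      ; (there (here refl)) p → x∉ p
      ; (there (there (here refl))) p → b∉ (there (covered p (A⊆S b∈)))
      ; (there (there (there (here refl)))) p → y∉ (there p) }

  -- Pigeonhole principle by double counting: if every `b` were related to at most `c` elements of
  -- `A`, there would be at most `c * σ` elements.
  popular : {R : Fin n → Fin n → Set} (R? : ∀ x b → Dec (R x b)) (A S : Sub n) (c σ : ℕ) →
    (∀ {x} → x ∈ A → ∃[ b ] b ∈ S × R x b) → ∣ S ∣ ≤ σ → c * σ < ∣ A ∣ →
    (∀ b → b ∈ S → c < ∣ A ∩ ⟪ (λ x → R? x b) ⟫ ∣ → ⊥) → ⊥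
  popular R? A S c σ choice S≤ big none = <-irrefl refl (<-≤-trans big (begin
    ∣ A ∣                                      ≤⟨ sum-mono pointwise ⟩
    pairs (λ x b → Q? b x)                     ≡⟨ sym (pairs-swap Q?) ⟩
    pairs Q?                                   ≤⟨ sum-≤* _ (λ b → ⟦ mem? S b ⟧) c column ⟩
    c * ∣ S ∣                                  ≤⟨ *-monoʳ-≤ c S≤ ⟩
    c * σ                                      ∎))
    where
    open ≤-Reasoning
    Q? : ∀ b x → Dec (b ∈ S × (x ∈ A × _))
    Q? b x = mem? S b ×-dec (mem? A x ×-dec R? x b)
    pointwise : ∀ x → ⟦ mem? A x ⟧ ≤ sum (λ b → ⟦ Q? b x ⟧)
    pointwise x with mem? A x
    ... | no _ = z≤n
    ... | yes x∈A = let b , b∈S , r = choice x∈A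
                    in ∈⇒1≤∣∣ ⟪ (λ b → mem? S b ×-dec (yes x∈A ×-dec R? x b)) ⟫ (b∈S , x∈A , r)
    column : ∀ b → sum (λ x → ⟦ Q? b x ⟧) ≤ c * ⟦ mem? S b ⟧
    column b with mem? S b
    ... | no b∉S = ≤-trans (≤-reflexive (sum-0 {n} λ x → refl)) z≤n
    ... | yes b∈S = ≤-trans (∣∣-mono ⟪ (λ x → yes b∈S ×-dec (mem? A x ×-dec R? x b)) ⟫ (A ∩ ⟪ (λ x → R? x b) ⟫) proj₂)
        (≤-trans (≮⇒≥ (none b b∈S)) (≤-reflexive (sym (*-identityʳ c))))

  record Biclique (S A : Sub n) (k c : ℕ) : Set₁ where
    field
      {left right} : Sub n
      left⊆  : left ⊆ S
      right⊆ : right ⊆ A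
      left≥  : k ≤ ∣ left ∣
      right> : c < ∣ right ∣
      complete : Complete left right

  -- Some `a` in `S` is adjacent to more than a fraction `1 / σ` of the required number of vertices;
  -- these are kept, `a` is moved to the left side, and each of them has at least `k` neighbours
  -- left in `S -ˢ a`.
  biclique : ∀ k (S A : Sub n) (c σ : ℕ) → ∣ S ∣ ≤ σ → (∀ {x} → x ∈ A → k ≤ ∣ S ∩ N x ∣) → c * σ ^ k < ∣ A ∣ →
    ¬ ¬ Biclique S A k c
  biclique zero S A c σ S≤ _ big none = none record
    { left = ⟨ [] ⟩ ; right = A ; left⊆ = λ () ; right⊆ = id ; left≥ = z≤n
    ; right> = subst (_< ∣ A ∣) (*-identityʳ c) big ; complete = λ () }
  biclique (suc k) S A c σ S≤ many big none =
    popular (λ x b → mem? (N b) x) A S (c * σ ^ k) σ choice S≤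
      (subst (_< ∣ A ∣) (c*[s*p]≡c*p*s c σ (σ ^ k)) big)
      λ a a∈S big′ → biclique k (S -ˢ a) (A ∩ N a) c σ
        (≤-trans (∣∣-mono (S -ˢ a) S proj₁) S≤) (λ {x} (x∈A , ax) → fewer a a∈S x x∈A ax) big′
        λ K → let open Biclique K in none record
          { left = left ∪ ⁅ a ⁆ ; right = right
          ; left⊆ = λ { (inj₁ p) → proj₁ (left⊆ p) ; (inj₂ refl) → a∈S }
          ; right⊆ = proj₁ ∘ right⊆
          ; left≥ = ≤-trans (≤-reflexive (+-comm 1 k)) (≤-trans (+-mono-≤ left≥ (≤-reflexive (sym (∣⁅⁆∣ a))))
              (∣∣-pack (left ∪ ⁅ a ⁆) left ⁅ a ⁆ inj₁ inj₂ λ { p refl → proj₂ (left⊆ p) refl }))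
          ; right> = right>
          ; complete = λ { (inj₁ p) q → complete p q ; (inj₂ refl) q → proj₂ (right⊆ q) } }
    where
    choice : ∀ {x} → x ∈ A → ∃[ b ] b ∈ S × x ∈ N b
    choice {x} x∈A with inhabited (S ∩ N x) (≤-trans (s≤s z≤n) (many x∈A))
    ... | b , b∈S , xb = b , b∈S , N-sym xb
    fewer : ∀ a → a ∈ S → ∀ x → x ∈ A → x ∈ N a → k ≤ ∣ (S -ˢ a) ∩ N x ∣
    fewer a a∈S x x∈A ax = s≤s⁻¹ (≤-trans (many x∈A) (≤-trans (≤-reflexive (∣-∣ (S ∩ N x) {a} (a∈S , N-sym ax)))
      (s≤s (∣∣-mono (S ∩ N x -ˢ a) ((S -ˢ a) ∩ N x) λ ((p , q) , r) → (p , r) , q))))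

  between? : (X Y : Sub n) → ∀ u v → Dec (u ∈ X × v ∈ Y × v ∈ N u)
  between? X Y u v = mem? X u ×-dec mem? Y v ×-dec mem? (N u) v

  -- Ordered pairs are counted, so `d X X` is twice the number of edges inside `X`.
  d : Sub n → Sub n → ℕ
  d X Y = pairs (between? X Y)

  d-swap : ∀ X Y → d X Y ≡ d Y X
  d-swap X Y = trans (pairs-swap (between? X Y)) (≤-antisym
    (pairs-mono (flip (between? X Y)) (between? Y X) λ (p , q , r) → q , p , N-sym r)
    (pairs-mono (between? Y X) (flip (between? X Y)) λ (p , q , r) → q , p , N-sym r))

  d≤* : ∀ X Y → d X Y ≤ ∣ X ∣ * ∣ Y ∣
  d≤* X Y = ≤-trans (sum-≤* _ (λ u → ⟦ mem? X u ⟧) ∣ Y ∣ row) (≤-reflexive (*-comm ∣ Y ∣ ∣ X ∣))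
    where
    row : ∀ u → sum (λ v → ⟦ between? X Y u v ⟧) ≤ ∣ Y ∣ * ⟦ mem? X u ⟧
    row u with mem? X u
    ... | no _ = ≤-trans (≤-reflexive (sum-0 {n} λ v → refl)) z≤n
    ... | yes u∈X = ≤-trans (∣∣-mono ⟪ (λ v → yes u∈X ×-dec mem? Y v ×-dec mem? (N u) v) ⟫ Y (proj₁ ∘ proj₂))
                      (≤-reflexive (sym (*-identityʳ ∣ Y ∣)))

  d-coverˡ : ∀ X Y Z W → (∀ {x} → x ∈ X → x ∈ Y ⊎ x ∈ Z) → d X W ≤ d Y W + d Z W
  d-coverˡ X Y Z W h = pairs-cover (between? X W) (between? Y W) (between? Z W)
    λ (p , q , r) → Sum.map (_, q , r) (_, q , r) (h p)

  d-cover : ∀ X Y Z → (∀ {x} → x ∈ X → x ∈ Y ⊎ x ∈ Z) → d X X ≤ d Y Y + (d Y Z + d Y Z) + d Z Z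
  d-cover X Y Z h = begin
    d X X                                  ≤⟨ d-coverˡ X Y Z X h ⟩
    d Y X + d Z X                          ≡⟨ cong₂ _+_ (d-swap Y X) (d-swap Z X) ⟩
    d X Y + d X Z                          ≤⟨ +-mono-≤ (d-coverˡ X Y Z Y h) (d-coverˡ X Y Z Z h) ⟩
    d Y Y + d Z Y + (d Y Z + d Z Z)        ≡⟨ cong (λ w → d Y Y + w + (d Y Z + d Z Z)) (d-swap Z Y) ⟩
    d Y Y + d Y Z + (d Y Z + d Z Z)        ≡⟨ a+b+[b+c]≡a+[b+b]+c (d Y Y) (d Y Z) (d Z Z) ⟩
    d Y Y + (d Y Z + d Y Z) + d Z Z        ∎
    where
    open ≤-Reasoning

  listSum-tabulate : ∀ {k} (f : Fin k → ℕ) → ListAction.sum (tabulate f) ≡ sum f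
  listSum-tabulate {zero}  f = refl
  listSum-tabulate {suc k} f = cong (f zero +_) (listSum-tabulate (f ∘ suc))

  listSum-allFin : ∀ {k} (f : Fin k → ℕ) → ListAction.sum (map f (allFin k)) ≡ sum f
  listSum-allFin f = trans (cong ListAction.sum (map-tabulate id f)) (listSum-tabulate f)

  degreeSum≡d : degreeSum G ≡ d full full
  degreeSum≡d = trans (listSum-allFin (degree G)) (sum-cong-≗ λ u →
    trans (listSum-allFin (λ v → b2n (adj G u v))) (sum-cong-≗ λ v → case u v))
    where
    case : ∀ u v → b2n (adj G u v) ≡ ⟦ between? full full u v ⟧
    case u v with adj G u v
    ... | true = refl
    ... | false = refl

  -- Greedy: every vertex goes to the side opposite to at least half of its already placed neighbours.
  max-cut : ∀ U → ∃[ χ ] d U U ≤ 4 * Bipartite.e G χ U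
  max-cut U = go ∣ U ∣ U ≤-refl
    where
    go : ∀ k U → ∣ U ∣ ≤ k → ∃[ χ ] d U U ≤ 4 * Bipartite.e G χ U
    go k U h with Fin.any? (mem? U)
    ... | no none = (λ _ → true) , ≤-trans (≤-reflexive (sum-0 λ x → sum-0 λ y →
            ⟦⟧-no (between? U U x y) λ (p , _) → none (x , p))) z≤n
    go zero U h | yes (v , v∈U) = ⊥-elim (<-irrefl refl (≤-trans (∈⇒1≤∣∣ U v∈U) h))
    go (suc k) U h | yes (v , v∈U) with go k (U -ˢ v) (s≤s⁻¹ (≤-trans (≤-reflexive (sym (∣-∣ U v∈U))) h))
    ... | χ , ih = choose (≤-total (∣ side true ∣) (∣ side false ∣))
      where
      side : Bool → Sub n
      side b = U ∩ N v ∩ ⟪ (λ u → χ u Bool.≟ b) ⟫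
      nbhd≤ : ∣ U ∩ N v ∣ ≤ ∣ side true ∣ + ∣ side false ∣
      nbhd≤ = ∣∣-cover (U ∩ N v) (side true) (side false) split
        where
        split : ∀ {x} → x ∈ (U ∩ N v) → x ∈ side true ⊎ x ∈ side false
        split {x} p with χ x in eq
        ... | true = inj₁ (p , refl)
        ... | false = inj₂ (p , refl)
      dU≤ : d U U ≤ ∣ U ∩ N v ∣ + ∣ U ∩ N v ∣ + d (U -ˢ v) (U -ˢ v)
      dU≤ = begin
        d U U                                                                 ≤⟨ d-cover U ⁅ v ⁆ (U -ˢ v) split ⟩
        d ⁅ v ⁆ ⁅ v ⁆ + (d ⁅ v ⁆ (U -ˢ v) + d ⁅ v ⁆ (U -ˢ v)) + d (U -ˢ v) (U -ˢ v)
                                                                              ≤⟨ +-monoˡ-≤ _ (+-mono-≤ (≤-reflexive loop) (+-mono-≤ row row)) ⟩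
        ∣ U ∩ N v ∣ + ∣ U ∩ N v ∣ + d (U -ˢ v) (U -ˢ v)                       ∎
        where
        open ≤-Reasoning
        split : ∀ {x} → x ∈ U → x ∈ ⁅ v ⁆ ⊎ x ∈ (U -ˢ v)
        split {x} p with x Fin.≟ v
        ... | yes q = inj₁ q
        ... | no q = inj₂ (p , q)
        loop : d ⁅ v ⁆ ⁅ v ⁆ ≡ 0
        loop = sum-0 λ x → sum-0 λ y → ⟦⟧-no (between? ⁅ v ⁆ ⁅ v ⁆ x y) λ { (refl , refl , p) → N-irrefl p }
        row : d ⁅ v ⁆ (U -ˢ v) ≤ ∣ U ∩ N v ∣
        row = ≤-trans (pairs-mono (between? ⁅ v ⁆ (U -ˢ v)) (λ x y → x Fin.≟ v ×-dec mem? (U ∩ N v) y)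
                (λ { (refl , (q , _) , r) → refl , q , r })) (≤-reflexive (pairs-row v (U ∩ N v)))
      module Place (b : Bool) where
        χ′ : Fin n → Bool
        χ′ u = if does (u Fin.≟ v) then b else χ u
        at : χ′ v ≡ b
        at with v Fin.≟ v
        ... | yes _ = refl
        ... | no q = ⊥-elim (q refl)
        off : ∀ {u} → u ≢ v → χ′ u ≡ χ u
        off {u} ne with u Fin.≟ v
        ... | yes q = ⊥-elim (ne q)
        ... | no _ = refl
        module B = Bipartite G χ
        module B′ = Bipartite G χ′
        e≡ : B.e (U -ˢ v) ≤ B′.e (U -ˢ v)
        e≡ = pairs-mono (B.arcs-in? (U -ˢ v)) (B′.arcs-in? (U -ˢ v))
          λ (p , q , r , s , t) → p , q , trans (off (proj₂ p)) r , trans (off (proj₂ q)) s , t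
        placed : ∣ U ∩ N v ∣ ≤ 2 * B′.deg U v → d U U ≤ 4 * B′.e U
        placed h = ≤-trans dU≤ (≤-trans (cut-count _ _ _ _ _ h ih e≡) (≤-reflexive (cong (4 *_) (sym (B′.e-remove U v∈U)))))
      choose : ∣ side true ∣ ≤ ∣ side false ∣ ⊎ ∣ side false ∣ ≤ ∣ side true ∣ → ∃[ χ ] d U U ≤ 4 * Bipartite.e G χ U
      choose (inj₁ le) = χ′ , placed (≤-trans nbhd≤ (≤-trans (+-monoˡ-≤ _ le) (≤-trans (≤-reflexive (cong (∣ side false ∣ +_) (sym (+-identityʳ _))))
          (*-monoʳ-≤ 2 (∣∣-mono (side false) (U ∩ B′.nbrs v)
            λ ((p , r) , s) → p , inj₁ (at , trans (off (N-≢ r)) s , r))))))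
        where open Place true
      choose (inj₂ le) = χ′ , placed (≤-trans nbhd≤ (≤-trans (+-monoʳ-≤ _ le) (≤-trans (≤-reflexive (cong (∣ side true ∣ +_) (sym (+-identityʳ _))))
          (*-monoʳ-≤ 2 (∣∣-mono (side true) (U ∩ B′.nbrs v)
            λ ((p , r) , s) → p , inj₂ (trans (off (N-≢ r)) s , at , N-sym r))))))
        where open Place false

-- The lower-order terms of the edge count outside a set of size σ.
overhead : ℕ → ℕ
overhead σ = σ * σ + 2 * (σ * (8 * σ ^ 4)) + 2 * (σ * (8 * σ ^ 5)) + 16 * (σ ^ 2) * σ * σ * (16 * (σ ^ 2) * σ * σ)

-- Edge count in the presence of a small exceptional set

module Dense {n : ℕ} (G : Graph n) (noWin : ¬ HasConsecutiveEvenCycles G) (q σ : ℕ) (S : Sub n) (S≤ : ∣ S ∣ ≤ σ)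
  (bip : ∀ χ U → (∀ {v} → v ∈ U → v ∉ S) → 16 * q * Bipartite.e G χ U ≤ (32 * q + 1) * ∣ U ∣)
  (big : 8 * q * overhead σ < n) (avg : (14 * q + 1) * n ≤ q * d G full full) where

  H : Sub n
  H = full ∖ S

  T : Fin n → ℕ
  T v = ∣ S ∩ N G v ∣

  Many : ℕ → Sub n
  Many k = ⟪ (λ v → mem? H v ×-dec k ≤? T v) ⟫

  T≤σ : ∀ v → T v ≤ σ
  T≤σ v = ≤-trans (∣∣-mono (S ∩ N G v) S proj₁) S≤

  to-S : (f : Fin n → ℕ) → (∀ v → v ∈ H → T v ≤ f v) → d G H S ≤ sum f
  to-S f h = sum-mono row
    where
    row : ∀ v → sum (λ u → ⟦ between? G H S v u ⟧) ≤ f v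
    row v with mem? H v
    ... | no v∉H = ≤-trans (≤-reflexive (sum-0 λ u → ⟦⟧-no (between? G H S v u) (v∉H ∘ proj₁))) z≤n
    ... | yes v∈H = ≤-trans (∣∣-mono ⟪ between? G H S v ⟫ (S ∩ N G v) proj₂) (h v v∈H)

  edges≤ : d G full full ≤ σ * σ + (d G H S + d G H S) + d G H H
  edges≤ = ≤-trans (d-cover G full S H split) (+-monoˡ-≤ _ (+-mono-≤ (≤-trans (d≤* G S S) (*-mono-≤ S≤ S≤))
      (≤-reflexive (cong₂ _+_ (d-swap G S H) (d-swap G S H)))))
    where
    split : ∀ {x} → x ∈ full → x ∈ S ⊎ x ∈ H
    split {x} _ with mem? S x
    ... | yes p = inj₁ p
    ... | no p = inj₂ (_ , p)

  -- Otherwise there is a K(5,9) with its five vertices in `S`; three of them carry a hexagon and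
  -- the other two a disjoint square.
  few-5 : ∣ Many 5 ∣ ≤ 8 * σ ^ 5
  few-5 with ∣ Many 5 ∣ ≤? 8 * σ ^ 5
  ... | yes p = p
  ... | no p = ⊥-elim (biclique G 5 S (Many 5) 8 σ S≤ proj₂ (≰⇒> p) λ K → use K)
    where
    use : Biclique G S (Many 5) 5 8 → ⊥
    use K with pick left [] (≤-trans (s≤s z≤n) left≥) where open Biclique K
    ... | a , a∈ , _ with pick (Biclique.left K) [ a ] (≤-trans (m≤m+n 2 3) (Biclique.left≥ K))
    ...   | b , b∈ , b∉ with pick (Biclique.left K) (b ∷ a ∷ []) (≤-trans (m≤m+n 3 2) (Biclique.left≥ K))
    ...     | c , c∈ , c∉ with pick (Biclique.right K) [] (≤-trans (s≤s z≤n) (Biclique.right> K))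
    ...       | x , x∈ , _ with pick (Biclique.right K) [ x ] (≤-trans (m≤m+n 2 7) (Biclique.right> K))
    ...         | y , y∈ , y∉ with pick (Biclique.right K) (y ∷ x ∷ []) (≤-trans (m≤m+n 3 6) (Biclique.right> K))
    ...           | z , z∈ , z∉ = noWin (hexagon-square G S (a ∷ b ∷ c ∷ [])
        (hexagon G S (left⊆ a∈) (left⊆ b∈) (left⊆ c∈) (out x∈) (out y∈) (out z∈)
          (λ { refl → b∉ (here refl) }) (λ { refl → c∉ (there (here refl)) }) (λ { refl → c∉ (here refl) })
          (λ { refl → y∉ (here refl) }) (λ { refl → z∉ (there (here refl)) }) (λ { refl → z∉ (here refl) })
          (complete a∈ x∈) (complete b∈ x∈) (complete b∈ y∈) (complete c∈ y∈) (complete c∈ z∈) (complete a∈ z∈))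
        ≤-refl
        (λ { (here refl) _ → here refl ; (there (here refl)) p → ⊥-elim (out x∈ p)
           ; (there (there (here refl))) _ → there (here refl) ; (there (there (there (here refl)))) p → ⊥-elim (out y∈ p)
           ; (there (there (there (there (here refl))))) _ → there (there (here refl))
           ; (there (there (there (there (there (here refl)))))) p → ⊥-elim (out z∈ p) })
        left right left⊆ out complete left≥ right>)
      where
      open Biclique K
      out : ∀ {v} → v ∈ right → v ∉ S
      out v∈ = proj₂ (proj₁ (right⊆ v∈))

  -- Almost every vertex of `H` then sends at most three edges to `S`, and a cut with at least half
  -- of the edges of `H` bounds their number by `(4 + 1 / (8 * q)) * ∣ H ∣`.
  few-4⇒⊥ : ∣ Many 4 ∣ ≤ 8 * σ ^ 4 → ⊥
  few-4⇒⊥ few with max-cut G H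
  ... | χ , cut = few-rich-count n q (∣ H ∣) (d G full full) (σ * σ) (σ * (8 * σ ^ 4)) (σ * (8 * σ ^ 5))
      (16 * (σ ^ 2) * σ * σ * (16 * (σ ^ 2) * σ * σ)) (d G H S) (d G H H) (Bipartite.e G χ H)
      avg edges≤ T-sum cut (bip χ H proj₂) (∣∣≤n H) big
    where
    f : Fin n → ℕ
    f v = 3 * ⟦ mem? H v ⟧ + σ * ⟦ mem? (Many 4) v ⟧
    T≤f : ∀ v → v ∈ H → T v ≤ f v
    T≤f v v∈H with T v ≤? 3
    ... | yes p = ≤-trans p (≤-trans (≤-reflexive (cong (3 *_) (sym (⟦⟧-yes (mem? H v) v∈H)))) (m≤m+n _ _))
    ... | no p = ≤-trans (T≤σ v) (≤-trans (≤-reflexive (trans (sym (*-identityʳ σ))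
            (cong (σ *_) (sym (⟦⟧-yes (mem? (Many 4) v) (v∈H , ≰⇒> p)))))) (m≤n+m _ (3 * ⟦ mem? H v ⟧)))
    T-sum : d G H S ≤ 3 * ∣ H ∣ + σ * (8 * σ ^ 4)
    T-sum = begin
      d G H S                         ≤⟨ to-S f T≤f ⟩
      sum f                           ≡⟨ ∑-distrib-+ (λ v → 3 * ⟦ mem? H v ⟧) (λ v → σ * ⟦ mem? (Many 4) v ⟧) ⟩
      sum (λ v → 3 * ⟦ mem? H v ⟧) + sum (λ v → σ * ⟦ mem? (Many 4) v ⟧)
                                      ≡⟨ cong₂ _+_ (sym (*-distribˡ-sum 3 λ v → ⟦ mem? H v ⟧)) (sym (*-distribˡ-sum σ λ v → ⟦ mem? (Many 4) v ⟧)) ⟩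
      3 * ∣ H ∣ + σ * ∣ Many 4 ∣      ≤⟨ +-monoʳ-≤ (3 * ∣ H ∣) (*-monoʳ-≤ σ few) ⟩
      3 * ∣ H ∣ + σ * (8 * σ ^ 4)     ∎
      where open ≤-Reasoning

  module _ (K : Biclique G S (Many 4) 4 8) where
    open Biclique K

    out : ∀ {v} → v ∈ right → v ∉ S
    out v∈ = proj₂ (proj₁ (right⊆ v∈))

    W : Sub n
    W = Many 2

    W∉S : ∀ {v} → v ∈ W → v ∉ S
    W∉S v∈W = proj₂ (proj₁ v∈W)

    -- Many neighbours of `y` in `W` would include three joined to the same `b` and `c` in `S`. They
    -- form a hexagon with `y`, `b` and `c`, which uses only two vertices of `S` and leaves a square
    -- of `K`.
    W-nbrs : ∀ y → y ∈ W → ∣ W ∩ N G y ∣ ≤ 8 * σ ^ 2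
    W-nbrs y y∈W with ∣ W ∩ N G y ∣ ≤? 8 * σ ^ 2
    ... | yes p = p
    ... | no p = ⊥-elim (biclique G 2 S (W ∩ N G y) 8 σ S≤ (λ x∈ → proj₂ (proj₁ x∈)) (≰⇒> p) use)
      where
      use : Biclique G S (W ∩ N G y) 2 8 → ⊥
      use K₂ with pick (Biclique.left K₂) [] (≤-trans (s≤s z≤n) (Biclique.left≥ K₂))
      ... | b , b∈ , _ with pick (Biclique.left K₂) [ b ] (Biclique.left≥ K₂)
      ...   | c , c∈ , c∉ with pick (Biclique.right K₂) [] (≤-trans (s≤s z≤n) (Biclique.right> K₂))
      ...     | x₁ , x₁∈ , _ with pick (Biclique.right K₂) [ x₁ ] (≤-trans (m≤m+n 2 7) (Biclique.right> K₂))
      ...       | x₂ , x₂∈ , x₂∉ with pick (Biclique.right K₂) (x₂ ∷ x₁ ∷ []) (≤-trans (m≤m+n 3 6) (Biclique.right> K₂))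
      ...         | x₃ , x₃∈ , x₃∉ = noWin (hexagon-square G S (b ∷ c ∷ [])
          (hexagon G (S ∪ ⁅ y ⁆) (inj₂ refl) (inj₁ (K₂.left⊆ b∈)) (inj₁ (K₂.left⊆ c∈)) (out₂ x₁∈) (out₂ x₂∈) (out₂ x₃∈)
            (λ { refl → W∉S y∈W (K₂.left⊆ b∈) }) (λ { refl → W∉S y∈W (K₂.left⊆ c∈) }) (λ { refl → c∉ (here refl) })
            (λ { refl → x₂∉ (here refl) }) (λ { refl → x₃∉ (there (here refl)) }) (λ { refl → x₃∉ (here refl) })
            (proj₂ (K₂.right⊆ x₁∈)) (K₂.complete b∈ x₁∈) (K₂.complete b∈ x₂∈) (K₂.complete c∈ x₂∈) (K₂.complete c∈ x₃∈)
            (proj₂ (K₂.right⊆ x₃∈)))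
          ≤-refl
          (λ { (here refl) p → ⊥-elim (W∉S y∈W p) ; (there (here refl)) p → ⊥-elim (out₂ x₁∈ (inj₁ p))
             ; (there (there (here refl))) _ → here refl ; (there (there (there (here refl)))) p → ⊥-elim (out₂ x₂∈ (inj₁ p))
             ; (there (there (there (there (here refl))))) _ → there (here refl)
             ; (there (there (there (there (there (here refl)))))) p → ⊥-elim (out₂ x₃∈ (inj₁ p)) })
          left right left⊆ out complete left≥ right>)
        where
        module K₂ = Biclique K₂
        out₂ : ∀ {v} → v ∈ K₂.right → v ∉ (S ∪ ⁅ y ⁆)
        out₂ v∈ (inj₁ p) = W∉S (proj₁ (K₂.right⊆ v∈)) p
        out₂ v∈ (inj₂ refl) = N-irrefl G (proj₂ (K₂.right⊆ v∈))

    W′ : Sub n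
    W′ = ⟪ (λ x → mem? W x ×-dec Fin.any? λ y → mem? W y ×-dec mem? (N G x) y) ⟫

    -- Each `x` in `W′` lies on a path `a`, `x`, `y`, `b` with `y` in `W` and distinct ends `a`, `b`
    -- in `S`. If `W′` is large, many `x` share both ends, and two such paths with disjoint
    -- interiors make a hexagon with only two vertices in `S`.
    few-W′ : ∣ W′ ∣ ≤ 16 * (σ ^ 2) * σ * σ
    few-W′ with ∣ W′ ∣ ≤? 16 * (σ ^ 2) * σ * σ
    ... | yes p = p
    ... | no p = ⊥-elim (popular G (λ x a → mem? (N G a) x) W′ S (16 * (σ ^ 2) * σ) σ choice S≤ (≰⇒> p)
        λ a a∈S big₁ → popular G (λ x b → Fin.any? λ y → mem? W y ×-dec mem? (N G x) y ×-dec mem? (N G b) y)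
          (W′ ∩ N G a) (S -ˢ a) (16 * (σ ^ 2)) σ (choice₂ a) (≤-trans (∣∣-mono (S -ˢ a) S proj₁) S≤) big₁
        λ b (b∈S , b≢a) big₂ → use a b a∈S b∈S b≢a big₂)
      where
      choice : ∀ {x} → x ∈ W′ → ∃[ b ] b ∈ S × x ∈ N G b
      choice {x} ((_ , h) , _) with inhabited (S ∩ N G x) (≤-trans (s≤s z≤n) h)
      ... | b , b∈S , xb = b , b∈S , N-sym G xb
      choice₂ : ∀ a {x} → x ∈ (W′ ∩ N G a) → ∃[ b ] b ∈ (S -ˢ a) × (∃[ y ] y ∈ W × y ∈ N G x × y ∈ N G b)
      choice₂ a {x} ((_ , y , y∈W , xy) , _) with pick (S ∩ N G y) [ a ] (proj₂ y∈W)
      ... | b , (b∈S , yb) , b≢a = b , (b∈S , λ { refl → b≢a (here refl) }) , y , y∈W , xy , N-sym G yb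
      use : ∀ a b → a ∈ S → b ∈ S → b ≢ a →
        16 * σ ^ 2 < ∣ W′ ∩ N G a ∩ ⟪ (λ x → Fin.any? λ y → mem? W y ×-dec mem? (N G x) y ×-dec mem? (N G b) y) ⟫ ∣ → ⊥
      use a b a∈S b∈S b≢a big₂ with inhabited A₂ (≤-trans (s≤s z≤n) big₂)
        where A₂ = W′ ∩ N G a ∩ ⟪ (λ x → Fin.any? λ y → mem? W y ×-dec mem? (N G x) y ×-dec mem? (N G b) y) ⟫
      ... | x , ((x∈W , _) , ax) , y , y∈W , xy , by with Fin.any? (mem? (A₂ ∖ ((W ∩ N G x) ∪ (W ∩ N G y))))
        where A₂ = W′ ∩ N G a ∩ ⟪ (λ x → Fin.any? λ y → mem? W y ×-dec mem? (N G x) y ×-dec mem? (N G b) y) ⟫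
      -- The second vertex `x′` is sought off the neighbourhoods of `x` and `y` in `W`, which
      -- together have at most `16 * σ ^ 2` vertices. Since `x` and `y` are adjacent, this also
      -- keeps `x′` and `y′` distinct from both.
      ...   | no none = <-irrefl refl (<-≤-trans big₂ (begin
          ∣ A₂ ∣                                     ≤⟨ ∣∣-cover A₂ (W ∩ N G x) (W ∩ N G y) inside ⟩
          ∣ W ∩ N G x ∣ + ∣ W ∩ N G y ∣              ≤⟨ +-mono-≤ (W-nbrs x x∈W) (W-nbrs y y∈W) ⟩
          8 * σ ^ 2 + 8 * σ ^ 2                      ≡⟨ sym (*-distribʳ-+ (σ ^ 2) 8 8) ⟩
          16 * σ ^ 2                                 ∎))
        where
        open ≤-Reasoning
        A₂ = W′ ∩ N G a ∩ ⟪ (λ x → Fin.any? λ y → mem? W y ×-dec mem? (N G x) y ×-dec mem? (N G b) y) ⟫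
        inside : ∀ {v} → v ∈ A₂ → v ∈ (W ∩ N G x) ⊎ v ∈ (W ∩ N G y)
        inside {v} v∈ with mem? ((W ∩ N G x) ∪ (W ∩ N G y)) v
        ... | yes p = p
        ... | no p = ⊥-elim (none (v , v∈ , p))
      -- The hexagon is `a`, `x`, `y`, `b`, `y′`, `x′`, with `X₀` as one colour class; of its
      -- vertices only `a` and `b` are in `S`.
      ...   | yes (x′ , (((x′∈W , _) , ax′) , y′ , y′∈W , x′y′ , by′) , x′∉) = noWin (hexagon-square G S (a ∷ b ∷ [])
          (hexagon G X₀ (here refl) (there (here refl)) (there (there (here refl)))
            (λ { (here refl) → W∉S x∈W a∈S ; (there (here refl)) → N-irrefl G xy
               ; (there (there (here refl))) → x′∉ (inj₁ (x′∈W , N-sym G x′y′)) })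
            (λ { (here refl) → b≢a refl ; (there (here refl)) → W∉S y∈W b∈S ; (there (there (here refl))) → W∉S y′∈W b∈S })
            (λ { (here refl) → W∉S x′∈W a∈S ; (there (here refl)) → x′∉ (inj₁ (x′∈W , xy))
               ; (there (there (here refl))) → N-irrefl G x′y′ })
            (λ { refl → W∉S y∈W a∈S }) (λ { refl → W∉S y′∈W a∈S }) (λ { refl → x′∉ (inj₂ (x′∈W , N-sym G x′y′)) })
            (λ { refl → W∉S x∈W b∈S }) (λ { refl → x′∉ (inj₂ (x′∈W , N-sym G xy)) }) (λ { refl → W∉S x′∈W b∈S })
            ax (N-sym G xy) (N-sym G by) (N-sym G by′) (N-sym G x′y′) ax′)
          ≤-refl
          (λ { (here refl) _ → here refl ; (there (here refl)) p → ⊥-elim (W∉S x∈W p)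
             ; (there (there (here refl))) p → ⊥-elim (W∉S y∈W p) ; (there (there (there (here refl)))) _ → there (here refl)
             ; (there (there (there (there (here refl))))) p → ⊥-elim (W∉S y′∈W p)
             ; (there (there (there (there (there (here refl)))))) p → ⊥-elim (W∉S x′∈W p) })
          left right left⊆ out complete left≥ right>)
        where X₀ = ⟨ a ∷ y ∷ y′ ∷ [] ⟩

    R : Sub n
    R = H ∖ W

    inside-W : d G W W ≤ 16 * (σ ^ 2) * σ * σ * (16 * (σ ^ 2) * σ * σ)
    inside-W = ≤-trans (pairs-mono (between? G W W) (between? G W′ W′)
        λ {u} {v} (p , r , s) → (p , v , r , s) , (r , u , p , N-sym G s) , s)
      (≤-trans (d≤* G W′ W′) (*-mono-≤ few-W′ few-W′))

    -- Up to lower-order terms, vertices of `W` send at most 4 edges to `S` and those of `R` at most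
    -- 1. The edges between `W` and `R` form a bipartite graph, those inside `R` are bounded through
    -- a cut, and those inside `W` are negligible.
    contra : ⊥
    contra with max-cut G R
    ... | χ , cut = many-rich-count n q (∣ W ∣) (∣ R ∣) (d G full full) (σ * σ) (σ * (8 * σ ^ 4)) (σ * (8 * σ ^ 5))
        (16 * (σ ^ 2) * σ * σ * (16 * (σ ^ 2) * σ * σ)) (d G H S) (d G H H) (d G W W) (d G W R) (d G R R)
        (Bipartite.e G χW H) (Bipartite.e G χ R)
        avg edges≤ T-sum (d-cover G H W R split) inside-W cross
        (≤-trans (bip χW H proj₂) (*-monoʳ-≤ (32 * q + 1) (≤-reflexive H≡))) cut (bip χ R (proj₂ ∘ proj₁))
        (≤-trans (≤-reflexive (sym H≡)) (∣∣≤n H)) big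
      where
      χW : Fin n → Bool
      χW v = does (mem? W v)
      H≡ : ∣ H ∣ ≡ ∣ W ∣ + ∣ R ∣
      H≡ = ∣∖∣ H W proj₁
      split : ∀ {x} → x ∈ H → x ∈ W ⊎ x ∈ R
      split {x} p with mem? W x
      ... | yes r = inj₁ r
      ... | no r = inj₂ (p , r)
      cross : d G W R ≤ Bipartite.e G χW H
      cross = pairs-mono (between? G W R) (Bipartite.arcs-in? G χW H)
        λ (p , r , s) → proj₁ p , proj₁ r , in⇒χ G W p , out⇒χ G W (proj₂ r) , s
      f g : Fin n → ℕ
      g v = 4 * ⟦ mem? W v ⟧ + ⟦ mem? R v ⟧
      f v = g v + σ * ⟦ mem? (Many 5) v ⟧
      T≤f : ∀ v → v ∈ H → T v ≤ f v
      T≤f v v∈H with T v ≤? 1 | T v ≤? 4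
      ... | _ | no p = ≤-trans (T≤σ v) (≤-trans (≤-reflexive (trans (sym (*-identityʳ σ))
              (cong (σ *_) (sym (⟦⟧-yes (mem? (Many 5) v) (v∈H , ≰⇒> p)))))) (m≤n+m _ (g v)))
      ... | yes p | yes _ = ≤-trans p (≤-trans (≤-reflexive (sym (⟦⟧-yes (mem? R v) (v∈H , λ (_ , r) → <-irrefl refl (≤-trans r p)))))
              (≤-trans (m≤n+m _ (4 * ⟦ mem? W v ⟧)) (m≤m+n (g v) _)))
      ... | no p | yes r = ≤-trans r (≤-trans (≤-reflexive (cong (4 *_) (sym (⟦⟧-yes (mem? W v) (v∈H , ≰⇒> p)))))
              (≤-trans (m≤m+n (4 * ⟦ mem? W v ⟧) _) (m≤m+n (g v) _)))
      T-sum : d G H S ≤ 4 * ∣ W ∣ + ∣ R ∣ + σ * (8 * σ ^ 5)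
      T-sum = begin
        d G H S                                        ≤⟨ to-S f T≤f ⟩
        sum f                                          ≡⟨ ∑-distrib-+ g (λ v → σ * ⟦ mem? (Many 5) v ⟧) ⟩
        sum g + sum (λ v → σ * ⟦ mem? (Many 5) v ⟧)    ≡⟨ cong₂ _+_
            (trans (∑-distrib-+ (λ v → 4 * ⟦ mem? W v ⟧) (λ v → ⟦ mem? R v ⟧))
                   (cong (_+ ∣ R ∣) (sym (*-distribˡ-sum 4 λ v → ⟦ mem? W v ⟧))))
            (sym (*-distribˡ-sum σ λ v → ⟦ mem? (Many 5) v ⟧)) ⟩
        4 * ∣ W ∣ + ∣ R ∣ + σ * ∣ Many 5 ∣             ≤⟨ +-monoʳ-≤ (4 * ∣ W ∣ + ∣ R ∣) (*-monoʳ-≤ σ few-5) ⟩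
        4 * ∣ W ∣ + ∣ R ∣ + σ * (8 * σ ^ 5)            ∎
        where open ≤-Reasoning

  impossible : ⊥
  impossible with ∣ Many 4 ∣ ≤? 8 * σ ^ 4
  ... | yes p = few-4⇒⊥ p
  ... | no p = biclique G 4 S (Many 4) 8 σ S≤ proj₂ (≰⇒> p) contra

-- Polynomial bounds

PolyBounded : (ℕ → ℕ) → Set
PolyBounded f = ∃₂ λ C k → ∀ l → f l ≤ C * suc l ^ k

module _ where
  private variable f g : ℕ → ℕ

  poly-const : ∀ c → PolyBounded (λ _ → c)
  poly-const c = c , 0 , λ l → ≤-reflexive (sym (*-identityʳ c))

  poly-suc : PolyBounded suc
  poly-suc = 1 , 1 , λ l → ≤-reflexive (sym (trans (+-identityʳ _) (*-identityʳ (suc l))))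

  infixl 6 _⊞_
  infixl 7 _⊠_

  _⊞_ : PolyBounded f → PolyBounded g → PolyBounded (λ l → f l + g l)
  (C , k , h) ⊞ (C′ , k′ , h′) = C + C′ , k + k′ , λ l → ≤-trans
    (+-mono-≤ (≤-trans (h l) (*-monoʳ-≤ C (^-monoʳ-≤ (suc l) (m≤m+n k k′))))
              (≤-trans (h′ l) (*-monoʳ-≤ C′ (^-monoʳ-≤ (suc l) (m≤n+m k′ k)))))
    (≤-reflexive (sym (*-distribʳ-+ (suc l ^ (k + k′)) C C′)))

  _⊠_ : PolyBounded f → PolyBounded g → PolyBounded (λ l → f l * g l)
  (C , k , h) ⊠ (C′ , k′ , h′) = C * C′ , k + k′ , λ l → ≤-trans (*-mono-≤ (h l) (h′ l)) (≤-reflexive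
    (trans (eq C C′ (suc l ^ k) (suc l ^ k′)) (cong (C * C′ *_) (sym (^-distribˡ-+-* (suc l) k k′)))))
    where
    eq : ∀ a b c d → a * c * (b * d) ≡ a * b * (c * d)
    eq = solve-∀

  poly-^ : ∀ m → PolyBounded f → PolyBounded (λ l → f l ^ m)
  poly-^ zero    p = poly-const 1
  poly-^ (suc m) p = p ⊠ poly-^ m p

n<2^n : ∀ n → n < 2 ^ n
n<2^n zero = s≤s z≤n
n<2^n (suc n) = ≤-trans (+-mono-≤ (≤-trans (s≤s z≤n) (n<2^n n)) (n<2^n n)) (≤-reflexive (cong (2 ^ n +_) (sym (+-identityʳ _))))

-- Induction on the degree: at `j`, half of `l`, one factor `suc j` is absorbed by `2 ^ j`, and the
-- induction hypothesis bounds the remaining power by another `2 ^ j`.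
poly<exp : ∀ k C → ∃[ l₀ ] (∀ l → l₀ ≤ l → C * suc l ^ k < 2 ^ l)
poly<exp zero C = C , λ l h → subst (_< 2 ^ l) (sym (*-identityʳ C)) (≤-<-trans h (n<2^n l))
poly<exp (suc k) C with poly<exp k (C * 2 ^ suc k)
... | j₀ , ih = j₀ + j₀ , λ l h →
  let j = ⌊ l /2⌋
      2j≤l : j + j ≤ l
      2j≤l = ≤-trans (+-monoʳ-≤ j (⌊n/2⌋≤⌈n/2⌉ l)) (≤-reflexive (⌊n/2⌋+⌈n/2⌉≡n l))
      j₀≤j : j₀ ≤ j
      j₀≤j = ≤-trans (≤-reflexive (n≡⌊n+n/2⌋ j₀)) (⌊n/2⌋-mono h)
      l<2j : suc l ≤ 2 * suc j
      l<2j = half l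
  in begin-strict
    C * suc l ^ suc k                              ≤⟨ *-monoʳ-≤ C (^-monoˡ-≤ (suc k) l<2j) ⟩
    C * (2 * suc j) ^ suc k                        ≡⟨ cong (C *_) (^-distribʳ-* (suc k) 2 (suc j)) ⟩
    C * (2 ^ suc k * suc j ^ suc k)                ≡⟨ eq C (2 ^ suc k) (suc j) (suc j ^ k) ⟩
    C * 2 ^ suc k * suc j ^ k * suc j              <⟨ *-monoˡ-< (suc j) (ih j j₀≤j) ⟩
    2 ^ j * suc j                                  ≤⟨ *-monoʳ-≤ (2 ^ j) (n<2^n j) ⟩
    2 ^ j * 2 ^ j                                  ≡⟨ sym (^-distribˡ-+-* 2 j j) ⟩
    2 ^ (j + j)                                    ≤⟨ ^-monoʳ-≤ 2 2j≤l ⟩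
    2 ^ l                                          ∎
  where
  open ≤-Reasoning
  eq : ∀ C a s p → C * (a * (s * p)) ≡ C * a * p * s
  eq = solve-∀
  half : ∀ l → suc l ≤ 2 * suc ⌊ l /2⌋
  half zero = s≤s z≤n
  half (suc zero) = ≤-refl
  half (suc (suc l)) = ≤-trans (s≤s (s≤s (half l))) (≤-reflexive (sym (*-suc 2 (suc ⌊ l /2⌋))))
  ^-distribʳ-* : ∀ m a b → (a * b) ^ m ≡ a ^ m * b ^ m
  ^-distribʳ-* zero a b = refl
  ^-distribʳ-* (suc m) a b = trans (cong (a * b *_) (^-distribʳ-* m a b)) (eq′ a b (a ^ m) (b ^ m))
    where
    eq′ : ∀ a b c d → a * b * (c * d) ≡ a * c * (b * d)
    eq′ = solve-∀

binary-size : ∀ n → 1 ≤ n → ∃[ l ] 2 ^ l ≤ n × n < 2 ^ suc l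
binary-size (suc zero) _ = 0 , s≤s z≤n , s≤s (s≤s z≤n)
binary-size (suc n@(suc _)) _ with binary-size n (s≤s z≤n)
... | l , lo , hi with suc n <? 2 ^ suc l
...   | yes p = l , m≤n⇒m≤1+n lo , p
...   | no ≮ = suc l , ≮⇒≥ ≮ , ≤-trans (s≤s hi) (^-monoʳ-< 2 ≤-refl (n<1+n (suc l)))

level≤ : ∀ {n t} → n < 2 ^ t → level n ≤ 3 * t
level≤ {n} {t} h = ≤-trans (⌊log₂⌋-mono-≤ (≤-trans (*-mono-≤ (*-mono-≤ (<⇒≤ h) (<⇒≤ h)) (<⇒≤ h)) (≤-reflexive cube)))
    (≤-reflexive (⌊log₂[2^n]⌋≡n (3 * t)))
  where
  cube : 2 ^ t * 2 ^ t * 2 ^ t ≡ 2 ^ (3 * t)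
  cube = sym (trans (cong (2 ^_) (cong (t +_) (cong (t +_) (+-identityʳ t))))
    (trans (^-distribˡ-+-* 2 t (t + t)) (trans (cong (2 ^ t *_) (^-distribˡ-+-* 2 t t)) (sym (*-assoc (2 ^ t) _ _)))))

-- Decidability of the conclusion

search : ∀ {n} k {P : (Fin k → Fin n) → Set} → (∀ f → Dec (P f)) → (∀ {f g} → (∀ i → f i ≡ g i) → P f → P g) → Dec (∃ P)
search {n} zero {P} P? ext = map′ (none ,_) (λ (f , p) → ext {f} {none} (λ ()) p) (P? none)
  where
  none : Fin 0 → Fin n
  none ()
search {n} (suc k) {P} P? ext = map′
  (λ (x , f , p) → cons′ x f , p)
  -- A function agrees pointwise with the one rebuilt from its first value and its remaining values;
  -- `ext` transfers `P` along this agreement.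
  (λ (f , p) → f zero , f ∘ suc , ext (λ { zero → refl ; (suc i) → refl }) p)
  (Fin.any? λ x → search k (λ f → P? (cons′ x f)) λ eq → ext λ { zero → refl ; (suc i) → eq i })
  where
  cons′ : Fin n → (Fin k → Fin n) → Fin (suc k) → Fin n
  cons′ x f zero = x
  cons′ x f (suc i) = f i

module _ {n : ℕ} (G : Graph n) where

  isCycle? : ∀ k c → Dec (IsCycle G k c)
  isCycle? k c = 3 ≤? k ×-dec injective? ×-dec
    Fin.all? λ i → Fin.all? λ j →
      ((suc (toℕ i) ≟ toℕ j) ⊎-dec (suc (toℕ i) ≟ k ×-dec toℕ j ≟ 0)) →-dec (adj G (c i) (c j) Bool.≟ true)
    where
    injective? = map′ (λ h {i} {j} → h i j) (λ h i j → h)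
      (Fin.all? λ i → Fin.all? λ j → (c i Fin.≟ c j) →-dec (i Fin.≟ j))

  isCycle-ext : ∀ {k c c′} → (∀ i → c i ≡ c′ i) → IsCycle G k c → IsCycle G k c′
  isCycle-ext eq (h , inj , adjacent) = h , (λ e → inj (trans (eq _) (trans e (sym (eq _))))) ,
    λ i j s → subst₂ (λ u v → adj G u v ≡ true) (eq i) (eq j) (adjacent i j s)

  -- The search over `r` is finite because the longer cycle has `2 * r + 2` distinct vertices.
  hasConsecutiveEvenCycles? : Dec (HasConsecutiveEvenCycles G)
  hasConsecutiveEvenCycles? = map′
    (λ (r , _ , w) → r , w)
    (λ { (r , w@(_ , _ , d , _ , (_ , inj , _) , _)) → r , bounded r (Fin.injective⇒≤ inj) , w })
    (anyUpTo? (λ r → 2 ≤? r ×-dec search (2 * r)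
      (λ c → search (2 * r + 2)
        (λ d → isCycle? _ c ×-dec isCycle? _ d ×-dec Fin.all? λ i → Fin.all? λ j → ¬? (c i Fin.≟ d j))
        λ eq (p , q , disj) → p , isCycle-ext eq q , λ i j e → disj i j (trans e (sym (eq j))))
      λ eq (d , p , q , disj) → d , isCycle-ext eq p , q , λ i j e → disj i j (trans (eq i) e))
      (suc n))
    where
    bounded : ∀ r → 2 * r + 2 ≤ n → r < suc n
    bounded r h = s≤s (≤-trans (m≤n*m r 2) (≤-trans (m≤m+n (2 * r) 2) h))

  -- Greedy packing of even pairs

  module Packing (noWin : ¬ HasConsecutiveEvenCycles G) (L : ℕ)
    (next : ∀ S → ∣ S ∣ ≤ (2 + L) * (4 * L + 2) → ¬ ¬ EvenPair G (full ∖ S) L) where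

    -- Disjoint pairs are collected until two of them share the same r.
    collect : ∀ fuel (rs : List (Fin (suc L))) (used : List (Fin n)) → length rs + fuel ≡ 2 + L → Unique rs →
      length used ≤ length rs * (4 * L + 2) → All (λ r → 2 ≤ toℕ r × CycleOn G (2 * toℕ r) ⟨ used ⟩) rs → ⊥
    -- `2 + L` distinct values do not fit into `Fin (suc L)`.
    collect zero rs used len u _ _ = <-irrefl refl (≤-trans
      (≤-reflexive (sym (trans (sym (+-identityʳ _)) len)))
      (≤-trans (Unique⇒length≤ full u (All.tabulate _)) (∣∣≤n full)))
    collect (suc fuel) rs used len u size cycles = next ⟨ used ⟩
      (≤-trans (∣⟨⟩∣ used) (≤-trans size (*-monoˡ-≤ (4 * L + 2) (≤-trans (m≤m+n (length rs) (suc fuel)) (≤-reflexive len)))))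
      step
      where
      step : ¬ EvenPair G (full ∖ ⟨ used ⟩) L
      step p with mem-dec Fin._≟_ (fromℕ< (s≤s (EvenPair.r≤L p))) rs
      -- The short cycle of the earlier pair is combined with the long cycle of the new one.
      ... | yes r∈ = noWin (disjoint-cycles G {⟨ used ⟩} {full ∖ ⟨ used ⟩} r 2≤r
              (subst (λ k → CycleOn G (2 * k) ⟨ used ⟩) (Fin.toℕ-fromℕ< (s≤s r≤L)) (proj₂ (All.lookup cycles r∈)))
              long λ v∈ (_ , v∉) → v∉ v∈)
        where open EvenPair p
      ... | no r∉ = collect fuel (fromℕ< (s≤s r≤L) ∷ rs) used′ (trans (sym (+-suc (length rs) fuel)) len)
            (All.tabulate (λ x∈ → λ { refl → r∉ x∈ }) ∷ u) size′
            ((subst (2 ≤_) (sym r≡) 2≤r ,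
              subst (λ k → CycleOn G (2 * k) ⟨ used′ ⟩) (sym r≡) record
                { vertices = S.vertices ; isCycle = S.isCycle ; inside = λ i → ∈-++⁺ˡ (∈-tabulate⁺ i) })
             ∷ All.map (λ (h , C) → h , CycleOn-⊆ {G = G} {X = ⟨ used ⟩} {⟨ used′ ⟩} (∈-++⁺ʳ vs ∘ ∈-++⁺ʳ vl) C) cycles)
        where
        open EvenPair p
        module S = CycleOn short
        module L′ = CycleOn long
        r≡ = Fin.toℕ-fromℕ< (s≤s r≤L)
        vs = tabulate S.vertices
        vl = tabulate L′.vertices
        used′ = vs ++ vl ++ used
        size′ : length used′ ≤ (4 * L + 2) + length rs * (4 * L + 2)
        size′ = begin
          length used′                             ≡⟨ length-++ vs ⟩
          length vs + length (vl ++ used)          ≡⟨ cong (length vs +_) (length-++ vl) ⟩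
          length vs + (length vl + length used)    ≡⟨ cong₂ (λ a b → a + (b + length used)) (length-tabulate S.vertices) (length-tabulate L′.vertices) ⟩
          2 * r + (2 * r + 2 + length used)        ≡⟨ pair-size r (length used) ⟩
          4 * r + 2 + length used                  ≤⟨ +-mono-≤ (+-monoˡ-≤ 2 (*-monoʳ-≤ 4 r≤L)) size ⟩
          4 * L + 2 + length rs * (4 * L + 2)      ∎
          where
          open ≤-Reasoning

    absurd : ⊥
    absurd = collect (2 + L) [] [] refl [] z≤n []

-- Polylogarithmic parameters and the conclusion

poly-diameter : ∀ {E t s} → PolyBounded E → PolyBounded t → PolyBounded s → PolyBounded (λ l → diameter (E l) (t l) (s l))
poly-diameter pE pt ps = poly-const 2 ⊠ (poly-const 1 ⊞ (pt ⊠ (poly-const 6 ⊠ pE) ⊞ poly-const 6 ⊠ pE ⊠ ps))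

poly-bound : ∀ {E t} → PolyBounded E → PolyBounded t → PolyBounded (λ l → Bounds.bound (E l) (t l))
poly-bound {E} {t} pE pt = ps₂ ⊞ poly-diameter pE pt ps₂ ⊞ (pth ⊞ pth)
  where
  ps₁ : PolyBounded (λ l → Bounds.s₁ (E l) (t l))
  ps₁ = poly-const 4 ⊠ pE ⊠ poly-const 1
  pb₂ : PolyBounded (λ l → Bounds.b₂ (E l) (t l))
  pb₂ = ps₁ ⊞ (poly-const 1 ⊞ poly-diameter pE pt ps₁)
  ps₂ : PolyBounded (λ l → Bounds.s₂ (E l) (t l))
  ps₂ = poly-const 4 ⊠ pE ⊠ pb₂
  pth : PolyBounded (λ l → Bounds.threshold (E l) (t l))
  pth = poly-const 4 ⊠ ((poly-const 6 ⊠ pE ⊞ poly-const 1) ⊠ pb₂)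

poly-capacity : ∀ {L} → PolyBounded L → PolyBounded (λ l → (2 + L l) * (4 * L l + 2))
poly-capacity pL = (poly-const 2 ⊞ pL) ⊠ (poly-const 4 ⊠ pL ⊞ poly-const 2)

poly-overhead : ∀ {σ} → PolyBounded σ → PolyBounded (λ l → overhead (σ l))
poly-overhead pσ = pσ ⊠ pσ ⊞ poly-const 2 ⊠ (pσ ⊠ (poly-const 8 ⊠ poly-^ 4 pσ))
      ⊞ poly-const 2 ⊠ (pσ ⊠ (poly-const 8 ⊠ poly-^ 5 pσ)) ⊞ pW ⊠ pW
  where pW = poly-const 16 ⊠ poly-^ 2 pσ ⊠ pσ ⊠ pσ

PolyBounded⇒<exp : ∀ {f} → PolyBounded f → ∃[ l₀ ] (∀ l → l₀ ≤ l → f l < 2 ^ l)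
PolyBounded⇒<exp (C , k , h) = let l₀ , small = poly<exp k C in l₀ , λ l l₀≤l → ≤-<-trans (h l) (small l l₀≤l)

-- With `E = 16 * q * τ` the level, at most `τ`, adds at most `1 / (16 * q)` to the density 2, so a
-- violation of the bound meets the hypothesis of `bipartite-evenPair`.
bipartite-bound : ∀ q τ t {n} (G : Graph n) → 1 ≤ q → 1 ≤ τ → n < 2 ^ t → level n ≤ τ →
  ∀ S → ¬ EvenPair G (full ∖ S) (Bounds.bound (16 * q * τ) t) →
  ∀ χ U → (∀ {v} → v ∈ U → v ∉ S) → 16 * q * Bipartite.e G χ U ≤ (32 * q + 1) * ∣ U ∣
bipartite-bound q τ t G 1≤q 1≤τ n< level≤τ S noPair χ U U∉S with 16 * q * Bipartite.e G χ U ≤? (32 * q + 1) * ∣ U ∣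
... | yes p = p
... | no p = ⊥-elim (Bipartite.bipartite-evenPair G χ (16 * q * τ) t (*-mono-≤ 1≤16q 1≤τ) n< U
        (≤-trans level-U (m≤n*m τ (16 * q) {{>-nonZero 1≤16q}})) rich
        (noPair ∘ EvenPair-weaken {G = G} {X = U} {full ∖ S} (λ v∈ → _ , U∉S v∈) ≤-refl))
  where
  level-U : level ∣ U ∣ ≤ τ
  level-U = ≤-trans (level-mono (∣∣≤n U)) level≤τ
  1≤16q : 1 ≤ 16 * q
  1≤16q = ≤-trans 1≤q (m≤n*m q 16)
  rich : (2 * (16 * q * τ) + level ∣ U ∣) * ∣ U ∣ < 16 * q * τ * Bipartite.e G χ U
  rich = begin-strict
    (2 * (16 * q * τ) + level ∣ U ∣) * ∣ U ∣    ≤⟨ *-monoˡ-≤ ∣ U ∣ (+-monoʳ-≤ (2 * (16 * q * τ)) level-U) ⟩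
    (2 * (16 * q * τ) + τ) * ∣ U ∣              ≡⟨ eq₁ q τ ∣ U ∣ ⟩
    τ * ((32 * q + 1) * ∣ U ∣)                  <⟨ *-monoʳ-< τ {{>-nonZero 1≤τ}} (≰⇒> p) ⟩
    τ * (16 * q * Bipartite.e G χ U)            ≡⟨ eq₂ q τ (Bipartite.e G χ U) ⟩
    16 * q * τ * Bipartite.e G χ U              ∎
    where
    open ≤-Reasoning
    eq₁ : ∀ q τ u → (2 * (16 * q * τ) + τ) * u ≡ τ * ((32 * q + 1) * u)
    eq₁ = solve-∀
    eq₂ : ∀ q τ f → τ * (16 * q * f) ≡ 16 * q * τ * f
    eq₂ = solve-∀

-- Decidability allows arguing by contradiction: either the greedy packing succeeds, or it is
-- blocked by a set of at most `(2 + L) * (4 * L + 2)` vertices, off which the edge count applies.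
dense⇒cycles : ∀ q L {n} (G : Graph n) →
  (∀ S → ¬ EvenPair G (full ∖ S) L →
    ∀ χ U → (∀ {v} → v ∈ U → v ∉ S) → 16 * q * Bipartite.e G χ U ≤ (32 * q + 1) * ∣ U ∣) →
  8 * q * overhead ((2 + L) * (4 * L + 2)) < n → (14 * q + 1) * n ≤ q * degreeSum G → HasConsecutiveEvenCycles G
dense⇒cycles q L {n} G bip big avg = decidable-stable (hasConsecutiveEvenCycles? G) λ noWin →
  Packing.absurd G noWin L λ S S≤ noPair →
    Dense.impossible G noWin q ((2 + L) * (4 * L + 2)) S S≤ (bip S noPair) big
      (subst (λ s → (14 * q + 1) * n ≤ q * s) (degreeSum≡d G) avg)

-- Here `l` is the integer part of the binary logarithm of the order, so `suc l` bounds the number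
-- of doublings and `3 * suc l` the level.
pairLength : ℕ → ℕ → ℕ
pairLength q l = Bounds.bound (16 * q * (3 * suc l)) (suc l)

overhead-negligible : ∀ q → ∃[ l₀ ] (∀ l → l₀ ≤ l → 8 * q * overhead ((2 + pairLength q l) * (4 * pairLength q l + 2)) < 2 ^ l)
overhead-negligible q = PolyBounded⇒<exp {λ l → 8 * q * overhead (capacity l)}
  (_⊠_ {λ _ → 8 * q} {λ l → overhead (capacity l)} (poly-const (8 * q))
    (poly-overhead {capacity} (poly-capacity {pairLength q} pL)))
  where
  capacity : ℕ → ℕ
  capacity l = (2 + pairLength q l) * (4 * pairLength q l + 2)
  pE : PolyBounded (λ l → 16 * q * (3 * suc l))
  pE = poly-const (16 * q) ⊠ (poly-const 3 ⊠ poly-suc)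
  pL : PolyBounded (pairLength q)
  pL = poly-bound {λ l → 16 * q * (3 * suc l)} {suc} pE poly-suc

cycles-beyond : ∀ p q → 0 < p → 0 < q →
  ∃[ l₀ ] (∀ l → l₀ ≤ l → 8 * q * overhead ((2 + pairLength q l) * (4 * pairLength q l + 2)) < 2 ^ l) →
  ∃[ N ] (∀ n → N ≤ n → (G : Graph n) → AvgDegreeAtLeast14Plus G p q → HasConsecutiveEvenCycles G)
cycles-beyond p q 0<p 0<q (l₀ , small) = 2 ^ l₀ , λ n N≤n G avg →
  let l , lo , hi = binary-size n (≤-trans (m^n>0 2 l₀) N≤n)
      l₀≤l = ≮⇒≥ λ l<l₀ → <-irrefl refl (<-≤-trans hi (≤-trans (^-monoʳ-≤ 2 l<l₀) N≤n))
  in dense⇒cycles q (pairLength q l) G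
       (bipartite-bound q (3 * suc l) (suc l) G 0<q (s≤s z≤n) hi (level≤ hi))
       (<-≤-trans (small l l₀≤l) lo)
       -- As `p` is at least 1, the excess p/q may be lowered to 1/q.
       (≤-trans (*-monoˡ-≤ n (+-monoʳ-≤ (14 * q) 0<p)) avg)

theorem5p1 : (p q : ℕ) → 0 < p → 0 < q →
    ∃[ N ] (∀ (n : ℕ) → N ≤ n → (G : Graph n) →
    AvgDegreeAtLeast14Plus G p q → HasConsecutiveEvenCycles G)
theorem5p1 p q 0<p 0<q = cycles-beyond p q 0<p 0<q (overhead-negligible q)
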